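{- Let $n\ge 1$ and let $X$ be a finite pure $n$-dimensional simplicial complex with connected links, equipped with the homogeneous weight function $m$. Assume that $X$ is $K$-regular in the following sense: every vertex $\{v\}\in X(0)$ is contained in exactly $K$ $n$-dimensional simplices of $X$, i.e. $m(\{v\})=n!\,K$. Assume that there is a constant $0<\lambda<1$ such that for every $0\le k\le n-1$ and every $\tau\in X(k-1)$, $\mathrm{Spec}((M')^+_{\tau,0})\subseteq[-\lambda,\lambda]\cup\{1\}$. Then for all pairwise disjoint sets $U_0,\dots,U_n\subseteq X(0)$, $$\left| |X(U_0,\dots,U_n)|-\frac{n!\,K}{|X(0)|^n}|U_0||U_1|\cdots|U_n|\right|\le C_n\,n!\,\lambda K\min_{0\le i<j\le n}\sqrt{|U_i||U_j|},$$ and $$\left|\frac{|X(U_0,\dots,U_n)|}{|X(n)|}-(n+1)!\,\frac{|U_0||U_1|\cdots|U_n|}{|X(0)|^{n+1}}\right|\le C_n\,(n+1)!\,\lambda\min_{0\le i<j\le n}\sqrt{\frac{|U_i||U_j|}{|X(0)|^2}},$$ where $$C_n=\sum_{k=0}^{n-1}\left((k+1)(k+2)^{n-k}-(k+1)^{n-k+1}\right).$$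
   Context: $X(k)$ denotes the set of simplices of $X$ with $k+1$ vertices, $X(-1)=\{\emptyset\}$; a vertex $v$ is identified with $\{v\}\in X(0)$. $X$ is pure $n$-dimensional if every simplex is contained in a simplex of $X(n)$. For $\tau\in X(k)$ the link $X_\tau$ is the complex with $\eta\in X_\tau(l)$ iff $\eta\in X(l)$ and $\tau\cup\eta\in X(k+l+1)$; $X_\emptyset=X$. "Connected links" means that for every $-1\le k\le n-2$ and every $\tau\in X(k)$ the one-skeleton of $X_\tau$ (the graph with vertices $X_\tau(0)$ and edges $X_\tau(1)$) is connected; in particular the one-skeleton of $X$ is connected. Homogeneous weight: for $-1\le k\le n$ and $\tau\in X(k)$, $m(\tau)=(n-k)!\,|\{\sigma\in X(n):\tau\subseteq\sigma\}|$. On the link, $m_\tau(\eta)=m(\tau\cup\eta)$. The weighted random walk operator $(M')^+_{\tau,0}$ acts on functions $\phi:X_\tau(0)\to\mathbb{R}$ by $$(M')^+_{\tau,0}\phi(v)=\sum_{u:\{u,v\}\in X_\tau(1)}\frac{m_\tau(\{u,v\})}{m_\tau(\{v\})}\phi(u).$$ For pairwise disjoint $U_0,\dots,U_n\subseteq X(0)$, $X(U_0,\dots,U_n)=\{\sigma\in X(n):|\sigma\cap U_i|=1\text{ for all }0\le i\le n\}$. -}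

module Defs where

open import Data.Fin.Base using (Fin; zero; suc)
import Data.Fin.Properties as Fin
open import Data.Fin.Subset
open import Data.Fin.Subset.Properties hiding (_∈?_)
open import Data.Integer.Base as ℤ using (ℤ; +_)
import Data.Integer.Properties as ℤ
import Data.Integer.Solver as ℤSolver
open import Data.List.Base as List using (List; []; _∷_; _++_; allFin; filter; length)
open import Data.Nat.Base as ℕ using (ℕ; zero; suc)
import Data.Nat.Properties as ℕ
import Data.Nat.Solver as ℕSolver
open import Data.Product.Base using (_×_; _,_; ∃-syntax; uncurry)
open import Data.Rational.Base as ℚ using (ℚ; mkℚ; 0ℚ; 1ℚ; ↥_; ↧ₙ_)
import Data.Rational.Properties as ℚ
open import Data.Rational.Unnormalised.Base as ℚᵘ using (mkℚᵘ; *≤*)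
import Data.Rational.Unnormalised.Properties as ℚᵘ
import Data.Rational.Solver as ℚSolver
open import Data.Sum.Base using (_⊎_; inj₁; inj₂)
open import Data.Vec.Base using ([]; _∷_; here)
open import Level using (0ℓ)
open import Relation.Binary.Construct.Closure.ReflexiveTransitive using (Star)
open import Relation.Binary.PropositionalEquality
open import Relation.Nullary using (¬_; yes; no; _×-dec_; contradiction)
open import Relation.Unary using (Pred; Decidable)

------------------------------------------------------------------------
-- Real numbers: Cauchy sequences of rationals with a modulus.  Equality
-- is the setoid equality _≃_.

private
  variable
    p q r s ε : ℚ

  ∣-∣≤⁺ : p ℚ.≤ q ℚ.+ ε → q ℚ.≤ p ℚ.+ ε → ℚ.∣ p ℚ.- q ∣ ℚ.≤ ε
  ∣-∣≤⁺ {p} {q} {ε} p≤ q≤ with ℚ.∣p∣≡p∨∣p∣≡-p (p ℚ.- q)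
  ... | inj₁ eq = begin
    ℚ.∣ p ℚ.- q ∣       ≡⟨ eq ⟩
    p ℚ.- q             ≤⟨ ℚ.+-monoˡ-≤ (ℚ.- q) p≤ ⟩
    q ℚ.+ ε ℚ.- q       ≡⟨ solve 2 (λ q e → q :+ e :- q := e) refl q ε ⟩
    ε                   ∎
    where
    open ℚ.≤-Reasoning
    open ℚSolver.+-*-Solver
  ... | inj₂ eq = begin
    ℚ.∣ p ℚ.- q ∣       ≡⟨ eq ⟩
    ℚ.- (p ℚ.- q)       ≡⟨ solve 2 (λ p q → :- (p :- q) := q :- p) refl p q ⟩
    q ℚ.- p             ≤⟨ ℚ.+-monoˡ-≤ (ℚ.- p) q≤ ⟩
    p ℚ.+ ε ℚ.- p       ≡⟨ solve 2 (λ q e → q :+ e :- q := e) refl p ε ⟩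
    ε                   ∎
    where
    open ℚ.≤-Reasoning
    open ℚSolver.+-*-Solver

  p≤∣p∣ : ∀ p → p ℚ.≤ ℚ.∣ p ∣
  p≤∣p∣ p with ℚ.≤-total 0ℚ p
  ... | inj₁ 0≤p = ℚ.≤-reflexive (sym (ℚ.0≤p⇒∣p∣≡p 0≤p))
  ... | inj₂ p≤0 = ℚ.≤-trans p≤0 (ℚ.0≤∣p∣ p)

  ∣-∣≤⁻ : ∀ p q → ℚ.∣ p ℚ.- q ∣ ℚ.≤ ε → p ℚ.≤ q ℚ.+ ε
  ∣-∣≤⁻ {ε} p q h = begin
    p                   ≡⟨ solve 2 (λ p q → p := q :+ (p :- q)) refl p q ⟩
    q ℚ.+ (p ℚ.- q)     ≤⟨ ℚ.+-monoʳ-≤ q (ℚ.≤-trans (p≤∣p∣ (p ℚ.- q)) h) ⟩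
    q ℚ.+ ε             ∎
    where
    open ℚ.≤-Reasoning
    open ℚSolver.+-*-Solver

  *-mono-≤ : 0ℚ ℚ.≤ p → 0ℚ ℚ.≤ s → p ℚ.≤ q → r ℚ.≤ s → p ℚ.* r ℚ.≤ q ℚ.* s
  *-mono-≤ {p} {s} {q} {r} 0≤p 0≤s p≤q r≤s = ℚ.≤-trans
    (ℚ.*-monoˡ-≤-nonNeg p {{ℚ.nonNegative 0≤p}} r≤s)
    (ℚ.*-monoʳ-≤-nonNeg s {{ℚ.nonNegative 0≤s}} p≤q)

  -- Chosen so that  half ε + half ε ≡ ε.
  half : ℚ → ℚ
  half ε = ℚ.½ ℚ.* ε

  half-+ : ∀ ε → half ε ℚ.+ half ε ≡ ε
  half-+ ε = trans (sym (ℚ.*-distribʳ-+ ε ℚ.½ ℚ.½)) (ℚ.*-identityˡ ε)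

  half-pos : 0ℚ ℚ.< ε → 0ℚ ℚ.< half ε
  half-pos {ε} ε>0 = ℚ.positive⁻¹ (half ε)
    {{ℚ.pos*pos⇒pos ℚ.½ ε {{ℚ.positive ε>0}}}}

IsCauchy : (ℕ → ℚ) → Set
IsCauchy x = ∀ ε → 0ℚ ℚ.< ε →
  ∃[ N ] ∀ m n → N ℕ.≤ m → N ℕ.≤ n → ℚ.∣ x m ℚ.- x n ∣ ℚ.≤ ε

record ℝ : Set where
  constructor mkℝ
  field
    seq    : ℕ → ℚ
    cauchy : IsCauchy seq

open ℝ public

infix 4 _≤ℝ_ _<ℝ_ _≃_

_≤ℝ_ : ℝ → ℝ → Set
x ≤ℝ y = ∀ ε → 0ℚ ℚ.< ε → ∃[ N ] ∀ n → N ℕ.≤ n → seq x n ℚ.≤ seq y n ℚ.+ ε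

_<ℝ_ : ℝ → ℝ → Set
x <ℝ y = ∃[ ε ] 0ℚ ℚ.< ε × ∃[ N ] ∀ n → N ℕ.≤ n → seq x n ℚ.+ ε ℚ.≤ seq y n

_≃_ : ℝ → ℝ → Set
x ≃ y = x ≤ℝ y × y ≤ℝ x

fromℚ : ℚ → ℝ
fromℚ p = mkℝ (λ _ → p) λ ε ε>0 → 0 , λ _ _ _ _ →
  subst (ℚ._≤ ε) (sym (cong ℚ.∣_∣ (ℚ.+-inverseʳ p))) (ℚ.<⇒≤ ε>0)

0ℝ 1ℝ : ℝ
0ℝ = fromℚ 0ℚ
1ℝ = fromℚ 1ℚ

infix  8 -ℝ_
infixl 7 _*ℝ_ _⊓ℝ_
infixl 6 _+ℝ_

-ℝ_ : ℝ → ℝ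
-ℝ x = mkℝ (λ n → ℚ.- seq x n) λ ε ε>0 →
  let N , h = cauchy x ε ε>0 in
  N , λ m n N≤m N≤n → subst (ℚ._≤ ε) (eq (seq x m) (seq x n)) (h m n N≤m N≤n)
  where
  open ℚSolver.+-*-Solver
  eq : ∀ p q → ℚ.∣ p ℚ.- q ∣ ≡ ℚ.∣ ℚ.- p ℚ.- ℚ.- q ∣
  eq p q = trans (sym (ℚ.∣-p∣≡∣p∣ (p ℚ.- q)))
    (cong ℚ.∣_∣ (solve 2 (λ p q → :- (p :- q) := :- p :- :- q) refl p q))

_+ℝ_ : ℝ → ℝ → ℝ
x +ℝ y = mkℝ (λ n → seq x n ℚ.+ seq y n) λ ε ε>0 →
  let N₁ , h₁ = cauchy x (half ε) (half-pos ε>0)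
      N₂ , h₂ = cauchy y (half ε) (half-pos ε>0)
  in N₁ ℕ.⊔ N₂ , λ m n N≤m N≤n → begin
    ℚ.∣ (seq x m ℚ.+ seq y m) ℚ.- (seq x n ℚ.+ seq y n) ∣
      ≡⟨ cong ℚ.∣_∣ (solve 4 (λ a b c d → (a :+ b) :- (c :+ d) := (a :- c) :+ (b :- d))
           refl (seq x m) (seq y m) (seq x n) (seq y n)) ⟩
    ℚ.∣ (seq x m ℚ.- seq x n) ℚ.+ (seq y m ℚ.- seq y n) ∣
      ≤⟨ ℚ.∣p+q∣≤∣p∣+∣q∣ (seq x m ℚ.- seq x n) (seq y m ℚ.- seq y n) ⟩
    ℚ.∣ seq x m ℚ.- seq x n ∣ ℚ.+ ℚ.∣ seq y m ℚ.- seq y n ∣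
      ≤⟨ ℚ.+-mono-≤
           (h₁ m n (ℕ.m⊔n≤o⇒m≤o N₁ N₂ N≤m) (ℕ.m⊔n≤o⇒m≤o N₁ N₂ N≤n))
           (h₂ m n (ℕ.m⊔n≤o⇒n≤o N₁ N₂ N≤m) (ℕ.m⊔n≤o⇒n≤o N₁ N₂ N≤n)) ⟩
    half ε ℚ.+ half ε
      ≡⟨ half-+ ε ⟩
    ε ∎
  where
  open ℚ.≤-Reasoning
  open ℚSolver.+-*-Solver

_⊓ℝ_ : ℝ → ℝ → ℝ
x ⊓ℝ y = mkℝ (λ n → seq x n ℚ.⊓ seq y n) λ ε ε>0 →
  let N₁ , h₁ = cauchy x ε ε>0
      N₂ , h₂ = cauchy y ε ε>0
      step : ∀ m n → N₁ ℕ.⊔ N₂ ℕ.≤ m → N₁ ℕ.⊔ N₂ ℕ.≤ n →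
             seq x m ℚ.⊓ seq y m ℚ.≤ seq x n ℚ.⊓ seq y n ℚ.+ ε
      step m n N≤m N≤n = subst (seq x m ℚ.⊓ seq y m ℚ.≤_)
        (sym (ℚ.mono-≤-distrib-⊓ (ℚ.+-monoˡ-≤ ε) (seq x n) (seq y n)))
        (ℚ.⊓-mono-≤
          (∣-∣≤⁻ (seq x m) (seq x n) (h₁ m n (ℕ.m⊔n≤o⇒m≤o N₁ N₂ N≤m) (ℕ.m⊔n≤o⇒m≤o N₁ N₂ N≤n)))
          (∣-∣≤⁻ (seq y m) (seq y n) (h₂ m n (ℕ.m⊔n≤o⇒n≤o N₁ N₂ N≤m) (ℕ.m⊔n≤o⇒n≤o N₁ N₂ N≤n))))
  in N₁ ℕ.⊔ N₂ , λ m n N≤m N≤n → ∣-∣≤⁺ (step m n N≤m N≤n) (step n m N≤n N≤m)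

private
  EventuallyBounded : (ℕ → ℚ) → Set
  EventuallyBounded x = ∃[ B ] 0ℚ ℚ.< B × ∃[ N ] ∀ n → N ℕ.≤ n → ℚ.∣ x n ∣ ℚ.≤ B

  bounded : ∀ x → EventuallyBounded (seq x)
  bounded x with cauchy x 1ℚ (ℚ.positive⁻¹ 1ℚ)
  ... | N , h = ℚ.∣ seq x N ∣ ℚ.+ 1ℚ
    , ℚ.+-mono-≤-< (ℚ.0≤∣p∣ (seq x N)) (ℚ.positive⁻¹ 1ℚ)
    , N , λ n N≤n → begin
    ℚ.∣ seq x n ∣
      ≡⟨ cong ℚ.∣_∣ (solve 2 (λ a b → a := b :+ (a :- b)) refl (seq x n) (seq x N)) ⟩
    ℚ.∣ seq x N ℚ.+ (seq x n ℚ.- seq x N) ∣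
      ≤⟨ ℚ.∣p+q∣≤∣p∣+∣q∣ (seq x N) (seq x n ℚ.- seq x N) ⟩
    ℚ.∣ seq x N ∣ ℚ.+ ℚ.∣ seq x n ℚ.- seq x N ∣
      ≤⟨ ℚ.+-monoʳ-≤ ℚ.∣ seq x N ∣ (h n N N≤n ℕ.≤-refl) ⟩
    ℚ.∣ seq x N ∣ ℚ.+ 1ℚ ∎
    where
    open ℚ.≤-Reasoning
    open ℚSolver.+-*-Solver

_*ℝ_ : ℝ → ℝ → ℝ
x *ℝ y = mkℝ (λ n → seq x n ℚ.* seq y n) λ ε ε>0 →
  let B , B>0 , M₁ , bx = bounded x
      C , C>0 , M₂ , by = bounded y
      D     = B ℚ.+ C
      instance
        D-pos : ℚ.Positive D
        D-pos = ℚ.positive (ℚ.+-mono-< B>0 C>0)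
        D≢0 : ℚ.NonZero D
        D≢0 = ℚ.pos⇒nonZero D
      δ     = ε ℚ.* ℚ.1/ D
      δ>0   = ℚ.positive⁻¹ δ
                {{ℚ.pos*pos⇒pos ε {{ℚ.positive ε>0}} (ℚ.1/ D) {{ℚ.1/pos⇒pos D}}}}
      N₁ , h₁ = cauchy x δ δ>0
      N₂ , h₂ = cauchy y δ δ>0
      M = M₁ ℕ.⊔ M₂
      N = N₁ ℕ.⊔ N₂
  in M ℕ.⊔ N , λ m n K≤m K≤n →
  let M≤m = ℕ.m⊔n≤o⇒m≤o M N K≤m
      M≤n = ℕ.m⊔n≤o⇒m≤o M N K≤n
      N≤m = ℕ.m⊔n≤o⇒n≤o M N K≤m
      N≤n = ℕ.m⊔n≤o⇒n≤o M N K≤n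
      a = seq x m; b = seq y m; c = seq x n; d = seq y n
  in begin
    ℚ.∣ a ℚ.* b ℚ.- c ℚ.* d ∣
      ≡⟨ cong ℚ.∣_∣ (solve 4 (λ a b c d → a :* b :- c :* d := a :* (b :- d) :+ d :* (a :- c))
           refl a b c d) ⟩
    ℚ.∣ a ℚ.* (b ℚ.- d) ℚ.+ d ℚ.* (a ℚ.- c) ∣
      ≤⟨ ℚ.∣p+q∣≤∣p∣+∣q∣ (a ℚ.* (b ℚ.- d)) (d ℚ.* (a ℚ.- c)) ⟩
    ℚ.∣ a ℚ.* (b ℚ.- d) ∣ ℚ.+ ℚ.∣ d ℚ.* (a ℚ.- c) ∣
      ≡⟨ cong₂ ℚ._+_ (ℚ.∣p*q∣≡∣p∣*∣q∣ a (b ℚ.- d)) (ℚ.∣p*q∣≡∣p∣*∣q∣ d (a ℚ.- c)) ⟩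
    ℚ.∣ a ∣ ℚ.* ℚ.∣ b ℚ.- d ∣ ℚ.+ ℚ.∣ d ∣ ℚ.* ℚ.∣ a ℚ.- c ∣
      ≤⟨ ℚ.+-mono-≤
           (*-mono-≤ (ℚ.0≤∣p∣ a) (ℚ.<⇒≤ δ>0) (bx m (ℕ.m⊔n≤o⇒m≤o M₁ M₂ M≤m))
             (h₂ m n (ℕ.m⊔n≤o⇒n≤o N₁ N₂ N≤m) (ℕ.m⊔n≤o⇒n≤o N₁ N₂ N≤n)))
           (*-mono-≤ (ℚ.0≤∣p∣ d) (ℚ.<⇒≤ δ>0) (by n (ℕ.m⊔n≤o⇒n≤o M₁ M₂ M≤n))
             (h₁ m n (ℕ.m⊔n≤o⇒m≤o N₁ N₂ N≤m) (ℕ.m⊔n≤o⇒m≤o N₁ N₂ N≤n))) ⟩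
    B ℚ.* δ ℚ.+ C ℚ.* δ
      ≡⟨ solve 4 (λ B C e i → B :* (e :* i) :+ C :* (e :* i) := e :* ((B :+ C) :* i))
           refl B C ε (ℚ.1/ D) ⟩
    ε ℚ.* (D ℚ.* ℚ.1/ D)
      ≡⟨ cong (ε ℚ.*_) (ℚ.*-inverseʳ D) ⟩
    ε ℚ.* 1ℚ
      ≡⟨ ℚ.*-identityʳ ε ⟩
    ε ∎
  where
  open ℚ.≤-Reasoning
  open ℚSolver.+-*-Solver

fromℤ : ℤ → ℝ
fromℤ i = fromℚ (i ℚ./ 1)

fromℕ : ℕ → ℝ
fromℕ k = fromℤ (+ k)

-- Total division of naturals; division by zero gives 0.
infixl 7 _÷_
_÷_ : ℕ → ℕ → ℚ
a ÷ zero  = 0ℚ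
a ÷ suc b = + a ℚ./ suc b

-- isqrt k is the integer part of the square root of k.
isqrt : ℕ → ℕ
isqrt zero    = 0
isqrt (suc k) with suc (isqrt k) ℕ.* suc (isqrt k) ℕ.≤? suc k
... | yes _ = suc (isqrt k)
... | no  _ = isqrt k

isqrt-lower : ∀ k → isqrt k ℕ.* isqrt k ℕ.≤ k
isqrt-lower zero    = ℕ.z≤n
isqrt-lower (suc k) with suc (isqrt k) ℕ.* suc (isqrt k) ℕ.≤? suc k
... | yes h = h
... | no  _ = ℕ.m≤n⇒m≤1+n (isqrt-lower k)

isqrt-upper : ∀ k → k ℕ.< suc (isqrt k) ℕ.* suc (isqrt k)
isqrt-upper zero    = ℕ.≤-refl
isqrt-upper (suc k) with suc (isqrt k) ℕ.* suc (isqrt k) ℕ.≤? suc k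
... | yes _ = ℕ.≤-<-trans (isqrt-upper k)
                (ℕ.*-mono-< (ℕ.n<1+n (suc (isqrt k))) (ℕ.n<1+n (suc (isqrt k))))
... | no ¬h = ℕ.≰⇒> ¬h

private
  sq-cancel-≤ : ∀ {a b} → a ℕ.* a ℕ.≤ b ℕ.* b → a ℕ.≤ b
  sq-cancel-≤ {a} {b} h with a ℕ.≤? b
  ... | yes a≤b = a≤b
  ... | no  a≰b = contradiction h (ℕ.<⇒≱ (ℕ.*-mono-< (ℕ.≰⇒> a≰b) (ℕ.≰⇒> a≰b)))

  /-mono : ∀ a b m n → a ℕ.* suc n ℕ.≤ b ℕ.* suc m →
           + a ℚ./ suc m ℚ.≤ + b ℚ./ suc n
  /-mono a b m n h = ℚ.toℚᵘ-cancel-≤ (begin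
    ℚ.toℚᵘ (+ a ℚ./ suc m)  ≃⟨ ℚ.toℚᵘ-fromℚᵘ (mkℚᵘ (+ a) m) ⟩
    mkℚᵘ (+ a) m            ≤⟨ *≤* (subst₂ ℤ._≤_ (ℤ.pos-* a (suc n)) (ℤ.pos-* b (suc m)) (ℤ.+≤+ h)) ⟩
    mkℚᵘ (+ b) n            ≃⟨ ℚ.toℚᵘ-fromℚᵘ (mkℚᵘ (+ b) n) ⟨
    ℚ.toℚᵘ (+ b ℚ./ suc n)  ∎)
    where
    open ℚᵘ.≤-Reasoning

  /-suc : ∀ a n → + suc a ℚ./ suc n ≡ + a ℚ./ suc n ℚ.+ + 1 ℚ./ suc n
  /-suc a n = ℚ.toℚᵘ-injective (begin-equality
    ℚ.toℚᵘ (+ suc a ℚ./ suc n)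
      ≃⟨ ℚ.toℚᵘ-fromℚᵘ (mkℚᵘ (+ suc a) n) ⟩
    mkℚᵘ (+ suc a) n
      ≃⟨ ℚᵘ.*≡* (solve 2 (λ a d → (con (+ 1) :+ a) :* (d :* d) := (a :* d :+ con (+ 1) :* d) :* d)
           refl (+ a) (+ suc n)) ⟩
    mkℚᵘ (+ a) n ℚᵘ.+ mkℚᵘ (+ 1) n
      ≃⟨ ℚᵘ.+-cong (ℚ.toℚᵘ-fromℚᵘ (mkℚᵘ (+ a) n)) (ℚ.toℚᵘ-fromℚᵘ (mkℚᵘ (+ 1) n)) ⟨
    ℚ.toℚᵘ (+ a ℚ./ suc n) ℚᵘ.+ ℚ.toℚᵘ (+ 1 ℚ./ suc n)
      ≃⟨ ℚ.toℚᵘ-homo-+ (+ a ℚ./ suc n) (+ 1 ℚ./ suc n) ⟨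
    ℚ.toℚᵘ (+ a ℚ./ suc n ℚ.+ + 1 ℚ./ suc n) ∎)
    where
    open ℚᵘ.≤-Reasoning
    open ℤSolver.+-*-Solver

-- The square root of a natural number k, approximated from below by
-- ⌊ (n+1) √k ⌋ / (n+1).
√ℕ : ℕ → ℝ
√ℕ k = mkℝ x λ { ε@(mkℚ (+ suc p) d _) ε>0 → d , λ m n d≤m d≤n →
    ∣-∣≤⁺ (ℚ.≤-trans (step m n) (ℚ.+-monoʳ-≤ (x n) (small ε d≤n)))
          (ℚ.≤-trans (step n m) (ℚ.+-monoʳ-≤ (x m) (small ε d≤m)))
  ; (mkℚ (+ zero) _ _) (ℚ.*<* (ℤ.+<+ ()))
  ; (mkℚ ℤ.-[1+ _ ] _ _) (ℚ.*<* ()) }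
  where
  open ℕSolver.+-*-Solver

  num : ℕ → ℕ
  num n = isqrt (k ℕ.* (suc n ℕ.* suc n))

  x : ℕ → ℚ
  x n = + num n ℚ./ suc n

  sq : ∀ a b → (a ℕ.* b) ℕ.* (a ℕ.* b) ≡ (a ℕ.* a) ℕ.* (b ℕ.* b)
  sq = solve 2 (λ a b → (a :* b) :* (a :* b) := (a :* a) :* (b :* b)) refl

  step : ∀ m n → x m ℚ.≤ x n ℚ.+ + 1 ℚ./ suc n
  step m n = subst (x m ℚ.≤_) (/-suc (num n) n) (/-mono (num m) (suc (num n)) m n (sq-cancel-≤ (begin
    (num m ℕ.* suc n) ℕ.* (num m ℕ.* suc n)
      ≡⟨ sq (num m) (suc n) ⟩
    (num m ℕ.* num m) ℕ.* (suc n ℕ.* suc n)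
      ≤⟨ ℕ.*-monoˡ-≤ (suc n ℕ.* suc n) (isqrt-lower (k ℕ.* (suc m ℕ.* suc m))) ⟩
    (k ℕ.* (suc m ℕ.* suc m)) ℕ.* (suc n ℕ.* suc n)
      ≡⟨ solve 3 (λ k a b → (k :* a) :* b := (k :* b) :* a)
           refl k (suc m ℕ.* suc m) (suc n ℕ.* suc n) ⟩
    (k ℕ.* (suc n ℕ.* suc n)) ℕ.* (suc m ℕ.* suc m)
      ≤⟨ ℕ.*-monoˡ-≤ (suc m ℕ.* suc m) (ℕ.<⇒≤ (isqrt-upper (k ℕ.* (suc n ℕ.* suc n)))) ⟩
    (suc (num n) ℕ.* suc (num n)) ℕ.* (suc m ℕ.* suc m)
      ≡⟨ sq (suc (num n)) (suc m) ⟨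
    (suc (num n) ℕ.* suc m) ℕ.* (suc (num n) ℕ.* suc m) ∎)))
    where
    open ℕ.≤-Reasoning

  small : ∀ ε .{{_ : ℚ.Positive ε}} {n} → ℚ.denominator-1 ε ℕ.≤ n → + 1 ℚ./ suc n ℚ.≤ ε
  small ε@(mkℚ (+ suc p) d _) {n} d≤n = subst (+ 1 ℚ./ suc n ℚ.≤_) (ℚ.↥p/↧p≡p ε)
    (/-mono 1 (suc p) n d (begin
      1 ℕ.* suc d     ≡⟨ ℕ.*-identityˡ (suc d) ⟩
      suc d           ≤⟨ ℕ.s≤s d≤n ⟩
      suc n           ≤⟨ ℕ.m≤n*m (suc n) (suc p) ⟩
      suc p ℕ.* suc n ∎))
    where
    open ℕ.≤-Reasoning

-- The square root of a rational p/d ≥ 0, as √(p d) / d.  (For negative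
-- arguments it is the square root of the absolute value.)
√ : ℚ → ℝ
√ q = fromℚ (1 ÷ ↧ₙ q) *ℝ √ℕ (ℤ.∣ ↥ q ∣ ℕ.* ↧ₙ q)

sumℝ : List ℝ → ℝ
sumℝ = List.foldr _+ℝ_ 0ℝ

-- min⟨i<j⟩ f is the minimum of f i j over 0 ≤ i < j ≤ n, for n ≥ 1.  There
-- are no such pairs for n = 0, where the value is immaterial.
min⟨i<j⟩ : ∀ {n} → (Fin (suc n) → Fin (suc n) → ℝ) → ℝ
min⟨i<j⟩ {zero}  f = 0ℝ
min⟨i<j⟩ {suc n} f = List.foldr _⊓ℝ_ (f zero (suc zero))
  (List.map (uncurry f)
    (filter (λ (i , j) → i Fin.<? j) (List.cartesianProduct (allFin _) (allFin _))))

------------------------------------------------------------------------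
-- Finite simplicial complexes, on vertices taken from Fin N.  Elements of
-- Fin N that are not vertices are allowed, so that links are complexes on
-- the same Fin N.

subsets : ∀ N → List (Subset N)
subsets zero    = [] ∷ []
subsets (suc N) = List.map (outside ∷_) (subsets N) ++ List.map (inside ∷_) (subsets N)

count : ∀ {N} {P : Pred (Subset N) 0ℓ} → Decidable P → ℕ
count P? = length (filter P? (subsets _))

record SimplicialComplex (N : ℕ) : Set₁ where
  field
    Simplex  : Pred (Subset N) 0ℓ
    simplex? : Decidable Simplex
    ∅-simp   : Simplex ⊥
    closed   : ∀ {σ τ} → τ ⊆ σ → Simplex σ → Simplex τ

open SimplicialComplex public

private
  variable
    N : ℕ

-- X ⟨ c ⟩ is the set of simplices with c vertices, i.e. X(c-1).
infix 5 _⟨_⟩ _⟨_⟩?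

_⟨_⟩ : SimplicialComplex N → ℕ → Pred (Subset N) 0ℓ
(X ⟨ c ⟩) σ = Simplex X σ × ∣ σ ∣ ≡ c

_⟨_⟩? : (X : SimplicialComplex N) (c : ℕ) → Decidable (X ⟨ c ⟩)
(X ⟨ c ⟩?) σ = simplex? X σ ×-dec (∣ σ ∣ ℕ.≟ c)

private
  ∪-card : ∀ (p q : Subset N) → ∣ p ∪ q ∣ ℕ.≤ ∣ p ∣ ℕ.+ ∣ q ∣
  ∪-card []            []            = ℕ.z≤n
  ∪-card (outside ∷ p) (outside ∷ q) = ∪-card p q
  ∪-card (outside ∷ p) (inside  ∷ q) =
    ℕ.≤-trans (ℕ.s≤s (∪-card p q)) (ℕ.≤-reflexive (sym (ℕ.+-suc ∣ p ∣ ∣ q ∣)))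
  ∪-card (inside  ∷ p) (outside ∷ q) = ℕ.s≤s (∪-card p q)
  ∪-card (inside  ∷ p) (inside  ∷ q) =
    ℕ.s≤s (ℕ.≤-trans (∪-card p q) (ℕ.+-monoʳ-≤ ∣ p ∣ (ℕ.n≤1+n ∣ q ∣)))

  ∪-card-⊆ : ∀ (p : Subset N) {q r} → r ⊆ q →
             ∣ p ∪ q ∣ ≡ ∣ p ∣ ℕ.+ ∣ q ∣ → ∣ p ∪ r ∣ ≡ ∣ p ∣ ℕ.+ ∣ r ∣
  ∪-card-⊆ [] {[]} {[]} _ _ = refl
  ∪-card-⊆ (inside ∷ p) {inside ∷ q} {_ ∷ r} _ eq = contradiction
    (trans (ℕ.suc-injective eq) (ℕ.+-suc ∣ p ∣ ∣ q ∣)) (ℕ.<⇒≢ (ℕ.s≤s (∪-card p q)))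
  ∪-card-⊆ (inside ∷ p) {outside ∷ q} {outside ∷ r} r⊆q eq =
    cong suc (∪-card-⊆ p (drop-∷-⊆ r⊆q) (ℕ.suc-injective eq))
  ∪-card-⊆ (outside ∷ p) {inside ∷ q} {inside ∷ r} r⊆q eq = trans
    (cong suc (∪-card-⊆ p (drop-∷-⊆ r⊆q) (ℕ.suc-injective (trans eq (ℕ.+-suc ∣ p ∣ ∣ q ∣)))))
    (sym (ℕ.+-suc ∣ p ∣ ∣ r ∣))
  ∪-card-⊆ (outside ∷ p) {inside ∷ q} {outside ∷ r} r⊆q eq =
    ∪-card-⊆ p (drop-∷-⊆ r⊆q) (ℕ.suc-injective (trans eq (ℕ.+-suc ∣ p ∣ ∣ q ∣)))
  ∪-card-⊆ (outside ∷ p) {outside ∷ q} {outside ∷ r} r⊆q eq = ∪-card-⊆ p (drop-∷-⊆ r⊆q) eq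
  ∪-card-⊆ (_ ∷ p) {outside ∷ q} {inside ∷ r} r⊆q eq with () ← r⊆q here

-- The cardinality condition says that τ and η are disjoint: τ ∪ η has
-- k+l+2 vertices when τ has k+1 and η has l+1.
link : (X : SimplicialComplex N) {τ : Subset N} → Simplex X τ → SimplicialComplex N
link {N} X {τ} τ∈X = record
  { Simplex  = λ η → Simplex X η × Simplex X (τ ∪ η) × ∣ τ ∪ η ∣ ≡ ∣ τ ∣ ℕ.+ ∣ η ∣
  ; simplex? = λ η → simplex? X η ×-dec simplex? X (τ ∪ η)
                       ×-dec (∣ τ ∪ η ∣ ℕ.≟ ∣ τ ∣ ℕ.+ ∣ η ∣)
  ; ∅-simp   = ∅-simp X
             , subst (Simplex X) (sym (∪-identityʳ τ)) τ∈X
             , (begin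
                 ∣ τ ∪ ⊥ ∣         ≡⟨ cong ∣_∣ (∪-identityʳ τ) ⟩
                 ∣ τ ∣             ≡⟨ ℕ.+-identityʳ ∣ τ ∣ ⟨
                 ∣ τ ∣ ℕ.+ 0       ≡⟨ cong (∣ τ ∣ ℕ.+_) (∣⊥∣≡0 N) ⟨
                 ∣ τ ∣ ℕ.+ ∣ ⊥ {N} ∣ ∎)
  ; closed   = λ ζ⊆η (η∈X , τη∈X , eq) →
                 closed X ζ⊆η η∈X
               , closed X (∪-mono ζ⊆η) τη∈X
               , ∪-card-⊆ τ ζ⊆η eq
  }
  where
  open ≡-Reasoning
  ∪-mono : ∀ {ζ η} → ζ ⊆ η → τ ∪ ζ ⊆ τ ∪ η
  ∪-mono {ζ} {η} ζ⊆η v∈ with x∈p∪q⁻ τ ζ v∈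
  ... | inj₁ v∈τ = x∈p∪q⁺ (inj₁ v∈τ)
  ... | inj₂ v∈ζ = x∈p∪q⁺ (inj₂ (ζ⊆η v∈ζ))

Pure : SimplicialComplex N → ℕ → Set
Pure X n = ∀ τ → Simplex X τ → ∃[ σ ] (X ⟨ suc n ⟩) σ × τ ⊆ σ

IsVertex : SimplicialComplex N → Fin N → Set
IsVertex X v = (X ⟨ 1 ⟩) ⁅ v ⁆

-- The condition that ⁅ u ⁆ ∪ ⁅ v ⁆ has two vertices excludes u = v.
IsEdge : SimplicialComplex N → Fin N → Fin N → Set
IsEdge X u v = (X ⟨ 2 ⟩) (⁅ u ⁆ ∪ ⁅ v ⁆)

Connected₁ : SimplicialComplex N → Set
Connected₁ X = ∀ u v → IsVertex X u → IsVertex X v → Star (IsEdge X) u v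

-- The index c = k+1 ranges over 0 ≤ c ≤ n-1, i.e. -1 ≤ k ≤ n-2.
ConnectedLinks : SimplicialComplex N → ℕ → Set
ConnectedLinks X n = ∀ c {τ} → c ℕ.< n → ((τ∈X , _) : (X ⟨ c ⟩) τ) → Connected₁ (link X τ∈X)

degree : SimplicialComplex N → ℕ → Subset N → ℕ
degree X n τ = count (λ σ → (X ⟨ suc n ⟩?) σ ×-dec τ ⊆? σ)

-- The homogeneous weight: for τ ∈ X(k) one has n-k = n+1-∣τ∣.
weight : SimplicialComplex N → ℕ → Subset N → ℕ
weight X n τ = (suc n ℕ.∸ ∣ τ ∣) ℕ.! ℕ.* degree X n τ

Regular : SimplicialComplex N → ℕ → ℕ → Set
Regular X n K = ∀ v → IsVertex X v → degree X n ⁅ v ⁆ ≡ K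

module _ (X : SimplicialComplex N) (n : ℕ) {τ : Subset N} (τ∈X : Simplex X τ) where

  linkWeight : Subset N → ℕ
  linkWeight η = weight X n (τ ∪ η)

  -- The random walk operator of the link.  Functions on the vertices of the
  -- link are represented by functions on Fin N; only the values at vertices
  -- of the link matter.  The denominator is non-zero at those vertices
  -- when X is pure.
  walk : (Fin N → ℝ) → Fin N → ℝ
  walk φ v = sumℝ (List.map
    (λ u → fromℚ (linkWeight (⁅ u ⁆ ∪ ⁅ v ⁆) ÷ linkWeight ⁅ v ⁆) *ℝ φ u)
    (filter (λ u → (link X τ∈X ⟨ 2 ⟩?) (⁅ u ⁆ ∪ ⁅ v ⁆)) (allFin N)))

  -- μ is an eigenvalue of the walk operator; the space of functions is
  -- finite-dimensional, so these are the elements of the spectrum.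
  InSpec : ℝ → Set
  InSpec μ = ∃[ φ ]
      ¬ (∀ v → IsVertex (link X τ∈X) v → φ v ≃ 0ℝ)
    × (∀ v → IsVertex (link X τ∈X) v → walk φ v ≃ μ *ℝ φ v)

Transversal : ∀ {n} → SimplicialComplex N → (Fin (suc n) → Subset N) → Pred (Subset N) 0ℓ
Transversal {n = n} X U σ = (X ⟨ suc n ⟩) σ × ∀ i → ∣ σ ∩ U i ∣ ≡ 1

#Transversal : ∀ {n} → SimplicialComplex N → (Fin (suc n) → Subset N) → ℕ
#Transversal {n = n} X U =
  count {P = Transversal X U}
    (λ σ → (X ⟨ suc n ⟩?) σ ×-dec Fin.all? (λ i → ∣ σ ∩ U i ∣ ℕ.≟ 1))

∏∣_∣ : ∀ {n} → (Fin n → Subset N) → ℕ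
∏∣ U ∣ = List.foldr ℕ._*_ 1 (List.map (λ i → ∣ U i ∣) (allFin _))

C : ℕ → ℤ
C n = List.foldr ℤ._+_ (+ 0) (List.map term (List.upTo n))
  where
  term : ℕ → ℤ
  term k = + ((k ℕ.+ 1) ℕ.* (k ℕ.+ 2) ℕ.^ (n ℕ.∸ k))
         ℤ.- + ((k ℕ.+ 1) ℕ.^ (n ℕ.∸ k ℕ.+ 1))

{-# OPTIONS --safe #-}
{-
Let w(v₁,…,vⱼ) = m({v₁,…,vⱼ}) if the vᵢ are distinct and 0 otherwise, so that w(l) = Σᵥ w(v,l).
Since the Uᵢ are disjoint, |X(U₀,…,Uₙ)| is the sum of w over v₀ ∈ U₀, …, vₙ ∈ Uₙ.

Mixing.  If the graph of every link satisfies the expander mixing lemma with constant λ, then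
for sets V₁,…,Vₖ, and V of vertices, the events "(v₁,…,vₖ) ∈ V₁×⋯×Vₖ" and "v ∈ V" for a random
ordered simplex are independent up to k λ √(P(V₁×⋯×Vₖ) P(V)): condition on v₁, use induction in
its link, and apply the mixing lemma once more to 1_V and v₁ ↦ P(V₁×⋯×Vₖ | v₁).  Peeling off the
sets one by one, Uᵢ first and Uⱼ last, gives an error of at most n(n+1)/2 · λ √(P(Uᵢ) P(Uⱼ)),
and n(n+1)/2 ≤ Cₙ.  Geometric means √(FG) are replaced by the bounds (pF + qG)/2 with pq = 1,
which are linear in F and G; p is optimised at the very end.  Likewise λ is replaced by an
arbitrary rational t > λ, so that all of this takes place over ℚ.

Spectrum.  The mixing lemma for t says that the rational forms t D ∓ S are positive semidefinite,
where D is the norm and S the covariance form of the walk.  This is decidable, by Schur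
complements.  If it fails, bisection gives a real μ ≥ t for which μ D ∓ S is positive semidefinite
but (μ - ε) D ∓ S is not, for any ε > 0.  By Schur complements again μ D ∓ S is then degenerate,
now only up to double negation, as it requires the signs of real pivots; but the goal is a
contradiction.  A vector in the kernel is an eigenfunction of the walk orthogonal to the
constants, so its eigenvalue ±μ can only be 1, which connectedness excludes.
-}
module Submission where

open import Defs
open import Algebra.Bundles using (CommutativeRing; RawRing)
open import Algebra.Solver.Ring.AlmostCommutativeRing
  using (fromCommutativeRing; _-Raw-AlmostCommutative⟶_; -raw-almostCommutative⟶)
open import Algebra.Structures using (IsCommutativeRing)
import Algebra.Properties.Ring as RingProperties
import Algebra.Properties.Semiring.Sum as SemiringSum
import Algebra.Solver.Ring as RingSolver
import Data.Bool.Properties as Bool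
open import Data.Bool.Base using (if_then_else_)
open import Data.Empty using (⊥; ⊥-elim)
import Data.Fin.Base as Fin
open import Data.Fin.Base using (Fin; zero; suc)
import Data.Fin.Properties as Fin
open import Data.Fin.Subset using (Subset; inside; outside; _∈_; _∉_; _⊆_; _∪_; _∩_; ⁅_⁆; ∣_∣; Empty) renaming (⊥ to ∅)
import Data.Fin.Subset.Properties as Subset
open import Data.Fin.Subset.Properties using (_∈?_; _⊆?_)
open import Data.Integer.Base as ℤ using (ℤ; +_; -[1+_])
import Data.Integer.Properties as ℤ
open import Data.List.Base as List using (List; []; _∷_; length; filter; allFin; reverse)
import Data.List.Membership.Propositional as List
import Data.List.Membership.Propositional.Properties as List
import Data.List.Properties as List
open import Data.List.Relation.Binary.Permutation.Propositional as Perm using (_↭_; ↭-sym; ↭-trans; ↭-reflexive; prep; ↭⇒↭ₛ)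
import Data.List.Relation.Binary.Permutation.Propositional.Properties as Perm
import Data.List.Relation.Binary.Permutation.Setoid.Properties as PermSetoid
open import Data.List.Relation.Unary.AllPairs using ([]; _∷_)
open import Data.List.Relation.Unary.Unique.Propositional using (Unique)
import Data.List.Relation.Unary.Unique.Propositional.Properties as Unique
open import Data.List.Relation.Unary.All as All using (All; []; _∷_)
import Data.List.Relation.Unary.All.Properties as All
open import Data.List.Relation.Unary.Any using (here; there)
open import Data.Maybe.Base as Maybe using (Maybe)
import Data.Nat.Coprimality as Coprime
open import Data.Nat.Base as ℕ using (ℕ; zero; suc; _!)
import Data.Nat.Properties as ℕ
open import Data.Product.Base using (_×_; _,_; ∃-syntax; proj₁; proj₂)
open import Data.Rational.Base as ℚ using (ℚ; mkℚ; 0ℚ; 1ℚ; ½)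
import Data.Rational.Properties as ℚ
import Data.Rational.Unnormalised.Base as ℚᵘ
import Data.Rational.Unnormalised.Properties as ℚᵘ
import Data.Rational.Solver as ℚSolver
open import Data.Nat.ListAction using () renaming (sum to listSum; product to listProduct)
import Data.Nat.ListAction.Properties as ListAction
import Data.Nat.Solver as ℕSolver
open import Data.Unit.Base using (⊤; tt)
open import Relation.Unary using (Decidable)
open import Data.Sum.Base using (_⊎_; inj₁; inj₂)
import Data.Vec.Base as Vec
import Data.Vec.Properties as Vec
open import Data.Vec.Base using ([]; _∷_)
open import Data.Vec.Functional using () renaming (_∷_ to _◂_)
open import Level using (0ℓ)
open import Relation.Binary.Definitions using (tri<; tri≈; tri>)
import Relation.Binary.PropositionalEquality as ≡
open import Relation.Binary.PropositionalEquality
  using (_≡_; _≢_; refl; sym; trans; cong; cong₂; subst; subst₂; module ≡-Reasoning)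
open import Function.Base using (_∘_)
open import Relation.Binary.Construct.Closure.ReflexiveTransitive using (Star; _◅_) renaming (ε to ε⋆; map to Star-map)
open import Relation.Nullary using (¬_; Dec; yes; no; does; _×-dec_; ¬?)
open import Relation.Nullary.Decidable using (dec⇒maybe)

-- Quadratic forms over ordered rings

-- What refutes the non-degenerate case at the limit μ is coercivity. Pointwise positivity says
-- nothing about nearby parameters, and no compactness argument is at hand to upgrade it; so
-- elimination carries along an explicit lower bound by a multiple of the Euclidean norm. Such a
-- bound survives a slight decrease of μ and contradicts the negative directions that bisection
-- keeps finding just below μ. The pencil argument also needs D definite, although vertices outside
-- a link have weight zero: these get an artificial weight, harmless because kernel vectors vanish
-- there. Bounds linear in F and G pay off because the induction over links sums errors over all
-- first vertices v: the marginal identity of the weights adds up linear terms directly, with no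
-- square root to sum. Separating one set from k others costs k such errors, whence 1 + ... + n. The
-- k-th summand of Cₙ is at least k + 1, since (k+2)^e exceeds (k+1)^e for e = n - k ≥ 1.

ℚ-rawRing : RawRing 0ℓ 0ℓ
ℚ-rawRing = CommutativeRing.rawRing ℚ.+-*-commutativeRing

-- Positivity is primitive and its sign is not assumed decidable; `tight` is the part of trichotomy
-- that Cauchy reals do satisfy. `scalar` supplies rational coefficients to the ring solver and lets
-- rational weights serve as matrix entries over either ring.
record OrderedRing : Set₁ where
  field
    commutativeRing : CommutativeRing 0ℓ 0ℓ

  open CommutativeRing commutativeRing public
    hiding (zero)
    renaming (refl to ≈-refl; sym to ≈-sym; trans to ≈-trans)

  infix 4 _≈0
  _≈0 : Carrier → Set
  x ≈0 = x ≈ 0#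

  field
    Pos        : Carrier → Set
    pos-resp-≈ : ∀ {x y} → x ≈ y → Pos x → Pos y
    pos-+      : ∀ {x y} → Pos x → Pos y → Pos (x + y)
    pos-*      : ∀ {x y} → Pos x → Pos y → Pos (x * y)
    pos-1      : Pos 1#
    ¬pos-0     : ¬ Pos 0#
    tight      : ∀ {x} → ¬ Pos x → ¬ Pos (- x) → x ≈0
    scalar     : ℚ-rawRing -Raw-AlmostCommutative⟶ fromCommutativeRing commutativeRing

module OrderedRingProperties (R : OrderedRing) where
  open OrderedRing R public
  open RingProperties ring using (-‿distribˡ-*; -‿distribʳ-*; -0#≈0#; -‿involutive) public
  open SemiringSum semiring public using (sum; sum-cong-≋; ∑-distrib-+; ∑-comm; *-distribˡ-sum; *-distribʳ-sum)
  open _-Raw-AlmostCommutative⟶_ scalar public renaming (⟦_⟧ to ⌊_⌋) using ()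

  scalar-≟ : ∀ p q → Maybe (⌊ p ⌋ ≈ ⌊ q ⌋)
  scalar-≟ p q = Maybe.map (λ p≡q → reflexive (cong ⌊_⌋ p≡q)) (dec⇒maybe (p ℚ.≟ q))

  module Solver = RingSolver ℚ-rawRing (fromCommutativeRing commutativeRing) scalar scalar-≟
  open Solver using (solve; _:+_; _:*_; _:-_; :-_; _:=_)

  NonNeg : Carrier → Set
  NonNeg x = ¬ Pos (- x)

  -- With ⊥ as the goal, `tight` allows a case distinction on signs. As `NonNeg` is itself a
  -- negation, its closure properties below can be proved by such cases without deciding anything.
  nn-case : ∀ {x} → NonNeg x → (x ≈0 → ⊥) → (Pos x → ⊥) → ⊥
  nn-case nn ¬zero ¬pos = ¬zero (tight ¬pos nn)

  sign-case : ∀ x → (Pos (- x) → ⊥) → (x ≈0 → ⊥) → (Pos x → ⊥) → ⊥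
  sign-case x ¬neg ¬zero ¬pos = ¬zero (tight ¬pos ¬neg)

  nn-resp-≈ : ∀ {x y} → x ≈ y → NonNeg x → NonNeg y
  nn-resp-≈ x≈y nn p = nn (pos-resp-≈ (-‿cong (≈-sym x≈y)) p)

  pos⇒nn : ∀ {x} → Pos x → NonNeg x
  pos⇒nn p -p = ¬pos-0 (pos-resp-≈ (-‿inverseʳ _) (pos-+ p -p))

  0-nn : NonNeg 0#
  0-nn p = ¬pos-0 (pos-resp-≈ -0#≈0# p)

  ≈0⇒nn : ∀ {x} → x ≈0 → NonNeg x
  ≈0⇒nn x≈0 = nn-resp-≈ (≈-sym x≈0) 0-nn

  nn-+ : ∀ {x y} → NonNeg x → NonNeg y → NonNeg (x + y)
  nn-+ {x} {y} nx ny p = nn-case nx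
    (λ x≈0 → ny (pos-resp-≈ (-‿cong (≈-trans (+-congʳ x≈0) (+-identityˡ y))) p))
    (λ px → nn-case ny
      (λ y≈0 → nx (pos-resp-≈ (-‿cong (≈-trans (+-congˡ y≈0) (+-identityʳ x))) p))
      (λ py → pos⇒nn (pos-+ px py) p))

  nn-* : ∀ {x y} → NonNeg x → NonNeg y → NonNeg (x * y)
  nn-* {x} {y} nx ny p = nn-case nx
    (λ x≈0 → ≈0⇒nn (≈-trans (*-congʳ x≈0) (zeroˡ y)) p)
    (λ px → nn-case ny
      (λ y≈0 → ≈0⇒nn (≈-trans (*-congˡ y≈0) (zeroʳ x)) p)
      (λ py → pos⇒nn (pos-* px py) p))

  nn-sq : ∀ x → NonNeg (x * x)
  nn-sq x p = sign-case x
    (λ neg → pos⇒nn (pos-resp-≈ (solve 1 (λ x → :- x :* :- x := x :* x) ≈-refl x) (pos-* neg neg)) p)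
    (λ x≈0 → ≈0⇒nn (≈-trans (*-congʳ x≈0) (zeroˡ x)) p)
    (λ pos → pos⇒nn (pos-* pos pos) p)

  nn-sum : ∀ {n} {f : Fin n → Carrier} → (∀ i → NonNeg (f i)) → NonNeg (sum f)
  nn-sum {zero}  nn = 0-nn
  nn-sum {suc n} nn = nn-+ (nn zero) (nn-sum (λ i → nn (suc i)))

  nn-antisym : ∀ {x} → NonNeg x → NonNeg (- x) → x ≈0
  nn-antisym nx n-x = tight (λ p → n-x (pos-resp-≈ (≈-sym (-‿involutive _)) p)) nx

  nn-+-≈0ˡ : ∀ {x y} → NonNeg x → NonNeg y → x + y ≈0 → x ≈0
  nn-+-≈0ˡ {x} {y} nx ny eq = nn-antisym nx (nn-resp-≈ (begin
    y             ≈⟨ solve 2 (λ x y → y := (x :+ y) :- x) ≈-refl x y ⟩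
    (x + y) - x   ≈⟨ +-congʳ eq ⟩
    0# - x        ≈⟨ +-identityˡ (- x) ⟩
    - x           ∎) ny)
    where open import Relation.Binary.Reasoning.Setoid setoid

  nn-sum-≈0 : ∀ {n} {f : Fin n → Carrier} → (∀ i → NonNeg (f i)) → sum f ≈0 → ∀ i → f i ≈0
  nn-sum-≈0 {suc n} nn eq zero    = nn-+-≈0ˡ (nn zero) (nn-sum (λ i → nn (suc i))) eq
  nn-sum-≈0 {suc n} nn eq (suc i) = nn-sum-≈0 (λ j → nn (suc j))
    (nn-+-≈0ˡ (nn-sum (λ j → nn (suc j))) (nn zero) (≈-trans (+-comm _ _) eq)) i

  *-cancel-nn : ∀ {b x} → Pos b → NonNeg (b * x) → NonNeg x
  *-cancel-nn pb nn p = nn (pos-resp-≈ (≈-sym (-‿distribʳ-* _ _)) (pos-* pb p))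

  *-cancel-≈0 : ∀ {b x} → Pos b → b * x ≈0 → x ≈0
  *-cancel-≈0 {b} {x} pb eq = tight
    (λ p → ¬pos-0 (pos-resp-≈ eq (pos-* pb p)))
    (λ p → ≈0⇒nn eq (pos-resp-≈ (≈-sym (-‿distribʳ-* b x)) (pos-* pb p)))

  *-cancelˡ-≈ : ∀ {b x y} → Pos b → b * x ≈ b * y → x ≈ y
  *-cancelˡ-≈ {b} {x} {y} pb eq = begin
    x             ≈⟨ solve 2 (λ x y → x := y :+ (x :- y)) ≈-refl x y ⟩
    y + (x - y)   ≈⟨ +-congˡ (*-cancel-≈0 pb (≈-trans (solve 3 (λ b x y → b :* (x :- y) := b :* x :- b :* y) ≈-refl b x y)
                       (≈-trans (+-congʳ eq) (-‿inverseʳ (b * y))))) ⟩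
    y + 0#        ≈⟨ +-identityʳ y ⟩
    y             ∎
    where open import Relation.Binary.Reasoning.Setoid setoid

  sq-≈0 : ∀ {x} → x * x ≈0 → x ≈0
  sq-≈0 {x} eq = tight
    (λ p → ¬pos-0 (pos-resp-≈ eq (pos-* p p)))
    (λ p → ¬pos-0 (pos-resp-≈ (≈-trans (solve 1 (λ x → :- x :* :- x := x :* x) ≈-refl x) eq) (pos-* p p)))

  sum-≈0 : ∀ {n} {f : Fin n → Carrier} → (∀ i → f i ≈0) → sum f ≈0
  sum-≈0 {zero}  eq = ≈-refl
  sum-≈0 {suc n} eq = ≈-trans (+-cong (eq zero) (sum-≈0 (λ i → eq (suc i)))) (+-identityˡ 0#)

module QuadraticForms (R : OrderedRing) where
  open OrderedRingProperties R
  open Solver using (solve; _:+_; _:*_; _:-_; :-_; _:=_)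
  open import Relation.Binary.Reasoning.Setoid setoid

  private
    variable
      n : ℕ

  Vector : ℕ → Set
  Vector n = Fin n → Carrier

  Matrix : ℕ → Set
  Matrix n = Fin n → Fin n → Carrier

  Symmetric : Matrix n → Set
  Symmetric B = ∀ i j → B i j ≈ B j i

  dot : Vector n → Vector n → Carrier
  dot x y = sum (λ i → x i * y i)

  quad : Matrix n → Vector n → Carrier
  quad B x = dot x (λ i → dot (B i) x)

  -- `Coercive` is the bound quad B x ≥ (c/d)·|x|² with its denominator cleared, because the ring
  -- has no division. `Negative` carries a witness vector, on which the bisection argument later
  -- evaluates the form.
  PSD Negative Kernel Coercive : Matrix n → Set
  PSD      B = ∀ x → NonNeg (quad B x)
  Negative B = ∃[ x ] Pos (- quad B x)
  Kernel   B = ∃[ x ] ¬ (∀ i → x i ≈0) × (∀ i → dot (B i) x ≈0)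
  Coercive B = ∃[ c ] ∃[ d ] Pos c × NonNeg d × ∀ x → NonNeg (d * quad B x - c * dot x x)

  dot-cong : {f g x y : Vector n} → (∀ i → f i ≈ g i) → (∀ i → x i ≈ y i) → dot f x ≈ dot g y
  dot-cong f≈g x≈y = sum-cong-≋ (λ i → *-cong (f≈g i) (x≈y i))

  dot-zeroˡ : {f : Vector n} → (∀ i → f i ≈0) → ∀ x → dot f x ≈0
  dot-zeroˡ f≈0 x = sum-≈0 (λ i → ≈-trans (*-congʳ (f≈0 i)) (zeroˡ (x i)))

  dot-zeroʳ : (f : Vector n) {x : Vector n} → (∀ i → x i ≈0) → dot f x ≈0
  dot-zeroʳ f x≈0 = sum-≈0 (λ i → ≈-trans (*-congˡ (x≈0 i)) (zeroʳ (f i)))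

  quad-zeroʳ : (B : Matrix n) {x : Vector n} → (∀ i → x i ≈0) → quad B x ≈0
  quad-zeroʳ B x≈0 = dot-zeroˡ x≈0 _

  dot-scaleʳ : ∀ k (f x : Vector n) → dot f (λ i → k * x i) ≈ k * dot f x
  dot-scaleʳ {zero}  k f x = ≈-sym (zeroʳ k)
  dot-scaleʳ {suc n} k f x = ≈-trans
    (+-congˡ (dot-scaleʳ k (λ i → f (suc i)) (λ i → x (suc i))))
    (solve 4 (λ k f x d → f :* (k :* x) :+ k :* d := k :* (f :* x :+ d)) ≈-refl
      k (f zero) (x zero) _)

  dot-comm : (f x : Vector n) → dot f x ≈ dot x f
  dot-comm f x = sum-cong-≋ (λ i → *-comm (f i) (x i))

  dot-linear : ∀ a c (f g x : Vector n) →
    dot (λ i → a * f i - c * g i) x ≈ a * dot f x - c * dot g x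
  dot-linear {zero}  a c f g x = ≈-sym (≈-trans
    (solve 3 (λ a c z → a :* z :- c :* z := (a :- c) :* z) ≈-refl a c 0#) (zeroʳ (a - c)))
  dot-linear {suc n} a c f g x = ≈-trans
    (+-congˡ (dot-linear a c (λ i → f (suc i)) (λ i → g (suc i)) (λ i → x (suc i))))
    (solve 7 (λ a c f g x d e → (a :* f :- c :* g) :* x :+ (a :* d :- c :* e)
                             := a :* (f :* x :+ d) :- c :* (g :* x :+ e)) ≈-refl
      a c (f zero) (g zero) (x zero) _ _)

  quad-scale : ∀ k (B : Matrix n) x → quad B (λ i → k * x i) ≈ k * k * quad B x
  quad-scale k B x = begin
    dot (λ i → k * x i) (λ i → dot (B i) (λ j → k * x j))
      ≈⟨ dot-cong (λ _ → ≈-refl) (λ i → dot-scaleʳ k (B i) x) ⟩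
    dot (λ i → k * x i) (λ i → k * dot (B i) x)
      ≈⟨ dot-scaleʳ k (λ i → k * x i) (λ i → dot (B i) x) ⟩
    k * dot (λ i → k * x i) (λ i → dot (B i) x)
      ≈⟨ *-congˡ (≈-trans (dot-comm (λ i → k * x i) (λ i → dot (B i) x))
           (≈-trans (dot-scaleʳ k _ x) (*-congˡ (dot-comm (λ i → dot (B i) x) x)))) ⟩
    k * (k * quad B x)
      ≈⟨ *-assoc k k _ ⟨
    k * k * quad B x ∎

  row : Matrix (suc n) → Vector n
  row B i = B zero (suc i)

  -- This is the usual Schur complement multiplied by the pivot B₀₀, which keeps elimination free of
  -- division; with a positive pivot the extra factor does not affect signs or kernels.
  minor schur : Matrix (suc n) → Matrix n
  minor B i j = B (suc i) (suc j)
  schur B i j = B zero zero * minor B i j - row B i * row B j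

  minor-sym : {B : Matrix (suc n)} → Symmetric B → Symmetric (minor B)
  minor-sym sym i j = sym (suc i) (suc j)

  schur-sym : {B : Matrix (suc n)} → Symmetric B → Symmetric (schur B)
  schur-sym sym i j = +-cong (*-congˡ (sym (suc i) (suc j))) (-‿cong (*-comm _ _))

  quad-∷ : (B : Matrix (suc n)) → Symmetric B → ∀ t y →
    quad B (t ◂ y) ≈ B zero zero * (t * t) + (t * dot (row B) y + t * dot (row B) y) + quad (minor B) y
  quad-∷ B sym t y = begin
    t * (b * t + s) + dot y (λ i → B (suc i) zero * t + dot (minor B i) y)
      ≈⟨ +-congˡ (dot-cong (λ _ → ≈-refl) (λ i → +-congʳ (≈-trans (*-congʳ (sym (suc i) zero)) (*-comm _ t)))) ⟩
    t * (b * t + s) + dot y (λ i → t * row B i + dot (minor B i) y)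
      ≈⟨ +-congˡ (sum-cong-≋ (λ i → distribˡ (y i) _ _)) ⟩
    t * (b * t + s) + sum (λ i → y i * (t * row B i) + y i * dot (minor B i) y)
      ≈⟨ +-congˡ (∑-distrib-+ (λ i → y i * (t * row B i)) (λ i → y i * dot (minor B i) y)) ⟩
    t * (b * t + s) + (dot y (λ i → t * row B i) + quad (minor B) y)
      ≈⟨ +-congˡ (+-congʳ (≈-trans (dot-scaleʳ t y (row B)) (*-congˡ (dot-comm y (row B))))) ⟩
    t * (b * t + s) + (t * s + quad (minor B) y)
      ≈⟨ solve 4 (λ t b s q → t :* (b :* t :+ s) :+ (t :* s :+ q) := b :* (t :* t) :+ (t :* s :+ t :* s) :+ q)
           ≈-refl t b s (quad (minor B) y) ⟩
    b * (t * t) + (t * s + t * s) + quad (minor B) y ∎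
    where
    b = B zero zero
    s = dot (row B) y

  quad-cong : (B : Matrix n) {x y : Vector n} → (∀ i → x i ≈ y i) → quad B x ≈ quad B y
  quad-cong B x≈y = dot-cong x≈y (λ i → dot-cong (λ _ → ≈-refl) x≈y)

  quad-split : (B : Matrix (suc n)) → Symmetric B → ∀ x → let y = λ i → x (suc i) in
    quad B x ≈ B zero zero * (x zero * x zero)
      + (x zero * dot (row B) y + x zero * dot (row B) y) + quad (minor B) y
  quad-split B sym x = ≈-trans
    (quad-cong B {x} {x zero ◂ (λ i → x (suc i))} λ { zero → ≈-refl ; (suc _) → ≈-refl })
    (quad-∷ B sym (x zero) (λ i → x (suc i)))

  dot-schur : (B : Matrix (suc n)) → ∀ y i →
    dot (schur B i) y ≈ B zero zero * dot (minor B i) y - row B i * dot (row B) y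
  dot-schur B y i = dot-linear (B zero zero) (row B i) (minor B i) (row B) y

  quad-schur : (B : Matrix (suc n)) → ∀ y →
    quad (schur B) y ≈ B zero zero * quad (minor B) y - dot (row B) y * dot (row B) y
  quad-schur B y = begin
    dot y (λ i → dot (schur B i) y)
      ≈⟨ dot-cong (λ _ → ≈-refl) (λ i → ≈-trans (dot-schur B y i) (+-congˡ (-‿cong (*-comm _ _)))) ⟩
    dot y (λ i → b * dot (minor B i) y - s * row B i)
      ≈⟨ dot-comm y _ ⟩
    dot (λ i → b * dot (minor B i) y - s * row B i) y
      ≈⟨ dot-linear b s (λ i → dot (minor B i) y) (row B) y ⟩
    b * dot (λ i → dot (minor B i) y) y - s * dot (row B) y
      ≈⟨ +-congʳ (*-congˡ (dot-comm _ y)) ⟩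
    b * quad (minor B) y - s * s ∎
    where
    b = B zero zero
    s = dot (row B) y

  complete-square : (B : Matrix (suc n)) → Symmetric B → ∀ x →
    let y = λ i → x (suc i); z = B zero zero * x zero + dot (row B) y in
    B zero zero * quad B x ≈ z * z + quad (schur B) y
  complete-square B sym x = begin
    b * quad B x
      ≈⟨ *-congˡ (quad-split B sym x) ⟩
    b * (b * (t * t) + (t * s + t * s) + q)
      ≈⟨ solve 4 (λ b t s q → b :* (b :* (t :* t) :+ (t :* s :+ t :* s) :+ q)
                           := (b :* t :+ s) :* (b :* t :+ s) :+ (b :* q :- s :* s)) ≈-refl b t s q ⟩
    (b * t + s) * (b * t + s) + (b * q - s * s)
      ≈⟨ +-congˡ (quad-schur B _) ⟨
    (b * t + s) * (b * t + s) + quad (schur B) (λ i → x (suc i)) ∎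
    where
    b = B zero zero
    t = x zero
    s = dot (row B) (λ i → x (suc i))
    q = quad (minor B) (λ i → x (suc i))

  -- A crude Cauchy–Schwarz inequality: only the existence of a bound matters.
  dot-bounded : (w : Vector n) → ∃[ W ] NonNeg W × ∀ y → NonNeg (W * dot y y - dot w y * dot w y)
  dot-bounded {zero} w = 0# , 0-nn , λ y → ≈0⇒nn (≈-trans
    (solve 1 (λ z → z :* z :- z :* z := z :- z) ≈-refl 0#) (-‿inverseʳ 0#))
  dot-bounded {suc n} w with dot-bounded (λ i → w (suc i))
  ... | W , nW , h = u * u + u * u + (W + W)
    , nn-+ (nn-+ (nn-sq u) (nn-sq u)) (nn-+ nW nW)
    , λ y → let t = y zero; y' = λ i → y (suc i); s = dot (λ i → w (suc i)) y'; Y = dot y' y' in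
      nn-resp-≈
        (solve 5 (λ u W t s Y →
          (((u :* u) :* Y :+ (u :* u) :* Y) :+ (W :* (t :* t) :+ W :* (t :* t)))
            :+ ((W :* Y :- s :* s) :+ (W :* Y :- s :* s)) :+ (u :* t :- s) :* (u :* t :- s)
          := (u :* u :+ u :* u :+ (W :+ W)) :* (t :* t :+ Y) :- (u :* t :+ s) :* (u :* t :+ s))
          ≈-refl u W t s Y)
        (nn-+ (nn-+
          (nn-+ (nn-+ (nn-* (nn-sq u) (nn-sum (λ i → nn-sq (y' i)))) (nn-* (nn-sq u) (nn-sum (λ i → nn-sq (y' i)))))
                (nn-+ (nn-* nW (nn-sq t)) (nn-* nW (nn-sq t))))
          (nn-+ (h y') (h y'))) (nn-sq (u * t - s)))
    where u = w zero

  -- T is the identity over ℚ, where signs are decidable, and double negation over ℝ.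
  module Classify
    (T : Set → Set) (return : ∀ {A} → A → T A) (_>>=_ : ∀ {A B} → T A → (A → T B) → T B)
    (sign : ∀ x → T (Pos (- x) ⊎ x ≈0 ⊎ Pos x))
    where

    Class : Matrix n → Set
    Class B = Negative B ⊎ PSD B × (Kernel B ⊎ Coercive B)

    -- A single sign test on the sum of squares settles all entries at once, and its positive
    -- outcome is the form in which `zero-pivot` needs a non-zero row.
    vanishes? : (w : Vector n) → T (Pos (dot w w) ⊎ ∀ i → w i ≈0)
    vanishes? {zero}  w = return (inj₂ λ ())
    vanishes? {suc n} w = sign (dot w w) >>= λ
      { (inj₁ neg)        → return (⊥-elim (nn-sum (λ i → nn-sq (w i)) neg))
      ; (inj₂ (inj₁ eq))  → return (inj₂ (λ i → sq-≈0 (nn-sum-≈0 (λ i → nn-sq (w i)) eq i)))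
      ; (inj₂ (inj₂ pos)) → return (inj₁ pos)
      }

    unit : Vector (suc n)
    unit = 1# ◂ λ _ → 0#

    unit≉0 : ¬ (∀ i → unit {n} i ≈0)
    unit≉0 eq = ¬pos-0 (pos-resp-≈ (eq zero) pos-1)

    negative-pivot : (B : Matrix (suc n)) → Symmetric B → Pos (- B zero zero) → Negative B
    negative-pivot B sym neg = unit , pos-resp-≈ (-‿cong (≈-sym (begin
      quad B unit
        ≈⟨ quad-∷ B sym 1# (λ _ → 0#) ⟩
      b * (1# * 1#) + (1# * dot (row B) (λ _ → 0#) + 1# * dot (row B) (λ _ → 0#)) + quad (minor B) (λ _ → 0#)
        ≈⟨ +-cong (+-cong (*-congˡ (*-identityˡ 1#)) (+-cong 1*0 1*0)) (quad-zeroʳ (minor B) (λ _ → ≈-refl)) ⟩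
      b * 1# + (0# + 0#) + 0#
        ≈⟨ +-identityʳ _ ⟩
      b * 1# + (0# + 0#)
        ≈⟨ +-cong (*-identityʳ b) (+-identityʳ 0#) ⟩
      b + 0#
        ≈⟨ +-identityʳ b ⟩
      b ∎))) neg
      where
      b = B zero zero
      1*0 = ≈-trans (*-identityˡ _) (dot-zeroʳ (row B) (λ _ → ≈-refl))

    -- Without a pivot the form is affine in the first coordinate, with slope 2·dot (row B) y, so a
    -- y along the row and a sufficiently negative coordinate make it negative. With y = 2s·row and
    -- first coordinate -(q + 1) the value is exactly -(2s)².
    zero-pivot : (B : Matrix (suc n)) → Symmetric B → B zero zero ≈0 → Pos (dot (row B) (row B)) → Negative B
    zero-pivot B sym b≈0 pos = (- (q + 1#) ◂ y) , pos-resp-≈ (≈-sym (begin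
      - quad B (- (q + 1#) ◂ y)
        ≈⟨ -‿cong (quad-∷ B sym (- (q + 1#)) y) ⟩
      - (B zero zero * (- (q + 1#) * - (q + 1#)) + (- (q + 1#) * dot (row B) y + - (q + 1#) * dot (row B) y) + quad (minor B) y)
        ≈⟨ -‿cong (+-cong (+-cong (≈-trans (*-congʳ b≈0) (zeroˡ _)) (+-cong (*-congˡ dy) (*-congˡ dy))) (quad-scale (s + s) (minor B) (row B))) ⟩
      - (0# + (- (q + 1#) * ((s + s) * s) + - (q + 1#) * ((s + s) * s)) + (s + s) * (s + s) * q)
        ≈⟨ -‿cong (+-congʳ (+-identityˡ _)) ⟩
      - (- (q + 1#) * ((s + s) * s) + - (q + 1#) * ((s + s) * s) + (s + s) * (s + s) * q)
        ≈⟨ solve 3 (λ q s e → :- (:- (q :+ e) :* ((s :+ s) :* s) :+ :- (q :+ e) :* ((s :+ s) :* s)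
                                  :+ (s :+ s) :* (s :+ s) :* q) := e :* ((s :+ s) :* (s :+ s))) ≈-refl q s 1# ⟩
      1# * ((s + s) * (s + s))
        ≈⟨ *-identityˡ _ ⟩
      (s + s) * (s + s) ∎)) (pos-* (pos-+ pos pos) (pos-+ pos pos))
      where
      s = dot (row B) (row B)
      q = quad (minor B) (row B)
      y = λ i → (s + s) * row B i
      dy : dot (row B) y ≈ (s + s) * s
      dy = dot-scaleʳ (s + s) (row B) (row B)

    module _ (B : Matrix (suc n)) (sym : Symmetric B) (b≈0 : B zero zero ≈0) (w≈0 : ∀ i → row B i ≈0) where

      quad-vanishing-row : ∀ x → quad B x ≈ quad (minor B) (λ i → x (suc i))
      quad-vanishing-row x = ≈-trans (quad-split B sym x) (≈-trans (+-congʳ (≈-trans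
        (+-cong (≈-trans (*-congʳ b≈0) (zeroˡ _)) (≈-trans (+-cong t*0 t*0) (+-identityˡ 0#))) (+-identityˡ 0#)))
        (+-identityˡ _))
        where
        t*0 = ≈-trans (*-congˡ (dot-zeroˡ w≈0 _)) (zeroʳ (x zero))

      vanishing-row : Class (minor B) → Class B
      vanishing-row (inj₁ (y , neg)) = inj₁ ((0# ◂ y) , pos-resp-≈ (-‿cong (≈-sym (quad-vanishing-row (0# ◂ y)))) neg)
      vanishing-row (inj₂ (psd , _)) = inj₂
        ( (λ x → nn-resp-≈ (≈-sym (quad-vanishing-row x)) (psd (λ i → x (suc i))))
        , inj₁ (unit , unit≉0 , λ i → ≈-trans
            (+-cong (≈-trans (*-identityʳ (B i zero)) (column i)) (dot-zeroʳ (λ j → B i (suc j)) (λ _ → ≈-refl)))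
            (+-identityˡ 0#)))
        where
        column : ∀ i → B i zero ≈0
        column zero    = b≈0
        column (suc i) = ≈-trans (sym (suc i) zero) (w≈0 i)

    module _ (B : Matrix (suc n)) (sym : Symmetric B) (pb : Pos (B zero zero)) where

      private
        b = B zero zero

      -- The vector above b·y at which the square in `complete-square` vanishes, that is, the
      -- minimiser of the form over the first coordinate, scaled by b to avoid division.
      lift : Vector n → Vector (suc n)
      lift y = - dot (row B) y ◂ λ i → b * y i

      quad-lift : ∀ y → quad B (lift y) ≈ b * quad (schur B) y
      quad-lift y = begin
        quad B (lift y)
          ≈⟨ quad-∷ B sym (- s) (λ i → b * y i) ⟩
        b * (- s * - s) + (- s * dot (row B) (λ i → b * y i) + - s * dot (row B) (λ i → b * y i)) + quad (minor B) (λ i → b * y i)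
          ≈⟨ +-cong (+-congˡ (+-cong (*-congˡ ds) (*-congˡ ds))) (quad-scale b (minor B) y) ⟩
        b * (- s * - s) + (- s * (b * s) + - s * (b * s)) + b * b * quad (minor B) y
          ≈⟨ solve 3 (λ b s q → b :* (:- s :* :- s) :+ (:- s :* (b :* s) :+ :- s :* (b :* s)) :+ b :* b :* q
                             := b :* (b :* q :- s :* s)) ≈-refl b s (quad (minor B) y) ⟩
        b * (b * quad (minor B) y - s * s)
          ≈⟨ *-congˡ (quad-schur B y) ⟨
        b * quad (schur B) y ∎
        where
        s = dot (row B) y
        ds = dot-scaleʳ b (row B) y

      lift-kernel : Kernel (schur B) → Kernel B
      lift-kernel (y , y≉0 , ker) = lift y
        , (λ eq → y≉0 (λ i → *-cancel-≈0 pb (eq (suc i))))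
        , λ { zero    → ≈-trans (+-congˡ (dot-scaleʳ b (row B) y)) (≈-trans
                          (solve 2 (λ b s → b :* :- s :+ b :* s := b :* (s :- s)) ≈-refl b s)
                          (≈-trans (*-congˡ (-‿inverseʳ s)) (zeroʳ b)))
            ; (suc i) → begin
                B (suc i) zero * - s + dot (minor B i) (λ j → b * y j)
                  ≈⟨ +-cong (*-congʳ (sym (suc i) zero)) (dot-scaleʳ b (minor B i) y) ⟩
                row B i * - s + b * dot (minor B i) y
                  ≈⟨ solve 4 (λ w s b d → w :* :- s :+ b :* d := b :* d :- w :* s) ≈-refl
                       (row B i) s b (dot (minor B i) y) ⟩
                b * dot (minor B i) y - row B i * s
                  ≈⟨ dot-schur B y i ⟨
                dot (schur B i) y
                  ≈⟨ ker i ⟩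
                0# ∎ }
        where s = dot (row B) y

      -- With z = bt + s one has b²t² ≤ 2z² + 2s² and s² ≤ WY, hence b²(t² + Y) ≤ 2z² + (2W + b²)Y.
      -- Coercivity of the complement bounds cY by dS, and z² + S is b times the form. The four
      -- groups of summands in the identity are the slack of these estimates, (bt + 2s)² among them.
      lift-coercive : PSD (schur B) → Coercive (schur B) → Coercive B
      lift-coercive psd (c , d , pc , nd , coercive) with dot-bounded (row B)
      ... | W , nW , bound =
          c * (b * b) , (c + c + (W + W + b * b) * d) * b
        , pos-* pc (pos-* pb pb)
        , nn-* (nn-+ (nn-+ (pos⇒nn pc) (pos⇒nn pc)) (nn-* nV nd)) (pos⇒nn pb)
        , λ x → let t = x zero; y = λ i → x (suc i); s = dot (row B) y; z = b * t + s; Y = dot y y; S = quad (schur B) y in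
          nn-resp-≈ (begin
            (c * S + c * S) + (W + W + b * b) * d * (z * z)
              + c * ((b * t + (s + s)) * (b * t + (s + s)))
              + (c * (W * Y - s * s) + c * (W * Y - s * s))
              + (W + W + b * b) * (d * S - c * Y)
              ≈⟨ solve 8 (λ b c d W t s Y S →
                   (c :* S :+ c :* S) :+ (W :+ W :+ b :* b) :* d :* ((b :* t :+ s) :* (b :* t :+ s))
                     :+ c :* ((b :* t :+ (s :+ s)) :* (b :* t :+ (s :+ s)))
                     :+ (c :* (W :* Y :- s :* s) :+ c :* (W :* Y :- s :* s))
                     :+ (W :+ W :+ b :* b) :* (d :* S :- c :* Y)
                   := (c :+ c :+ (W :+ W :+ b :* b) :* d) :* ((b :* t :+ s) :* (b :* t :+ s) :+ S)
                       :- c :* (b :* b) :* (t :* t :+ Y)) ≈-refl b c d W t s Y S ⟩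
            (c + c + (W + W + b * b) * d) * (z * z + S) - c * (b * b) * (t * t + Y)
              ≈⟨ +-congʳ (≈-trans (*-congˡ (≈-sym (complete-square B sym x))) (≈-sym (*-assoc _ b (quad B x)))) ⟩
            (c + c + (W + W + b * b) * d) * b * quad B x - c * (b * b) * dot x x ∎)
          (nn-+ (nn-+ (nn-+ (nn-+
            (nn-+ (nn-* (pos⇒nn pc) (psd y)) (nn-* (pos⇒nn pc) (psd y)))
            (nn-* (nn-* nV nd) (nn-sq z)))
            (nn-* (pos⇒nn pc) (nn-sq _)))
            (nn-+ (nn-* (pos⇒nn pc) (bound y)) (nn-* (pos⇒nn pc) (bound y))))
            (nn-* nV (coercive y)))
        where
        nV : NonNeg (W + W + b * b)
        nV = nn-+ (nn-+ nW nW) (nn-sq b)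

      positive-pivot : Class (schur B) → Class B
      positive-pivot (inj₁ (y , neg)) = inj₁ (lift y , pos-resp-≈
        (≈-trans (≈-sym (-‿distribʳ-* b _)) (-‿cong (≈-sym (quad-lift y)))) (pos-* pb neg))
      positive-pivot (inj₂ (psd , class)) = inj₂
        ( (λ x → *-cancel-nn pb (nn-resp-≈ (≈-sym (complete-square B sym x))
                   (nn-+ (nn-sq _) (psd (λ i → x (suc i))))))
        , [ class ]′)
        where
        [_]′ : Kernel (schur B) ⊎ Coercive (schur B) → Kernel B ⊎ Coercive B
        [ inj₁ ker ]′ = inj₁ (lift-kernel ker)
        [ inj₂ coe ]′ = inj₂ (lift-coercive psd coe)

    -- Symmetric elimination that never exchanges rows: a zero pivot either exposes a negative
    -- direction or has a vanishing row, in which case the first unit vector lies in the kernel.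
    classify : (B : Matrix n) → Symmetric B → T (Class B)
    classify {zero} B sym = return (inj₂ ((λ x → 0-nn) , inj₂ (1# , 0# , pos-1 , 0-nn ,
      λ x → ≈0⇒nn (≈-trans (+-cong (zeroˡ 0#) (-‿cong (zeroʳ 1#))) (-‿inverseʳ 0#)))))
    classify {suc n} B sym = sign (B zero zero) >>= λ
      { (inj₁ neg)        → return (inj₁ (negative-pivot B sym neg))
      ; (inj₂ (inj₁ b≈0)) → vanishes? (row B) >>= λ
          { (inj₁ pos) → return (inj₁ (zero-pivot B sym b≈0 pos))
          ; (inj₂ w≈0) → classify (minor B) (minor-sym {B = B} sym) >>= λ class →
                           return (vanishing-row B sym b≈0 w≈0 class)
          }
      ; (inj₂ (inj₂ pb))  → classify (schur B) (schur-sym {B = B} sym) >>= λ class →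
                              return (positive-pivot B sym pb class)
      }

-- The ordered rings ℚ and ℝ

module ℚ-Order where
  open ℚSolver.+-*-Solver

  abstract
    ≤⇒0≤ : ∀ {p q} → p ℚ.≤ q → 0ℚ ℚ.≤ q ℚ.- p
    ≤⇒0≤ {p} {q} p≤q = subst (ℚ._≤ q ℚ.- p) (ℚ.+-inverseʳ p) (ℚ.+-monoˡ-≤ (ℚ.- p) p≤q)

    0≤⇒≤ : ∀ {p q} → 0ℚ ℚ.≤ q ℚ.- p → p ℚ.≤ q
    0≤⇒≤ {p} {q} h = subst₂ ℚ._≤_ (ℚ.+-identityˡ p)
      (solve 2 (λ p q → q :- p :+ p := q) refl p q) (ℚ.+-monoˡ-≤ p h)

    ≤-by : ∀ {p q e} → 0ℚ ℚ.≤ e → q ℚ.- p ≡ e → p ℚ.≤ q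
    ≤-by h eq = 0≤⇒≤ (subst (0ℚ ℚ.≤_) (sym eq) h)

    infixl 6 _⊕_
    infixl 7 _⊗_

    _⊕_ : ∀ {p q} → 0ℚ ℚ.≤ p → 0ℚ ℚ.≤ q → 0ℚ ℚ.≤ p ℚ.+ q
    _⊕_ = ℚ.+-mono-≤

    _⊗_ : ∀ {p q} → 0ℚ ℚ.≤ p → 0ℚ ℚ.≤ q → 0ℚ ℚ.≤ p ℚ.* q
    _⊗_ {p} {q} hp hq = ℚ.nonNegative⁻¹ (p ℚ.* q)
      {{ℚ.nonNeg*nonNeg⇒nonNeg p {{ℚ.nonNegative hp}} q {{ℚ.nonNegative hq}}}}

    pos*pos : ∀ {p q} → 0ℚ ℚ.< p → 0ℚ ℚ.< q → 0ℚ ℚ.< p ℚ.* q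
    pos*pos {p} {q} hp hq = ℚ.positive⁻¹ (p ℚ.* q)
      {{ℚ.pos*pos⇒pos p {{ℚ.positive hp}} q {{ℚ.positive hq}}}}

    0≤sq : ∀ p → 0ℚ ℚ.≤ p ℚ.* p
    0≤sq p with ℚ.≤-total 0ℚ p
    ... | inj₁ h = h ⊗ h
    ... | inj₂ h = subst (0ℚ ℚ.≤_) (solve 1 (λ p → :- p :* :- p := p :* p) refl p)
                     (ℚ.neg-antimono-≤ h ⊗ ℚ.neg-antimono-≤ h)

    ≤∣∣ : ∀ p → p ℚ.≤ ℚ.∣ p ∣
    ≤∣∣ p with ℚ.≤-total 0ℚ p
    ... | inj₁ 0≤p = ℚ.≤-reflexive (sym (ℚ.0≤p⇒∣p∣≡p 0≤p))
    ... | inj₂ p≤0 = ℚ.≤-trans p≤0 (ℚ.0≤∣p∣ p)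

    -≤∣∣ : ∀ p → ℚ.- p ℚ.≤ ℚ.∣ p ∣
    -≤∣∣ p = subst (ℚ.- p ℚ.≤_) (ℚ.∣-p∣≡∣p∣ p) (≤∣∣ (ℚ.- p))

    ∣∣≤ : ∀ {p q} → p ℚ.≤ q → ℚ.- p ℚ.≤ q → ℚ.∣ p ∣ ℚ.≤ q
    ∣∣≤ {p} {q} h -h with ℚ.∣p∣≡p∨∣p∣≡-p p
    ... | inj₁ eq = subst (ℚ._≤ q) (sym eq) h
    ... | inj₂ eq = subst (ℚ._≤ q) (sym eq) -h

    halve : ∀ {ε} → 0ℚ ℚ.< ε → 0ℚ ℚ.< ½ ℚ.* ε
    halve = pos*pos (ℚ.positive⁻¹ ½)

    halves : ∀ ε → ½ ℚ.* ε ℚ.+ ½ ℚ.* ε ≡ ε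
    halves ε = trans (sym (ℚ.*-distribʳ-+ ε ½ ½)) (ℚ.*-identityˡ ε)

open ℚ-Order

ℚ-ordered : OrderedRing
ℚ-ordered = record
  { commutativeRing = ℚ.+-*-commutativeRing
  ; Pos        = 0ℚ ℚ.<_
  ; pos-resp-≈ = subst (0ℚ ℚ.<_)
  ; pos-+      = λ {p} {q} hp hq → ℚ.+-mono-< hp hq
  ; pos-*      = pos*pos
  ; pos-1      = ℚ.positive⁻¹ 1ℚ
  ; ¬pos-0     = ℚ.<-irrefl refl
  ; tight      = λ {p} → ℚ-tight p
  ; scalar     = -raw-almostCommutative⟶ (fromCommutativeRing ℚ.+-*-commutativeRing)
  }
  where
  ℚ-tight : ∀ p → ¬ (0ℚ ℚ.< p) → ¬ (0ℚ ℚ.< ℚ.- p) → p ≡ 0ℚ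
  ℚ-tight p ¬pos ¬neg with ℚ.<-cmp p 0ℚ
  ... | tri< p<0 _ _ = ⊥-elim (¬neg (ℚ.neg-antimono-< p<0))
  ... | tri≈ _ p≡0 _ = p≡0
  ... | tri> _ _ p>0 = ⊥-elim (¬pos p>0)

ℚ-sign : ∀ p → 0ℚ ℚ.< ℚ.- p ⊎ p ≡ 0ℚ ⊎ 0ℚ ℚ.< p
ℚ-sign p with ℚ.<-cmp p 0ℚ
... | tri< p<0 _ _ = inj₁ (ℚ.neg-antimono-< p<0)
... | tri≈ _ p≡0 _ = inj₂ (inj₁ p≡0)
... | tri> _ _ p>0 = inj₂ (inj₂ p>0)

Eventually : (ℕ → Set) → Set
Eventually P = ∃[ N ] ∀ n → N ℕ.≤ n → P n

eventually-map : ∀ {P Q : ℕ → Set} → (∀ n → P n → Q n) → Eventually P → Eventually Q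
eventually-map f (N , h) = N , λ n N≤n → f n (h n N≤n)

eventually-map₂ : ∀ {P Q R : ℕ → Set} → (∀ n → P n → Q n → R n) →
                  Eventually P → Eventually Q → Eventually R
eventually-map₂ f (M , g) (N , h) = M ℕ.⊔ N , λ n ≤n →
  f n (g n (ℕ.m⊔n≤o⇒m≤o M N ≤n)) (h n (ℕ.m⊔n≤o⇒n≤o M N ≤n))

eventually-witness : ∀ {P : ℕ → Set} → Eventually P → ∃[ n ] P n
eventually-witness (N , h) = N , h N ℕ.≤-refl

Vanishing Bounded : (ℕ → ℚ) → Set
Vanishing f = ∀ ε → 0ℚ ℚ.< ε → Eventually (λ n → ℚ.∣ f n ∣ ℚ.≤ ε)
Bounded   f = ∃[ B ] 0ℚ ℚ.< B × Eventually (λ n → ℚ.∣ f n ∣ ℚ.≤ B)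

vanishing-cong : ∀ {f g : ℕ → ℚ} → (∀ n → f n ≡ g n) → Vanishing f → Vanishing g
vanishing-cong eq v ε ε>0 = eventually-map (λ n → subst (λ p → ℚ.∣ p ∣ ℚ.≤ ε) (eq n)) (v ε ε>0)

vanishing-0 : ∀ {f : ℕ → ℚ} → (∀ n → f n ≡ 0ℚ) → Vanishing f
vanishing-0 eq ε ε>0 = 0 , λ n _ → subst (λ p → ℚ.∣ p ∣ ℚ.≤ ε) (sym (eq n)) (ℚ.<⇒≤ ε>0)

vanishing-+ : ∀ {f g : ℕ → ℚ} → Vanishing f → Vanishing g → Vanishing (λ n → f n ℚ.+ g n)
vanishing-+ {f} {g} vf vg ε ε>0 = eventually-map₂
  (λ n hf hg → ℚ.≤-trans (ℚ.∣p+q∣≤∣p∣+∣q∣ (f n) (g n))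
                 (subst (_ ℚ.≤_) (halves ε) (ℚ.+-mono-≤ hf hg)))
  (vf _ (halve ε>0)) (vg _ (halve ε>0))

vanishing-neg : ∀ {f : ℕ → ℚ} → Vanishing f → Vanishing (λ n → ℚ.- f n)
vanishing-neg {f} v ε ε>0 = eventually-map
  (λ n → subst (ℚ._≤ ε) (sym (ℚ.∣-p∣≡∣p∣ (f n)))) (v ε ε>0)

vanishing-* : ∀ {f g : ℕ → ℚ} → Bounded f → Vanishing g → Vanishing (λ n → f n ℚ.* g n)
vanishing-* {f} {g} (B , B>0 , bf) vg ε ε>0 = eventually-map₂
  (λ n hf hg → begin
    ℚ.∣ f n ℚ.* g n ∣          ≡⟨ ℚ.∣p*q∣≡∣p∣*∣q∣ (f n) (g n) ⟩
    ℚ.∣ f n ∣ ℚ.* ℚ.∣ g n ∣    ≤⟨ ℚ.*-monoʳ-≤-nonNeg ℚ.∣ g n ∣ {{ℚ.∣-∣-nonNeg (g n)}} hf ⟩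
    B ℚ.* ℚ.∣ g n ∣            ≤⟨ ℚ.*-monoˡ-≤-nonNeg B {{ℚ.nonNegative (ℚ.<⇒≤ B>0)}} hg ⟩
    B ℚ.* (ε ℚ.* ℚ.1/ B)       ≡⟨ solve 3 (λ B e i → B :* (e :* i) := e :* (B :* i)) refl B ε (ℚ.1/ B) ⟩
    ε ℚ.* (B ℚ.* ℚ.1/ B)       ≡⟨ cong (ε ℚ.*_) (ℚ.*-inverseʳ B) ⟩
    ε ℚ.* 1ℚ                   ≡⟨ ℚ.*-identityʳ ε ⟩
    ε                          ∎)
  bf (vg (ε ℚ.* ℚ.1/ B) (pos*pos ε>0 (ℚ.positive⁻¹ (ℚ.1/ B) {{ℚ.1/pos⇒pos B}})))
  where
  open ℚ.≤-Reasoning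
  open ℚSolver.+-*-Solver
  instance
    B-pos : ℚ.Positive B
    B-pos = ℚ.positive B>0
    B≢0 : ℚ.NonZero B
    B≢0 = ℚ.pos⇒nonZero B

bounded : ∀ x → Bounded (seq x)
bounded x with cauchy x 1ℚ (ℚ.positive⁻¹ 1ℚ)
... | N , h = ℚ.∣ seq x N ∣ ℚ.+ 1ℚ , ℚ.+-mono-≤-< (ℚ.0≤∣p∣ (seq x N)) (ℚ.positive⁻¹ 1ℚ)
  , N , λ n N≤n → begin
    ℚ.∣ seq x n ∣                                 ≡⟨ cong ℚ.∣_∣ (solve 2 (λ a b → a := b :+ (a :- b)) refl (seq x n) (seq x N)) ⟩
    ℚ.∣ seq x N ℚ.+ (seq x n ℚ.- seq x N) ∣       ≤⟨ ℚ.∣p+q∣≤∣p∣+∣q∣ (seq x N) (seq x n ℚ.- seq x N) ⟩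
    ℚ.∣ seq x N ∣ ℚ.+ ℚ.∣ seq x n ℚ.- seq x N ∣   ≤⟨ ℚ.+-monoʳ-≤ ℚ.∣ seq x N ∣ (h n N N≤n ℕ.≤-refl) ⟩
    ℚ.∣ seq x N ∣ ℚ.+ 1ℚ                          ∎
  where
  open ℚ.≤-Reasoning
  open ℚSolver.+-*-Solver

-- A record, so that x and y can be inferred from a proof of x ≈ℝ y.
infix 4 _≈ℝ_
record _≈ℝ_ (x y : ℝ) : Set where
  constructor vanishing
  field difference : Vanishing (λ n → seq x n ℚ.- seq y n)

open _≈ℝ_

pointwise : ∀ {x y} → (∀ n → seq x n ≡ seq y n) → x ≈ℝ y
pointwise {x} {y} eq = vanishing (vanishing-0 λ n →
  trans (cong (ℚ._- seq y n) (eq n)) (ℚ.+-inverseʳ (seq y n)))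

≈ℝ⇒≃ : ∀ {x y} → x ≈ℝ y → x ≃ y
≈ℝ⇒≃ {x} {y} (vanishing v) =
    (λ ε ε>0 → eventually-map (λ n h → ≤-by (≤⇒0≤ (ℚ.≤-trans (≤∣∣ (seq x n ℚ.- seq y n)) h))
      (solve 3 (λ a b e → b :+ e :- a := e :- (a :- b)) refl (seq x n) (seq y n) ε)) (v ε ε>0))
  , (λ ε ε>0 → eventually-map (λ n h → ≤-by (≤⇒0≤ (ℚ.≤-trans (-≤∣∣ (seq x n ℚ.- seq y n)) h))
      (solve 3 (λ a b e → a :+ e :- b := e :- :- (a :- b)) refl (seq x n) (seq y n) ε)) (v ε ε>0))
  where open ℚSolver.+-*-Solver

≃⇒≈ℝ : ∀ {x y} → x ≃ y → x ≈ℝ y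
≃⇒≈ℝ {x} {y} (x≤y , y≤x) = vanishing λ ε ε>0 → eventually-map₂
  (λ n h h' → ∣∣≤
    (≤-by (≤⇒0≤ h) (solve 3 (λ a b e → e :- (a :- b) := b :+ e :- a) refl (seq x n) (seq y n) ε))
    (≤-by (≤⇒0≤ h') (solve 3 (λ a b e → e :- :- (a :- b) := a :+ e :- b) refl (seq x n) (seq y n) ε)))
  (x≤y ε ε>0) (y≤x ε ε>0)
  where open ℚSolver.+-*-Solver

-- The operations of Defs, sealed: unfolding them makes conversion checking infeasible.
infixl 6 _⊞_
infixl 7 _⊠_
infix  8 ⊟_

abstract
  _⊞_ _⊠_ : ℝ → ℝ → ℝ
  _⊞_ = _+ℝ_
  _⊠_ = _*ℝ_

  ⊟_ : ℝ → ℝ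
  ⊟_ = -ℝ_

  ⊠≡*ℝ : ∀ x y → x ⊠ y ≡ x *ℝ y
  ⊠≡*ℝ x y = refl

  seq-⊞ : ∀ x y k → seq (x ⊞ y) k ≡ seq x k ℚ.+ seq y k
  seq-⊞ x y k = refl

  seq-⊠ : ∀ x y k → seq (x ⊠ y) k ≡ seq x k ℚ.* seq y k
  seq-⊠ x y k = refl

  seq-⊟ : ∀ x k → seq (⊟ x) k ≡ ℚ.- seq x k
  seq-⊟ x k = refl

  ℝ-isCommutativeRing : IsCommutativeRing _≈ℝ_ _⊞_ _⊠_ ⊟_ 0ℝ 1ℝ
  ℝ-isCommutativeRing = record
    { isRing = record
      { +-isAbelianGroup = record
        { isGroup = record
          { isMonoid = record
            { isSemigroup = record
              { isMagma = record
                { isEquivalence = record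
                  { refl  = pointwise λ _ → refl
                  ; sym   = λ {x} {y} (vanishing v) → vanishing (vanishing-cong
                      (λ n → solve 2 (λ a b → :- (a :- b) := b :- a) refl (seq x n) (seq y n))
                      (vanishing-neg v))
                  ; trans = λ {x} {y} {z} (vanishing v) (vanishing w) → vanishing (vanishing-cong
                      (λ n → solve 3 (λ a b c → (a :- b) :+ (b :- c) := a :- c) refl
                        (seq x n) (seq y n) (seq z n))
                      (vanishing-+ v w))
                  }
                ; ∙-cong = λ {x} {y} {u} {w} (vanishing v) (vanishing v') → vanishing (vanishing-cong
                    (λ n → solve 4 (λ a b c d → (a :- b) :+ (c :- d) := (a :+ c) :- (b :+ d)) refl
                      (seq x n) (seq y n) (seq u n) (seq w n))
                    (vanishing-+ v v'))
                }
              ; assoc = λ x y z → pointwise λ n → ℚ.+-assoc (seq x n) (seq y n) (seq z n)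
              }
            ; identity = (λ x → pointwise λ n → ℚ.+-identityˡ (seq x n))
                       , (λ x → pointwise λ n → ℚ.+-identityʳ (seq x n))
            }
          ; inverse = (λ x → pointwise λ n → ℚ.+-inverseˡ (seq x n))
                    , (λ x → pointwise λ n → ℚ.+-inverseʳ (seq x n))
          ; ⁻¹-cong = λ {x} {y} (vanishing v) → vanishing (vanishing-cong
              (λ n → solve 2 (λ a b → :- (a :- b) := :- a :- :- b) refl (seq x n) (seq y n))
              (vanishing-neg v))
          }
        ; comm = λ x y → pointwise λ n → ℚ.+-comm (seq x n) (seq y n)
        }
      ; *-cong = λ {x} {y} {u} {w} (vanishing v) (vanishing v') → vanishing (vanishing-cong
          (λ n → solve 4 (λ a b c d → c :* (a :- b) :+ b :* (c :- d) := a :* c :- b :* d) refl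
            (seq x n) (seq y n) (seq u n) (seq w n))
          (vanishing-+ (vanishing-* (bounded u) v) (vanishing-* (bounded y) v')))
      ; *-assoc = λ x y z → pointwise λ n → ℚ.*-assoc (seq x n) (seq y n) (seq z n)
      ; *-identity = (λ x → pointwise λ n → ℚ.*-identityˡ (seq x n))
                   , (λ x → pointwise λ n → ℚ.*-identityʳ (seq x n))
      ; distrib = (λ x y z → pointwise λ n → ℚ.*-distribˡ-+ (seq x n) (seq y n) (seq z n))
                , (λ x y z → pointwise λ n → ℚ.*-distribʳ-+ (seq x n) (seq y n) (seq z n))
      }
    ; *-comm = λ x y → pointwise λ n → ℚ.*-comm (seq x n) (seq y n)
    }
    where open ℚSolver.+-*-Solver

ℝ-commutativeRing : CommutativeRing 0ℓ 0ℓ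
ℝ-commutativeRing = record { isCommutativeRing = ℝ-isCommutativeRing }

Posℝ : ℝ → Set
Posℝ x = ∃[ ε ] 0ℚ ℚ.< ε × Eventually (λ n → ε ℚ.≤ seq x n)

abstract
  -- From N on the terms agree up to ε/4, so the decidable comparison of ±x_N with ε/2 is
  -- conclusive: if either is at least ε/2, all later terms of that sign exceed ε/4 and x or -x is
  -- positive; otherwise all later terms are below ε.
  ℝ-tight : ∀ {x} → ¬ Posℝ x → ¬ Posℝ (⊟ x) → x ≈ℝ 0ℝ
  ℝ-tight {x} ¬pos ¬neg = vanishing λ ε ε>0 → let η = ½ ℚ.* ε ; N , h = cauchy x (½ ℚ.* η) (halve (halve ε>0)) in
    N , λ n N≤n → subst (ℚ._≤ ε) (cong ℚ.∣_∣ (sym (ℚ.+-identityʳ (seq x n)))) (bound ε ε>0 N h n N≤n)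
    where
    open ℚSolver.+-*-Solver
    bound : ∀ ε → 0ℚ ℚ.< ε → ∀ N →
      (∀ m n → N ℕ.≤ m → N ℕ.≤ n → ℚ.∣ seq x m ℚ.- seq x n ∣ ℚ.≤ ½ ℚ.* (½ ℚ.* ε)) →
      ∀ n → N ℕ.≤ n → ℚ.∣ seq x n ∣ ℚ.≤ ε
    bound ε ε>0 N h n N≤n with ½ ℚ.* ε ℚ.≤? seq x N | ½ ℚ.* ε ℚ.≤? ℚ.- seq x N
    ... | yes big | _ = ⊥-elim (¬pos (_ , halve (halve ε>0) , N , λ k N≤k →
      ≤-by (≤⇒0≤ big ⊕ ≤⇒0≤ (ℚ.≤-trans (≤∣∣ _) (h N k ℕ.≤-refl N≤k)))
        (solve 3 (λ e a b → b :- con ½ :* (con ½ :* e)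
                   := (a :- con ½ :* e) :+ (con ½ :* (con ½ :* e) :- (a :- b)))
          refl ε (seq x N) (seq x k))))
    ... | _ | yes big = ⊥-elim (¬neg (_ , halve (halve ε>0) , N , λ k N≤k →
      ≤-by (≤⇒0≤ big ⊕ ≤⇒0≤ (ℚ.≤-trans (-≤∣∣ _) (h N k ℕ.≤-refl N≤k)))
        (solve 3 (λ e a b → :- b :- con ½ :* (con ½ :* e)
                   := (:- a :- con ½ :* e) :+ (con ½ :* (con ½ :* e) :- :- (a :- b)))
          refl ε (seq x N) (seq x k))))
    ... | no small | no small' = ∣∣≤
      (≤-by (≤⇒0≤ (ℚ.<⇒≤ (ℚ.≰⇒> small)) ⊕ ≤⇒0≤ (ℚ.≤-trans (-≤∣∣ _) (h N n ℕ.≤-refl N≤n)) ⊕ ℚ.<⇒≤ (halve (halve ε>0)))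
        (solve 3 (λ e a b → e :- b := (con ½ :* e :- a) :+ (con ½ :* (con ½ :* e) :- :- (a :- b)) :+ con ½ :* (con ½ :* e))
          refl ε (seq x N) (seq x n)))
      (≤-by (≤⇒0≤ (ℚ.<⇒≤ (ℚ.≰⇒> small')) ⊕ ≤⇒0≤ (ℚ.≤-trans (≤∣∣ _) (h N n ℕ.≤-refl N≤n)) ⊕ ℚ.<⇒≤ (halve (halve ε>0)))
        (solve 3 (λ e a b → e :- :- b := (con ½ :* e :- :- a) :+ (con ½ :* (con ½ :* e) :- (a :- b)) :+ con ½ :* (con ½ :* e))
          refl ε (seq x N) (seq x n)))

  ℝ-pos-+ : ∀ {x y} → Posℝ x → Posℝ y → Posℝ (x ⊞ y)
  ℝ-pos-+ = λ (ε , ε>0 , h) (δ , δ>0 , h') → ε ℚ.+ δ , ℚ.+-mono-< ε>0 δ>0 ,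
      eventually-map₂ (λ _ → ℚ.+-mono-≤) h h'

  ℝ-pos-* : ∀ {x y} → Posℝ x → Posℝ y → Posℝ (x ⊠ y)
  ℝ-pos-* {x} {y} = λ (ε , ε>0 , h) (δ , δ>0 , h') → ε ℚ.* δ , pos*pos ε>0 δ>0 ,
      eventually-map₂ (λ n h₁ h₂ → ≤-by (≤⇒0≤ h₁ ⊗ ℚ.≤-trans (ℚ.<⇒≤ δ>0) h₂ ⊕ ℚ.<⇒≤ ε>0 ⊗ ≤⇒0≤ h₂)
        (solve 4 (λ a b e d → a :* b :- e :* d := (a :- e) :* b :+ e :* (b :- d)) refl
          (seq x n) (seq y n) ε δ)) h h'
    where open ℚSolver.+-*-Solver

  fromℚ-+ : ∀ p q → fromℚ (p ℚ.+ q) ≈ℝ fromℚ p ⊞ fromℚ q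
  fromℚ-+ p q = pointwise λ _ → refl

  fromℚ-* : ∀ p q → fromℚ (p ℚ.* q) ≈ℝ fromℚ p ⊠ fromℚ q
  fromℚ-* p q = pointwise λ _ → refl

  fromℚ-neg : ∀ p → fromℚ (ℚ.- p) ≈ℝ ⊟ fromℚ p
  fromℚ-neg p = pointwise λ _ → refl

ℝ-ordered : OrderedRing
ℝ-ordered = record
  { commutativeRing = ℝ-commutativeRing
  ; Pos        = Posℝ
  ; pos-resp-≈ = λ {x} {y} (vanishing v) (ε , ε>0 , h) → ½ ℚ.* ε , halve ε>0 , eventually-map₂
      (λ n h₁ h₂ → ≤-by (≤⇒0≤ h₁ ⊕ ≤⇒0≤ (ℚ.≤-trans (≤∣∣ _) h₂))
        (solve 3 (λ e a b → b :- con ½ :* e := (a :- e) :+ (con ½ :* e :- (a :- b))) refl ε (seq x n) (seq y n)))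
      h (v (½ ℚ.* ε) (halve ε>0))
  ; pos-+      = ℝ-pos-+
  ; pos-*      = ℝ-pos-*
  ; pos-1      = 1ℚ , ℚ.positive⁻¹ 1ℚ , 0 , λ _ _ → ℚ.≤-refl
  ; ¬pos-0     = λ (ε , ε>0 , N , h) → ℚ.<-irrefl refl (ℚ.<-≤-trans ε>0 (h N ℕ.≤-refl))
  ; tight      = λ {x} → ℝ-tight {x}
  ; scalar     = record
    { ⟦_⟧    = fromℚ
    ; +-homo = fromℚ-+ ; *-homo = fromℚ-* ; -‿homo = fromℚ-neg ; 0-homo = pointwise λ _ → refl ; 1-homo = pointwise λ _ → refl
    }
  }
  where open ℚSolver.+-*-Solver

-- The top eigenvalue of a pencil of rational forms

ι : ℕ → ℚ
ι k = k ÷ 1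

ι≡mkℚ : ∀ k → ι k ≡ mkℚ (+ k) 0 _
ι≡mkℚ k = ℚ.↥p/↧p≡p (mkℚ (+ k) 0 (Coprime.sym (Coprime.1-coprimeTo k)))

ι-+ : ∀ a b → ι (a ℕ.+ b) ≡ ι a ℚ.+ ι b
ι-+ a b = sym (trans (cong₂ ℚ._+_ (ι≡mkℚ a) (ι≡mkℚ b))
  (cong (ℚ._/ 1) (cong₂ ℤ._+_ (ℤ.*-identityʳ (+ a)) (ℤ.*-identityʳ (+ b)))))

ι-* : ∀ a b → ι (a ℕ.* b) ≡ ι a ℚ.* ι b
ι-* a b = sym (trans (cong₂ ℚ._*_ (ι≡mkℚ a) (ι≡mkℚ b)) (cong (ℚ._/ 1) (sym (ℤ.pos-* a b))))

ι-nonneg : ∀ a → 0ℚ ℚ.≤ ι a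
ι-nonneg a = subst (0ℚ ℚ.≤_) (sym (ι≡mkℚ a)) (ℚ.nonNegative⁻¹ (mkℚ (+ a) 0 _))

ι-mono : ∀ {a b} → a ℕ.≤ b → ι a ℚ.≤ ι b
ι-mono {a} {b} a≤b with ℕ.m≤n⇒∃[o]m+o≡n a≤b
... | c , refl = subst₂ ℚ._≤_ (ℚ.+-identityʳ (ι a)) (sym (ι-+ a c)) (ℚ.+-monoʳ-≤ (ι a) (ι-nonneg c))

-- The Archimedean property with an explicit witness, the numerator; it supplies the number of
-- bisections and the indices at which 1/(k+1) becomes small.
≤ι∣↥∣ : ∀ p → p ℚ.≤ ι ℤ.∣ ℚ.↥ p ∣
≤ι∣↥∣ p@(mkℚ (+ a) d _) = subst (p ℚ.≤_) (sym (ι≡mkℚ a)) (ℚ.*≤* (subst₂ ℤ._≤_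
  (sym (ℤ.*-identityʳ (+ a))) (ℤ.pos-* a (suc d)) (ℤ.+≤+ (ℕ.m≤m*n a (suc d)))))
≤ι∣↥∣ p@(mkℚ -[1+ a ] d _) = ℚ.≤-trans (ℚ.nonPositive⁻¹ p) (ι-nonneg (suc a))

½^_ : ℕ → ℚ
½^ zero  = 1ℚ
½^ suc k = ½ ℚ.* ½^ k

½^-nonneg : ∀ k → 0ℚ ℚ.≤ ½^ k
½^-nonneg zero    = ℚ.nonNegative⁻¹ 1ℚ
½^-nonneg (suc k) = ℚ.nonNegative⁻¹ ½ ⊗ ½^-nonneg k

½^-≤ : ∀ k → ½^ k ℚ.* ι (suc k) ℚ.≤ 1ℚ
½^-≤ zero    = ℚ.≤-refl
½^-≤ (suc k) = begin
  ½ ℚ.* ½^ k ℚ.* ι (suc (suc k))           ≤⟨ ℚ.*-monoˡ-≤-nonNeg (½ ℚ.* ½^ k) {{ℚ.nonNegative (½^-nonneg (suc k))}}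
                                                (ι-mono (ℕ.s≤s (ℕ.m≤n+m (suc k) k))) ⟩
  ½ ℚ.* ½^ k ℚ.* ι (suc k ℕ.+ suc k)       ≡⟨ cong (½ ℚ.* ½^ k ℚ.*_) (ι-+ (suc k) (suc k)) ⟩
  ½ ℚ.* ½^ k ℚ.* (ι (suc k) ℚ.+ ι (suc k)) ≡⟨ solve 2 (λ h s → con ½ :* h :* (s :+ s) := h :* s) refl (½^ k) (ι (suc k)) ⟩
  ½^ k ℚ.* ι (suc k)                       ≤⟨ ½^-≤ k ⟩
  1ℚ                                       ∎
  where
  open ℚ.≤-Reasoning
  open ℚSolver.+-*-Solver

abstract
  ½^-small : ∀ {w ε} → 0ℚ ℚ.≤ w → 0ℚ ℚ.< ε → ∃[ k ] ½^ k ℚ.* w ℚ.≤ ε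
  ½^-small {w} {ε} 0≤w ε>0 = k , (begin
    ½^ k ℚ.* w                      ≡⟨ cong (½^ k ℚ.*_) w≡ ⟩
    ½^ k ℚ.* (w ℚ.* ℚ.1/ ε ℚ.* ε)   ≤⟨ ℚ.*-monoˡ-≤-nonNeg (½^ k) {{ℚ.nonNegative (½^-nonneg k)}}
                                         (ℚ.*-monoʳ-≤-nonNeg ε {{ℚ.nonNegative (ℚ.<⇒≤ ε>0)}}
                                           (ℚ.≤-trans (≤ι∣↥∣ (w ℚ.* ℚ.1/ ε)) (ι-mono (ℕ.n≤1+n k)))) ⟩
    ½^ k ℚ.* (ι (suc k) ℚ.* ε)      ≡⟨ ℚ.*-assoc (½^ k) (ι (suc k)) ε ⟨
    ½^ k ℚ.* ι (suc k) ℚ.* ε        ≤⟨ ℚ.*-monoʳ-≤-nonNeg ε {{ℚ.nonNegative (ℚ.<⇒≤ ε>0)}} (½^-≤ k) ⟩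
    1ℚ ℚ.* ε                        ≡⟨ ℚ.*-identityˡ ε ⟩
    ε                               ∎)
    where
    open ℚ.≤-Reasoning
    instance
      ε≢0 : ℚ.NonZero ε
      ε≢0 = ℚ.pos⇒nonZero ε {{ℚ.positive ε>0}}
    k : ℕ
    k = ℤ.∣ ℚ.↥ (w ℚ.* ℚ.1/ ε) ∣
    w≡ : w ≡ w ℚ.* ℚ.1/ ε ℚ.* ε
    w≡ = sym (trans (ℚ.*-assoc w (ℚ.1/ ε) ε) (trans (cong (w ℚ.*_) (ℚ.*-inverseˡ ε)) (ℚ.*-identityʳ w)))

module ℚ-ring = OrderedRingProperties ℚ-ordered
module ℝ-ring = OrderedRingProperties ℝ-ordered
module ℚ-forms = QuadraticForms ℚ-ordered
module ℝ-forms = QuadraticForms ℝ-ordered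

nn⇒0≤ : ∀ {p} → ℚ-ring.NonNeg p → 0ℚ ℚ.≤ p
nn⇒0≤ {p} nn with 0ℚ ℚ.≤? p
... | yes 0≤p = 0≤p
... | no  0≰p = ⊥-elim (nn (ℚ.neg-antimono-< (ℚ.≰⇒> 0≰p)))

0≤⇒nn : ∀ {p} → 0ℚ ℚ.≤ p → ℚ-ring.NonNeg p
0≤⇒nn {p} 0≤p -p>0 = ℚ.<-irrefl refl (ℚ.<-≤-trans -p>0 (ℚ.neg-antimono-≤ 0≤p))

seq-sum : ∀ {n} (f : Fin n → ℝ) k → seq (ℝ-ring.sum f) k ≡ ℚ-ring.sum (λ i → seq (f i) k)
seq-sum {zero}  f k = refl
seq-sum {suc n} f k = trans (seq-⊞ (f zero) _ k) (cong (seq (f zero) k ℚ.+_) (seq-sum (λ i → f (suc i)) k))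

seq-dot : ∀ {n} (x y : ℝ-forms.Vector n) k →
  seq (ℝ-forms.dot x y) k ≡ ℚ-forms.dot (λ i → seq (x i) k) (λ i → seq (y i) k)
seq-dot x y k = trans (seq-sum (λ i → x i ⊠ y i) k) (ℚ-ring.sum-cong-≋ (λ i → seq-⊠ (x i) (y i) k))

seq-quad : ∀ {n} (B : ℝ-forms.Matrix n) x k →
  seq (ℝ-forms.quad B x) k ≡ ℚ-forms.quad (λ i j → seq (B i j) k) (λ i → seq (x i) k)
seq-quad B x k = trans (seq-dot x (λ i → ℝ-forms.dot (B i) x) k)
  (ℚ-ring.sum-cong-≋ (λ i → cong (seq (x i) k ℚ.*_) (seq-dot (B i) x k)))

dot-self-nonneg : ∀ {n} (x : ℚ-forms.Vector n) → 0ℚ ℚ.≤ ℚ-forms.dot x x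
dot-self-nonneg x = nn⇒0≤ (ℚ-ring.nn-sum (λ i → ℚ-ring.nn-sq (x i)))

-- The cross term is split by 2ts ≤ t² + s², and s² ≤ WY. Applied to S it provides an upper end for
-- bisection, applied to Δ it controls how fast the pencil grows with its parameter; the size of the
-- constant is irrelevant for both.
quad-bounded : ∀ {n} (B : ℚ-forms.Matrix n) → ℚ-forms.Symmetric B →
  ∃[ r ] 0ℚ ℚ.≤ r × ∀ x → ℚ-forms.quad B x ℚ.≤ r ℚ.* ℚ-forms.dot x x
quad-bounded {zero}  B sym = 0ℚ , ℚ.≤-refl , λ x → ℚ.≤-refl
quad-bounded {suc n} B sym with ℚ-forms.dot-bounded (ℚ-forms.row B)
                              | quad-bounded (ℚ-forms.minor B) (ℚ-forms.minor-sym {B = B} sym)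
... | W , nW , bound | r , 0≤r , h =
    ℚ.∣ b ∣ ℚ.+ 1ℚ ℚ.+ W ℚ.+ r
  , ℚ.0≤∣p∣ b ⊕ 0≤1 ⊕ 0≤W ⊕ 0≤r
  , λ x → let t = x zero; y = λ i → x (suc i); s = ℚ-forms.dot (ℚ-forms.row B) y; Y = ℚ-forms.dot y y in
    ℚ.≤-trans (ℚ.≤-reflexive (ℚ-forms.quad-split B sym x)) (≤-by
      (≤⇒0≤ (≤∣∣ b) ⊗ 0≤sq t ⊕ 0≤sq (t ℚ.- s) ⊕ nn⇒0≤ (bound y) ⊕ ≤⇒0≤ (h y)
        ⊕ (0≤W ⊕ 0≤r) ⊗ 0≤sq t ⊕ (ℚ.0≤∣p∣ b ⊕ 0≤1) ⊗ dot-self-nonneg y)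
      (solve 8 (λ a b W r t s Y q →
          (a :+ con 1ℚ :+ W :+ r) :* (t :* t :+ Y) :- (b :* (t :* t) :+ (t :* s :+ t :* s) :+ q)
        := (a :- b) :* (t :* t) :+ (t :- s) :* (t :- s) :+ (W :* Y :- s :* s) :+ (r :* Y :- q)
            :+ (W :+ r) :* (t :* t) :+ (a :+ con 1ℚ) :* Y)
        refl ℚ.∣ b ∣ b W r t s Y (ℚ-forms.quad (ℚ-forms.minor B) y)))
  where
  open ℚSolver.+-*-Solver
  b = B zero zero
  0≤W = nn⇒0≤ nW
  0≤1 = ℚ.nonNegative⁻¹ 1ℚ

abstract
  0≤∧≢0⇒0< : ∀ {p} → 0ℚ ℚ.≤ p → p ≢ 0ℚ → 0ℚ ℚ.< p
  0≤∧≢0⇒0< {p} 0≤p p≢0 with ℚ.<-cmp 0ℚ p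
  ... | tri< 0<p _ _ = 0<p
  ... | tri≈ _ 0≡p _ = ⊥-elim (p≢0 (sym 0≡p))
  ... | tri> _ _ p<0 = ⊥-elim (ℚ.<-irrefl refl (ℚ.<-≤-trans p<0 0≤p))

  -- A tolerance δ whose amplified error e·δ, together with a spare δ, exhausts η. The spare term
  -- makes the divisor e + 1, so that e = 0 is no exception.
  split-off : ∀ {e η} → 0ℚ ℚ.≤ e → 0ℚ ℚ.< η → ∃[ δ ] 0ℚ ℚ.< δ × e ℚ.* δ ℚ.+ δ ≡ η
  split-off {e} {η} 0≤e η>0 = η ℚ.* ℚ.1/ E , pos*pos η>0 (ℚ.positive⁻¹ (ℚ.1/ E) {{ℚ.1/pos⇒pos E}})
    , trans (solve 3 (λ e η i → e :* (η :* i) :+ η :* i := η :* (i :* (e :+ con 1ℚ))) refl e η (ℚ.1/ E))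
        (trans (cong (η ℚ.*_) (ℚ.*-inverseˡ E)) (ℚ.*-identityʳ η))
    where
    open ℚSolver.+-*-Solver
    E : ℚ
    E = e ℚ.+ 1ℚ
    instance
      E-pos : ℚ.Positive E
      E-pos = ℚ.positive (ℚ.+-mono-≤-< 0≤e (ℚ.positive⁻¹ 1ℚ))
      E≢0 : ℚ.NonZero E
      E≢0 = ℚ.pos⇒nonZero E

  -- Coercivity would need dq ≥ cX, but dq ≤ D·w·M·X ≤ DMδ·X, which is below half of γX. The other
  -- half is the margin by which coercivity fails, uniform in the index of the sequences.
  coercive-bound : ∀ γ c d D M X q w δ → γ ℚ.≤ c → d ℚ.≤ D → 0ℚ ℚ.< D → 0ℚ ℚ.≤ M → 0ℚ ℚ.≤ X → 0ℚ ℚ.≤ q →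
    q ℚ.≤ w ℚ.* (M ℚ.* X) → w ℚ.≤ δ → 0ℚ ℚ.< δ → D ℚ.* M ℚ.* δ ℚ.+ δ ≡ ½ ℚ.* γ →
    ½ ℚ.* γ ℚ.* X ℚ.≤ ℚ.- (d ℚ.* q ℚ.- c ℚ.* X)
  coercive-bound γ c d D M X q w δ γ≤c d≤D D>0 0≤M 0≤X 0≤q q≤ w≤δ δ>0 eq = ≤-by
    (≤⇒0≤ γ≤c ⊗ 0≤X ⊕ ≤⇒0≤ d≤D ⊗ 0≤q ⊕ ℚ.<⇒≤ D>0 ⊗ ≤⇒0≤ q≤ ⊕ (ℚ.<⇒≤ D>0 ⊗ 0≤M) ⊗ ≤⇒0≤ w≤δ ⊗ 0≤X ⊕ ℚ.<⇒≤ δ>0 ⊗ 0≤X)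
    (trans
      (solve 9 (λ g c d D M X q w h →
          :- (d :* q :- c :* X) :- h :* X
        := (c :- (h :+ h)) :* X :+ (D :- d) :* q :+ D :* (w :* (M :* X) :- q) :+ h :* X :- D :* M :* w :* X)
        refl γ c d D M X q w (½ ℚ.* γ))
      (trans (cong₂ (λ h g → (c ℚ.- g) ℚ.* X ℚ.+ (D ℚ.- d) ℚ.* q ℚ.+ D ℚ.* (w ℚ.* (M ℚ.* X) ℚ.- q) ℚ.+ h ℚ.* X ℚ.- D ℚ.* M ℚ.* w ℚ.* X)
               (sym eq) (halves γ))
        (solve 9 (λ g c d D M X q w e →
            (c :- g) :* X :+ (D :- d) :* q :+ D :* (w :* (M :* X) :- q) :+ (D :* M :* e :+ e) :* X :- D :* M :* w :* X
          := (c :- g) :* X :+ (D :- d) :* q :+ D :* (w :* (M :* X) :- q) :+ D :* M :* (e :- w) :* X :+ e :* X)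
          refl γ c d D M X q w δ)))
    where open ℚSolver.+-*-Solver

  -- At the fixed vector the pencil is negative for the parameter a, and moving to b′ adds only (b′
  -- - a)Δ, at most the width of the bracket times MX.
  pencil-bound : ∀ a b b′ M X Δ s → b′ ℚ.≤ b → 0ℚ ℚ.≤ Δ → a ℚ.≤ b → Δ ℚ.≤ M ℚ.* X →
    0ℚ ℚ.< ℚ.- (a ℚ.* Δ ℚ.- s) → b′ ℚ.* Δ ℚ.- s ℚ.≤ (b ℚ.- a) ℚ.* (M ℚ.* X)
  pencil-bound a b b′ M X Δ s b′≤b 0≤Δ a≤b Δ≤ neg = ≤-by
    (≤⇒0≤ b′≤b ⊗ 0≤Δ ⊕ ≤⇒0≤ a≤b ⊗ ≤⇒0≤ Δ≤ ⊕ ℚ.<⇒≤ neg)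
    (solve 7 (λ a b b' M X Δ s → (b :- a) :* (M :* X) :- (b' :* Δ :- s)
       := (b :- b') :* Δ :+ (b :- a) :* (M :* X :- Δ) :+ :- (a :* Δ :- s)) refl a b b′ M X Δ s)
    where open ℚSolver.+-*-Solver

quad-null : ∀ {n} (B : ℚ-forms.Matrix n) x → ℚ-forms.dot x x ≡ 0ℚ → ℚ-forms.quad B x ≡ 0ℚ
quad-null B x x·x≡0 = ℚ-forms.quad-zeroʳ B {x} λ i →
  ℚ-ring.sq-≈0 {x i} (ℚ-ring.nn-sum-≈0 {f = λ i → x i ℚ.* x i} (λ j → ℚ-ring.nn-sq (x j)) x·x≡0 i)

ℝ-sign : ∀ x → ¬ ¬ (Posℝ (⊟ x) ⊎ x ≈ℝ 0ℝ ⊎ Posℝ x)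
ℝ-sign x k = ℝ-ring.sign-case x (λ neg → k (inj₁ neg)) (λ z → k (inj₂ (inj₁ z))) (λ pos → k (inj₂ (inj₂ pos)))

open ℝ-forms.Classify (λ A → ¬ ¬ A) (λ a k → k a) (λ m f k → m (λ a → f a k)) ℝ-sign using ()
  renaming (classify to ℝ-classify)

-- Since Δ dominates the Euclidean form, tΔ - S is increasing in t and positive semidefinite for
-- large t; bisection between a negative and a semidefinite parameter rests on both.
module Pencil {n} (Δ S : ℚ-forms.Matrix n) (Δ-sym : ℚ-forms.Symmetric Δ) (S-sym : ℚ-forms.Symmetric S)
  (Δ-large : ∀ x → ℚ-forms.dot x x ℚ.≤ ℚ-forms.quad Δ x)
  where

  open ℚ-forms using (dot; quad; PSD; Negative)
  open ℚSolver.+-*-Solver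

  pencil : ℚ → ℚ-forms.Matrix n
  pencil t i j = t ℚ.* Δ i j ℚ.- S i j

  pencilℝ : ℝ → ℝ-forms.Matrix n
  pencilℝ t i j = t ⊠ fromℚ (Δ i j) ⊞ ⊟ fromℚ (S i j)

  seq-pencilℝ : ∀ t i j k → seq (pencilℝ t i j) k ≡ pencil (seq t k) i j
  seq-pencilℝ t i j k = trans (seq-⊞ (t ⊠ fromℚ (Δ i j)) (⊟ fromℚ (S i j)) k)
    (cong₂ ℚ._+_ (seq-⊠ t (fromℚ (Δ i j)) k) (seq-⊟ (fromℚ (S i j)) k))

  seq-quad-pencilℝ : ∀ t x k → seq (ℝ-forms.quad (pencilℝ t) x) k ≡ quad (pencil (seq t k)) (λ i → seq (x i) k)
  seq-quad-pencilℝ t x k = trans (seq-quad (pencilℝ t) x k)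
    (ℚ-ring.sum-cong-≋ (λ i → cong (seq (x i) k ℚ.*_)
      (ℚ-ring.sum-cong-≋ (λ j → cong (ℚ._* seq (x j) k) (seq-pencilℝ t i j k)))))

  pencil-sym : ∀ t → ℚ-forms.Symmetric (pencil t)
  pencil-sym t i j = cong₂ (λ a b → t ℚ.* a ℚ.- b) (Δ-sym i j) (S-sym i j)

  pencilℝ-sym : ∀ t → ℝ-forms.Symmetric (pencilℝ t)
  pencilℝ-sym t i j = pointwise λ k →
    trans (seq-pencilℝ t i j k) (trans (pencil-sym (seq t k) i j) (sym (seq-pencilℝ t j i k)))

  quad-pencil : ∀ t x → quad (pencil t) x ≡ t ℚ.* quad Δ x ℚ.- quad S x
  quad-pencil t x = trans
    (ℚ-ring.sum-cong-≋ (λ i → cong (x i ℚ.*_) (trans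
      (ℚ-forms.dot-cong {f = pencil t i} {g = λ j → t ℚ.* Δ i j ℚ.- 1ℚ ℚ.* S i j}
        (λ j → cong (λ s → t ℚ.* Δ i j ℚ.- s) (sym (ℚ.*-identityˡ (S i j)))) (λ _ → refl))
      (ℚ-forms.dot-linear t 1ℚ (Δ i) (S i) x))))
    (trans (ℚ-forms.dot-comm x _)
      (trans (ℚ-forms.dot-linear t 1ℚ (λ i → dot (Δ i) x) (λ i → dot (S i) x) x)
        (cong₂ (λ a b → t ℚ.* a ℚ.- b) (ℚ-forms.dot-comm (λ i → dot (Δ i) x) x)
          (trans (ℚ.*-identityˡ _) (ℚ-forms.dot-comm (λ i → dot (S i) x) x)))))

  psd? : ∀ t → Negative (pencil t) ⊎ PSD (pencil t)
  psd? t with ℚ-forms.Classify.classify (λ A → A) (λ a → a) (λ a f → f a) ℚ-sign (pencil t) (pencil-sym t)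
  ... | inj₁ neg       = inj₁ neg
  ... | inj₂ (psd , _) = inj₂ psd

  psd-eventually : ∃[ t ] PSD (pencil t)
  psd-eventually with quad-bounded S S-sym
  ... | r , 0≤r , bound = r , λ x → 0≤⇒nn (subst (0ℚ ℚ.≤_)
    (trans (solve 4 (λ r X D s → r :* (D :- X) :+ (r :* X :- s) := r :* D :- s) refl
             r (dot x x) (quad Δ x) (quad S x)) (sym (quad-pencil r x)))
    (0≤r ⊗ ≤⇒0≤ (Δ-large x) ⊕ ≤⇒0≤ (bound x)))

  record Bracket : Set where
    field
      lo hi  : ℚ
      lo-neg : Negative (pencil lo)
      hi-psd : PSD (pencil hi)

  open Bracket

  width : Bracket → ℚ
  width β = hi β ℚ.- lo β

  -- The form of a pencil increases with the parameter.
  lo≤hi : (β : Bracket) → lo β ℚ.≤ hi β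
  lo≤hi β with lo β ℚ.≤? hi β
  ... | yes h = h
  ... | no ¬h = ⊥-elim (hi-psd β x (ℚ.<-≤-trans neg (ℚ.neg-antimono-≤ (≤-by
      (≤⇒0≤ (ℚ.<⇒≤ (ℚ.≰⇒> ¬h)) ⊗ ℚ.≤-trans (dot-self-nonneg x) (Δ-large x))
      (trans (cong₂ ℚ._-_ (quad-pencil (lo β) x) (quad-pencil (hi β) x))
        (solve 4 (λ a b D s → (a :* D :- s) :- (b :* D :- s) := (a :- b) :* D) refl
          (lo β) (hi β) (quad Δ x) (quad S x)))))))
    where
    x = proj₁ (lo-neg β)
    neg = proj₂ (lo-neg β)

  mid : Bracket → ℚ
  mid β = ½ ℚ.* (lo β ℚ.+ hi β)

  lo≤mid : ∀ β → lo β ℚ.≤ mid β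
  lo≤mid β = ≤-by (ℚ.nonNegative⁻¹ ½ ⊗ ≤⇒0≤ (lo≤hi β))
    (solve 2 (λ a b → con ½ :* (a :+ b) :- a := con ½ :* (b :- a)) refl (lo β) (hi β))

  mid≤hi : ∀ β → mid β ℚ.≤ hi β
  mid≤hi β = ≤-by (ℚ.nonNegative⁻¹ ½ ⊗ ≤⇒0≤ (lo≤hi β))
    (solve 2 (λ a b → b :- con ½ :* (a :+ b) := con ½ :* (b :- a)) refl (lo β) (hi β))

  _⊑_ : Bracket → Bracket → Set
  γ ⊑ β = lo β ℚ.≤ lo γ × hi γ ℚ.≤ hi β

  bisect : (β : Bracket) → ∃[ γ ] γ ⊑ β × width γ ≡ ½ ℚ.* width β
  bisect β with psd? (mid β)
  ... | inj₁ neg = record { lo = mid β ; hi = hi β ; lo-neg = neg ; hi-psd = hi-psd β }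
    , (lo≤mid β , ℚ.≤-refl)
    , solve 2 (λ a b → b :- con ½ :* (a :+ b) := con ½ :* (b :- a)) refl (lo β) (hi β)
  ... | inj₂ psd = record { lo = lo β ; hi = mid β ; lo-neg = lo-neg β ; hi-psd = psd }
    , (ℚ.≤-refl , mid≤hi β)
    , solve 2 (λ a b → con ½ :* (a :+ b) :- a := con ½ :* (b :- a)) refl (lo β) (hi β)

  module Limit (β₀ : Bracket) where

    β : ℕ → Bracket
    β zero    = β₀
    β (suc k) = proj₁ (bisect (β k))

    β-width : ∀ k → width (β k) ≡ ½^ k ℚ.* width β₀
    β-width zero    = sym (ℚ.*-identityˡ _)
    β-width (suc k) = trans (proj₂ (proj₂ (bisect (β k))))
      (trans (cong (½ ℚ.*_) (β-width k)) (sym (ℚ.*-assoc ½ (½^ k) (width β₀))))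

    β-nested : ∀ {k m} → k ℕ.≤ m → β m ⊑ β k
    β-nested k≤m = go (ℕ.≤⇒≤′ k≤m)
      where
      go : ∀ {k m} → k ℕ.≤′ m → β m ⊑ β k
      go (ℕ.≤′-reflexive refl) = ℚ.≤-refl , ℚ.≤-refl
      go {k} {suc m} (ℕ.≤′-step h) with go h | proj₁ (proj₂ (bisect (β m)))
      ... | a , b | c , d = ℚ.≤-trans a c , ℚ.≤-trans d b

    β-small : ∀ {ε} → 0ℚ ℚ.< ε → ∃[ k ] width (β k) ℚ.≤ ε
    β-small {ε} ε>0 = from-½^ (½^-small {width β₀} {ε} 0≤width ε>0)
      where
      0≤width : 0ℚ ℚ.≤ width β₀
      0≤width = ≤⇒0≤ (lo≤hi β₀)
      from-½^ : ∃[ k ] ½^ k ℚ.* width β₀ ℚ.≤ ε → ∃[ k ] width (β k) ℚ.≤ ε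
      from-½^ (k , h) = k , subst (λ w → w ℚ.≤ ε) (sym (β-width k)) h

    lo≤hi′ : ∀ {k m} → k ℕ.≤ m → lo (β k) ℚ.≤ hi (β m)
    lo≤hi′ {m = m} k≤m = ℚ.≤-trans (proj₁ (β-nested k≤m)) (lo≤hi (β m))

    -- Upper ends are used as approximations because they carry information term by term: each
    -- rational pencil at `hi (β k)` is positive semidefinite, and each term is at least the initial
    -- lower end.
    μ : ℝ
    μ = mkℝ (λ k → hi (β k)) λ ε ε>0 → let N , small = β-small ε>0 in
      N , λ l m N≤l N≤m → ∣∣≤ (close N small l m N≤l N≤m)
        (subst (ℚ._≤ ε) (solve 2 (λ a b → b :- a := :- (a :- b)) refl (hi (β l)) (hi (β m)))
          (close N small m l N≤m N≤l))
      where
      close : ∀ {ε} N → width (β N) ℚ.≤ ε → ∀ l m → N ℕ.≤ l → N ℕ.≤ m → hi (β l) ℚ.- hi (β m) ℚ.≤ ε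
      close {ε} N small l m N≤l N≤m = ℚ.≤-trans
        (≤-by (≤⇒0≤ (proj₂ (β-nested N≤l)) ⊕ ≤⇒0≤ (lo≤hi′ N≤m))
          (solve 4 (λ a b c d → (d :- c) :- (a :- b) := (d :- a) :+ (b :- c)) refl
            (hi (β l)) (hi (β m)) (lo (β N)) (hi (β N)))) small

    pencil-psd : ℝ-forms.PSD (pencilℝ μ)
    pencil-psd x (ε , ε>0 , N , h) = hi-psd (β N) (λ i → seq (x i) N)
      (ℚ.<-≤-trans ε>0 (subst (ε ℚ.≤_) (trans (seq-⊟ (ℝ-forms.quad (pencilℝ μ) x) N) (cong ℚ.-_ (seq-quad-pencilℝ μ x N))) (h N ℕ.≤-refl)))

    -- Take the bracket so narrow that its width times the constants of the alleged bound is small.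
    -- The vector x on which the form is negative at `lo (β k)` makes it at most width·M·|x|² at
    -- every later upper end, which is less than coercivity demands. The constants c, d, M are fixed
    -- before x is chosen.
    ¬coercive : ¬ ℝ-forms.Coercive (pencilℝ μ)
    ¬coercive (c , d , pos-c , _ , h) = go pos-c (bounded d) (quad-bounded Δ Δ-sym)
     where
     go : Posℝ c → Bounded (seq d) → (∃[ M ] 0ℚ ℚ.≤ M × ∀ x → quad Δ x ℚ.≤ M ℚ.* dot x x) → ⊥
     go (γ , γ>0 , c-large) (D , D>0 , d-small) (M , 0≤M , Δ-bound) =
        h xℝ (ε , ε>0 , eventually-map₂ {P = λ m → γ ℚ.≤ seq c m × ℚ.∣ seq d m ∣ ℚ.≤ D} {Q = k ℕ.≤_} {R = λ m → ε ℚ.≤ seq gap m}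
          below (eventually-map₂ (λ _ → _,_) c-large d-small) (k , λ _ k≤m → k≤m))
      where
      small : ∃[ δ ] 0ℚ ℚ.< δ × D ℚ.* M ℚ.* δ ℚ.+ δ ≡ ½ ℚ.* γ
      small = split-off (ℚ.<⇒≤ D>0 ⊗ 0≤M) (halve γ>0)
      δ : ℚ
      δ = proj₁ small
      k : ℕ
      k = proj₁ (β-small {δ} (proj₁ (proj₂ small)))
      w≤δ : width (β k) ℚ.≤ δ
      w≤δ = proj₂ (β-small {δ} (proj₁ (proj₂ small)))
      x : ℚ-forms.Vector n
      x = proj₁ (lo-neg (β k))
      X : ℚ
      X = dot x x
      X>0 : 0ℚ ℚ.< X
      X>0 = 0≤∧≢0⇒0< (dot-self-nonneg x) λ X≡0 → ℚ.<-irrefl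
        (cong ℚ.-_ (sym (quad-null (pencil (lo (β k))) x X≡0)))
        (proj₂ (lo-neg (β k)))
      ε : ℚ
      ε = ½ ℚ.* γ ℚ.* X
      ε>0 : 0ℚ ℚ.< ε
      ε>0 = pos*pos (halve γ>0) X>0
      xℝ : ℝ-forms.Vector n
      xℝ i = fromℚ (x i)
      gap : ℝ
      gap = ⊟ (d ⊠ ℝ-forms.quad (pencilℝ μ) xℝ ⊞ ⊟ (c ⊠ ℝ-forms.dot xℝ xℝ))
      seq-gap : ∀ m → seq gap m ≡ ℚ.- (seq d m ℚ.* quad (pencil (hi (β m))) x ℚ.- seq c m ℚ.* X)
      seq-gap m = trans (seq-⊟ _ m) (cong ℚ.-_ (trans (seq-⊞ (d ⊠ ℝ-forms.quad (pencilℝ μ) xℝ) _ m) (cong₂ ℚ._+_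
        (trans (seq-⊠ d _ m) (cong (seq d m ℚ.*_) (seq-quad-pencilℝ μ xℝ m)))
        (trans (seq-⊟ _ m) (cong ℚ.-_ (trans (seq-⊠ c _ m) (cong (seq c m ℚ.*_) (seq-dot xℝ xℝ m))))))))
      below : ∀ m → γ ℚ.≤ seq c m × ℚ.∣ seq d m ∣ ℚ.≤ D → k ℕ.≤ m →
        ε ℚ.≤ seq gap m
      below m (γ≤c , d≤D) k≤m = ℚ.≤-trans {j = ℚ.- (seq d m ℚ.* q ℚ.- seq c m ℚ.* X)}
        (coercive-bound γ (seq c m) (seq d m) D M X q (width (β k)) δ
          γ≤c (ℚ.≤-trans (≤∣∣ (seq d m)) d≤D) D>0 0≤M (ℚ.<⇒≤ X>0) (nn⇒0≤ (hi-psd (β m) x)) q≤ w≤δ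
          (proj₁ (proj₂ small)) (proj₂ (proj₂ small)))
        (ℚ.≤-reflexive (sym (seq-gap m)))
        where
        q : ℚ
        q = quad (pencil (hi (β m))) x
        q≤ : q ℚ.≤ width (β k) ℚ.* (M ℚ.* X)
        q≤ = ℚ.≤-trans (ℚ.≤-reflexive (quad-pencil (hi (β m)) x))
          (pencil-bound (lo (β k)) (hi (β k)) (hi (β m)) M X (quad Δ x) (quad S x)
            (proj₂ (β-nested k≤m)) (ℚ.≤-trans (ℚ.<⇒≤ X>0) (Δ-large x)) (lo≤hi (β k)) (Δ-bound x)
            (subst (λ z → 0ℚ ℚ.< ℚ.- z) (quad-pencil (lo (β k)) x) (proj₂ (lo-neg (β k)))))

    kernel : ¬ ¬ ℝ-forms.Kernel (pencilℝ μ)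
    kernel ¬kernel = ℝ-classify (pencilℝ μ) (pencilℝ-sym μ) refute
      where
      refute : ¬ (ℝ-forms.Negative (pencilℝ μ) ⊎ ℝ-forms.PSD (pencilℝ μ) × (ℝ-forms.Kernel (pencilℝ μ) ⊎ ℝ-forms.Coercive (pencilℝ μ)))
      refute (inj₁ (x , neg))      = pencil-psd x neg
      refute (inj₂ (_ , inj₁ ker)) = ¬kernel ker
      refute (inj₂ (_ , inj₂ coe)) = ¬coercive coe

  top-eigenvalue : ∀ {t} → Negative (pencil t) →
    ¬ ¬ (∃[ μ ] (∀ k → t ℚ.≤ seq μ k) × ℝ-forms.Kernel (pencilℝ μ))
  top-eigenvalue {t} neg ¬top = kernel λ ker → ¬top (μ , (λ k → lo≤hi′ {0} {k} ℕ.z≤n) , ker)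
    where
    initial : Bracket
    initial = record { lo = t ; hi = proj₁ psd-eventually ; lo-neg = neg ; hi-psd = proj₂ psd-eventually }
    open Limit initial

-- Weights of ordered simplices

module ℕ-sum = SemiringSum ℕ.+-*-semiring
open ℕ-sum using () renaming (sum to sumℕ)

χ : ∀ {A : Set} → Dec A → ℕ
χ d = if does d then 1 else 0

χ-yes : ∀ {A : Set} (d : Dec A) → A → χ d ≡ 1
χ-yes (yes _) _ = refl
χ-yes (no ¬a) a = ⊥-elim (¬a a)

χ-no : ∀ {A : Set} (d : Dec A) → ¬ A → χ d ≡ 0
χ-no (yes a) ¬a = ⊥-elim (¬a a)
χ-no (no _)  _  = refl

χ-cong : ∀ {A B : Set} (d : Dec A) (e : Dec B) → (A → B) → (B → A) → χ d ≡ χ e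
χ-cong (yes a) e f g = sym (χ-yes e (f a))
χ-cong (no ¬a) e f g = sym (χ-no e (¬a ∘ g))

sumL : ∀ {A : Set} → (A → ℕ) → List A → ℕ
sumL f xs = listSum (List.map f xs)

sumL-cong : ∀ {A : Set} {f g : A → ℕ} → (∀ x → f x ≡ g x) → ∀ xs → sumL f xs ≡ sumL g xs
sumL-cong eq []       = refl
sumL-cong eq (x ∷ xs) = cong₂ ℕ._+_ (eq x) (sumL-cong eq xs)

sumL-*ˡ : ∀ {A : Set} c (f : A → ℕ) xs → sumL (λ x → c ℕ.* f x) xs ≡ c ℕ.* sumL f xs
sumL-*ˡ c f []       = sym (ℕ.*-zeroʳ c)
sumL-*ˡ c f (x ∷ xs) = trans (cong (c ℕ.* f x ℕ.+_) (sumL-*ˡ c f xs)) (sym (ℕ.*-distribˡ-+ c (f x) (sumL f xs)))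

sumℕ-zero : ∀ {n} {f : Fin n → ℕ} → (∀ i → f i ≡ 0) → sumℕ f ≡ 0
sumℕ-zero {zero}  eq = refl
sumℕ-zero {suc n} eq = cong₂ ℕ._+_ (eq zero) (sumℕ-zero (λ i → eq (suc i)))

sumL-sumℕ : ∀ {A : Set} {n} (f : Fin n → A → ℕ) xs →
  sumL (λ x → sumℕ (λ v → f v x)) xs ≡ sumℕ (λ v → sumL (f v) xs)
sumL-sumℕ f []       = sym (sumℕ-zero {f = λ v → sumL (f v) []} (λ _ → refl))
sumL-sumℕ f (x ∷ xs) = trans (cong (sumℕ (λ v → f v x) ℕ.+_) (sumL-sumℕ f xs))
  (sym (ℕ-sum.∑-distrib-+ (λ v → f v x) (λ v → sumL (f v) xs)))

length-filter : ∀ {A : Set} {P : A → Set} (P? : Decidable P) xs → length (filter P? xs) ≡ sumL (λ x → χ (P? x)) xs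
length-filter P? []       = refl
length-filter P? (x ∷ xs) with P? x
... | yes _ = cong suc (length-filter P? xs)
... | no  _ = length-filter P? xs

subsets-complete : ∀ {N} (σ : Subset N) → σ List.∈ subsets N
subsets-complete []            = here refl
subsets-complete (outside ∷ σ) = List.∈-++⁺ˡ (List.∈-map⁺ (outside ∷_) (subsets-complete σ))
subsets-complete (inside  ∷ σ) = List.∈-++⁺ʳ _ (List.∈-map⁺ (inside ∷_) (subsets-complete σ))

count≢0 : ∀ {N} {P : Subset N → Set} (P? : Decidable P) σ → P σ → count P? ≢ 0
count≢0 P? σ Pσ eq with filter P? (subsets _) | List.∈-filter⁺ P? (subsets-complete σ) Pσ
count≢0 P? σ Pσ () | _ ∷ _ | here _
count≢0 P? σ Pσ () | _ ∷ _ | there _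

count-witness : ∀ {N} {P : Subset N → Set} (P? : Decidable P) → count P? ≢ 0 → ∃[ σ ] P σ
count-witness P? ≢0 = go (filter P? (subsets _)) (λ σ σ∈ → proj₂ (List.∈-filter⁻ P? {xs = subsets _} σ∈)) ≢0
  where
  go : ∀ xs → (∀ σ → σ List.∈ xs → _) → length xs ≢ 0 → _
  go []      _ ≢0 = ⊥-elim (≢0 refl)
  go (σ ∷ _) P _  = σ , P σ (here refl)

∣∣-sum : ∀ {N} (σ : Subset N) → ∣ σ ∣ ≡ sumℕ (λ v → χ (v ∈? σ))
∣∣-sum []            = refl
∣∣-sum (outside ∷ σ) = ∣∣-sum σ
∣∣-sum (inside  ∷ σ) = cong suc (∣∣-sum σ)

∪-∉ : ∀ {N} {v : Fin N} {σ τ : Subset N} → v ∉ σ → v ∉ τ → v ∉ σ ∪ τ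
∪-∉ {σ = σ} {τ} v∉σ v∉τ v∈ with Subset.x∈p∪q⁻ σ τ v∈
... | inj₁ v∈σ = v∉σ v∈σ
... | inj₂ v∈τ = v∉τ v∈τ

∪-⊆ : ∀ {N} {σ τ ρ : Subset N} → σ ⊆ ρ → τ ⊆ ρ → σ ∪ τ ⊆ ρ
∪-⊆ {σ = σ} {τ} σ⊆ρ τ⊆ρ v∈ with Subset.x∈p∪q⁻ σ τ v∈
... | inj₁ v∈σ = σ⊆ρ v∈σ
... | inj₂ v∈τ = τ⊆ρ v∈τ

⁅⁆-⊆ : ∀ {N} {v : Fin N} {σ : Subset N} → v ∈ σ → ⁅ v ⁆ ⊆ σ
⁅⁆-⊆ {v = v} {σ} v∈σ u∈ = subst (_∈ σ) (sym (Subset.x∈⁅y⁆⇒x≡y v u∈)) v∈σ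

∪-swap : ∀ {N} (ρ σ τ : Subset N) → ρ ∪ (σ ∪ τ) ≡ σ ∪ (ρ ∪ τ)
∪-swap ρ σ τ = trans (sym (Subset.∪-assoc ρ σ τ)) (trans (cong (_∪ τ) (Subset.∪-comm ρ σ)) (Subset.∪-assoc σ ρ τ))

∣⁅v⁆∪τ∣ : ∀ {N} {v : Fin N} {τ : Subset N} → v ∉ τ → ∣ ⁅ v ⁆ ∪ τ ∣ ≡ suc ∣ τ ∣
∣⁅v⁆∪τ∣ {v = zero}  {outside ∷ τ} v∉τ = cong (suc ∘ ∣_∣) (Subset.∪-identityˡ τ)
∣⁅v⁆∪τ∣ {v = zero}  {inside ∷ τ}  v∉τ = ⊥-elim (v∉τ Vec.here)
∣⁅v⁆∪τ∣ {v = suc v} {outside ∷ τ} v∉τ = ∣⁅v⁆∪τ∣ (v∉τ ∘ Vec.there)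
∣⁅v⁆∪τ∣ {v = suc v} {inside ∷ τ}  v∉τ = cong suc (∣⁅v⁆∪τ∣ (v∉τ ∘ Vec.there))

∣⁅v⁆∪τ∣-∈ : ∀ {N} {v : Fin N} {τ : Subset N} → v ∈ τ → ∣ ⁅ v ⁆ ∪ τ ∣ ≡ ∣ τ ∣
∣⁅v⁆∪τ∣-∈ {v = v} {τ} v∈τ = cong ∣_∣ (Subset.⊆-antisym (∪-⊆ (⁅⁆-⊆ v∈τ) (λ u∈ → u∈)) (Subset.q⊆p∪q ⁅ v ⁆ τ))

complement-size : ∀ {N} {σ τ : Subset N} → τ ⊆ σ →
  sumℕ (λ v → χ (¬? (v ∈? τ)) ℕ.* χ (v ∈? σ)) ≡ ∣ σ ∣ ℕ.∸ ∣ τ ∣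
complement-size {σ = σ} {τ} τ⊆σ = sym (trans
  (cong (ℕ._∸ ∣ τ ∣) (begin
    ∣ σ ∣
      ≡⟨ ∣∣-sum σ ⟩
    sumℕ (λ v → χ (v ∈? σ))
      ≡⟨ ℕ-sum.sum-cong-≋ split ⟩
    sumℕ (λ v → χ (¬? (v ∈? τ)) ℕ.* χ (v ∈? σ) ℕ.+ χ (v ∈? τ))
      ≡⟨ ℕ-sum.∑-distrib-+ (λ v → χ (¬? (v ∈? τ)) ℕ.* χ (v ∈? σ)) (λ v → χ (v ∈? τ)) ⟩
    sumℕ (λ v → χ (¬? (v ∈? τ)) ℕ.* χ (v ∈? σ)) ℕ.+ sumℕ (λ v → χ (v ∈? τ))
      ≡⟨ cong (sumℕ (λ v → χ (¬? (v ∈? τ)) ℕ.* χ (v ∈? σ)) ℕ.+_) (∣∣-sum τ) ⟨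
    sumℕ (λ v → χ (¬? (v ∈? τ)) ℕ.* χ (v ∈? σ)) ℕ.+ ∣ τ ∣ ∎))
  (ℕ.m+n∸n≡m _ ∣ τ ∣))
  where
  open ≡-Reasoning
  split : ∀ v → χ (v ∈? σ) ≡ χ (¬? (v ∈? τ)) ℕ.* χ (v ∈? σ) ℕ.+ χ (v ∈? τ)
  split v with v ∈? τ
  ... | yes v∈τ = χ-yes (v ∈? σ) (τ⊆σ v∈τ)
  ... | no  _   = sym (trans (ℕ.+-identityʳ _) (ℕ.*-identityˡ _))

support : ∀ {N} → List (Fin N) → Subset N
support []      = ∅
support (v ∷ l) = ⁅ v ⁆ ∪ support l

Distinct : ∀ {N} → List (Fin N) → Set
Distinct []      = ⊤
Distinct (v ∷ l) = v ∉ support l × Distinct l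

distinct? : ∀ {N} (l : List (Fin N)) → Dec (Distinct l)
distinct? []      = yes tt
distinct? (v ∷ l) = ¬? (v ∈? support l) ×-dec distinct? l

∣support∣ : ∀ {N} {l : List (Fin N)} → Distinct l → ∣ support l ∣ ≡ length l
∣support∣ {N} {[]}  _         = Subset.∣⊥∣≡0 N
∣support∣ {l = v ∷ l} (v∉ , d) = trans (∣⁅v⁆∪τ∣ v∉) (cong suc (∣support∣ d))

distinct-swap : ∀ {N} (u v : Fin N) l → Distinct (u ∷ v ∷ l) → Distinct (v ∷ u ∷ l)
distinct-swap u v l (u∉ , v∉ , d) =
    ∪-∉ (λ v∈⁅u⁆ → u∉ (Subset.p⊆p∪q (support l) (subst (_∈ ⁅ v ⁆) (Subset.x∈⁅y⁆⇒x≡y u v∈⁅u⁆) (Subset.x∈⁅x⁆ v)))) v∉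
  , (λ u∈ → u∉ (Subset.q⊆p∪q ⁅ v ⁆ (support l) u∈)) , d

module Weights {N} (X : SimplicialComplex N) (n : ℕ) where

  facet? : ∀ σ → Dec ((X ⟨ suc n ⟩) σ)
  facet? = X ⟨ suc n ⟩?

  degree-sum : ∀ τ → degree X n τ ≡ sumL (λ σ → χ (facet? σ ×-dec τ ⊆? σ)) (subsets N)
  degree-sum τ = length-filter (λ σ → facet? σ ×-dec τ ⊆? σ) (subsets N)

  -- m({v₁,…,vⱼ}), extended by 0 to lists with repeated entries.
  wℕ : List (Fin N) → ℕ
  wℕ l = χ (distinct? l) ℕ.* weight X n (support l)

  wℕ-distinct : ∀ l → Distinct l → wℕ l ≡ weight X n (support l)
  wℕ-distinct l d = trans (cong (ℕ._* weight X n (support l)) (χ-yes (distinct? l) d)) (ℕ.*-identityˡ _)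

  wℕ-repeated : ∀ l → ¬ Distinct l → wℕ l ≡ 0
  wℕ-repeated l ¬d = cong (ℕ._* weight X n (support l)) (χ-no (distinct? l) ¬d)

  wℕ-swap : ∀ u v l → wℕ (u ∷ v ∷ l) ≡ wℕ (v ∷ u ∷ l)
  wℕ-swap u v l = cong₂ ℕ._*_
    (χ-cong (distinct? (u ∷ v ∷ l)) (distinct? (v ∷ u ∷ l)) (distinct-swap u v l) (distinct-swap v u l))
    (cong (weight X n) (∪-swap ⁅ u ⁆ ⁅ v ⁆ (support l)))

  -- A facet σ ⊇ τ has n+1-∣τ∣ vertices outside τ.
  degree-marginal : ∀ τ →
    sumℕ (λ v → χ (¬? (v ∈? τ)) ℕ.* degree X n (⁅ v ⁆ ∪ τ)) ≡ (suc n ℕ.∸ ∣ τ ∣) ℕ.* degree X n τ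
  degree-marginal τ = begin
    sumℕ (λ v → χ (¬? (v ∈? τ)) ℕ.* degree X n (⁅ v ⁆ ∪ τ))
      ≡⟨ ℕ-sum.sum-cong-≋ (λ v → trans (cong (χ (¬? (v ∈? τ)) ℕ.*_) (degree-sum (⁅ v ⁆ ∪ τ)))
           (sym (sumL-*ˡ (χ (¬? (v ∈? τ))) _ (subsets N)))) ⟩
    sumℕ (λ v → sumL (λ σ → χ (¬? (v ∈? τ)) ℕ.* χ (facet? σ ×-dec (⁅ v ⁆ ∪ τ) ⊆? σ)) (subsets N))
      ≡⟨ sumL-sumℕ (λ v σ → χ (¬? (v ∈? τ)) ℕ.* χ (facet? σ ×-dec (⁅ v ⁆ ∪ τ) ⊆? σ)) (subsets N) ⟨
    sumL (λ σ → sumℕ (λ v → χ (¬? (v ∈? τ)) ℕ.* χ (facet? σ ×-dec (⁅ v ⁆ ∪ τ) ⊆? σ))) (subsets N)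
      ≡⟨ sumL-cong per-facet (subsets N) ⟩
    sumL (λ σ → (suc n ℕ.∸ ∣ τ ∣) ℕ.* χ (facet? σ ×-dec τ ⊆? σ)) (subsets N)
      ≡⟨ sumL-*ˡ (suc n ℕ.∸ ∣ τ ∣) _ (subsets N) ⟩
    (suc n ℕ.∸ ∣ τ ∣) ℕ.* sumL (λ σ → χ (facet? σ ×-dec τ ⊆? σ)) (subsets N)
      ≡⟨ cong ((suc n ℕ.∸ ∣ τ ∣) ℕ.*_) (degree-sum τ) ⟨
    (suc n ℕ.∸ ∣ τ ∣) ℕ.* degree X n τ ∎
    where
    open ≡-Reasoning
    per-facet : ∀ σ → sumℕ (λ v → χ (¬? (v ∈? τ)) ℕ.* χ (facet? σ ×-dec (⁅ v ⁆ ∪ τ) ⊆? σ))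
                    ≡ (suc n ℕ.∸ ∣ τ ∣) ℕ.* χ (facet? σ ×-dec τ ⊆? σ)
    per-facet σ = by-cases (facet? σ ×-dec τ ⊆? σ)
      where
      by-cases : Dec ((X ⟨ suc n ⟩) σ × τ ⊆ σ) → _
      by-cases (yes (facet , τ⊆σ)) = begin
        sumℕ (λ v → χ (¬? (v ∈? τ)) ℕ.* χ (facet? σ ×-dec (⁅ v ⁆ ∪ τ) ⊆? σ))
          ≡⟨ ℕ-sum.sum-cong-≋ (λ v → cong (χ (¬? (v ∈? τ)) ℕ.*_)
               (χ-cong (facet? σ ×-dec (⁅ v ⁆ ∪ τ) ⊆? σ) (v ∈? σ)
                 (λ (_ , vτ⊆σ) → vτ⊆σ (Subset.p⊆p∪q τ (Subset.x∈⁅x⁆ v)))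
                 (λ v∈σ → facet , ∪-⊆ (⁅⁆-⊆ v∈σ) τ⊆σ))) ⟩
        sumℕ (λ v → χ (¬? (v ∈? τ)) ℕ.* χ (v ∈? σ))
          ≡⟨ complement-size τ⊆σ ⟩
        ∣ σ ∣ ℕ.∸ ∣ τ ∣
          ≡⟨ cong (ℕ._∸ ∣ τ ∣) (proj₂ facet) ⟩
        suc n ℕ.∸ ∣ τ ∣
          ≡⟨ ℕ.*-identityʳ (suc n ℕ.∸ ∣ τ ∣) ⟨
        (suc n ℕ.∸ ∣ τ ∣) ℕ.* 1
          ≡⟨ cong ((suc n ℕ.∸ ∣ τ ∣) ℕ.*_) (χ-yes (facet? σ ×-dec τ ⊆? σ) (facet , τ⊆σ)) ⟨
        (suc n ℕ.∸ ∣ τ ∣) ℕ.* χ (facet? σ ×-dec τ ⊆? σ) ∎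
      by-cases (no ¬fτ) = trans
        (sumℕ-zero (λ v → trans (cong (χ (¬? (v ∈? τ)) ℕ.*_)
          (χ-no (facet? σ ×-dec (⁅ v ⁆ ∪ τ) ⊆? σ) (λ (f , vτ⊆σ) → ¬fτ (f , λ u∈ → vτ⊆σ (Subset.q⊆p∪q ⁅ v ⁆ τ u∈)))))
          (ℕ.*-zeroʳ (χ (¬? (v ∈? τ))))))
        (sym (trans (cong ((suc n ℕ.∸ ∣ τ ∣) ℕ.*_) (χ-no (facet? σ ×-dec τ ⊆? σ) ¬fτ)) (ℕ.*-zeroʳ (suc n ℕ.∸ ∣ τ ∣))))

  -- This is what the factorial in the weight is for: summing the degrees over v produces the factor
  -- n + 1 - |τ|, which turns (n - |τ|)! into (n + 1 - |τ|)!. At length n + 1 a facet has no vertex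
  -- left to add, hence the bound on the length.
  wℕ-marginal : ∀ l → length l ℕ.≤ n → wℕ l ≡ sumℕ (λ v → wℕ (v ∷ l))
  wℕ-marginal l ∣l∣≤n = by-cases (distinct? l)
    where
    open ≡-Reasoning
    τ = support l
    by-cases : Dec (Distinct l) → wℕ l ≡ sumℕ (λ v → wℕ (v ∷ l))
    by-cases (no ¬d) = trans (wℕ-repeated l ¬d) (sym (sumℕ-zero {f = λ v → wℕ (v ∷ l)} (λ v → wℕ-repeated (v ∷ l) (λ (_ , d) → ¬d d))))
    by-cases (yes d) = sym (begin
      sumℕ (λ v → wℕ (v ∷ l))
        ≡⟨ ℕ-sum.sum-cong-≋ extend ⟩
      sumℕ (λ v → (n ℕ.∸ ∣ τ ∣) ! ℕ.* (χ (¬? (v ∈? τ)) ℕ.* degree X n (⁅ v ⁆ ∪ τ)))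
        ≡⟨ ℕ-sum.*-distribˡ-sum ((n ℕ.∸ ∣ τ ∣) !) (λ v → χ (¬? (v ∈? τ)) ℕ.* degree X n (⁅ v ⁆ ∪ τ)) ⟨
      (n ℕ.∸ ∣ τ ∣) ! ℕ.* sumℕ (λ v → χ (¬? (v ∈? τ)) ℕ.* degree X n (⁅ v ⁆ ∪ τ))
        ≡⟨ cong ((n ℕ.∸ ∣ τ ∣) ! ℕ.*_) (degree-marginal τ) ⟩
      (n ℕ.∸ ∣ τ ∣) ! ℕ.* ((suc n ℕ.∸ ∣ τ ∣) ℕ.* degree X n τ)
        ≡⟨ ℕ.*-assoc ((n ℕ.∸ ∣ τ ∣) !) (suc n ℕ.∸ ∣ τ ∣) (degree X n τ) ⟨
      (n ℕ.∸ ∣ τ ∣) ! ℕ.* (suc n ℕ.∸ ∣ τ ∣) ℕ.* degree X n τ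
        ≡⟨ cong (ℕ._* degree X n τ) factorial ⟩
      weight X n τ
        ≡⟨ wℕ-distinct l d ⟨
      wℕ l ∎)
      where
      ∣τ∣≤n : ∣ τ ∣ ℕ.≤ n
      ∣τ∣≤n = subst (ℕ._≤ n) (sym (∣support∣ d)) ∣l∣≤n
      factorial : (n ℕ.∸ ∣ τ ∣) ! ℕ.* (suc n ℕ.∸ ∣ τ ∣) ≡ (suc n ℕ.∸ ∣ τ ∣) !
      factorial rewrite ℕ.+-∸-assoc 1 ∣τ∣≤n = ℕ.*-comm ((n ℕ.∸ ∣ τ ∣) !) (suc (n ℕ.∸ ∣ τ ∣))
      extend : ∀ v → wℕ (v ∷ l) ≡ (n ℕ.∸ ∣ τ ∣) ! ℕ.* (χ (¬? (v ∈? τ)) ℕ.* degree X n (⁅ v ⁆ ∪ τ))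
      extend v = extend-by (v ∈? τ)
        where
        extend-by : Dec (v ∈ τ) → wℕ (v ∷ l) ≡ (n ℕ.∸ ∣ τ ∣) ! ℕ.* (χ (¬? (v ∈? τ)) ℕ.* degree X n (⁅ v ⁆ ∪ τ))
        extend-by (yes v∈τ) = trans (wℕ-repeated (v ∷ l) (λ (v∉τ , _) → v∉τ v∈τ)) (sym (trans
          (cong (λ z → (n ℕ.∸ ∣ τ ∣) ! ℕ.* (z ℕ.* degree X n (⁅ v ⁆ ∪ τ))) (χ-no (¬? (v ∈? τ)) (λ v∉τ → v∉τ v∈τ)))
          (ℕ.*-zeroʳ ((n ℕ.∸ ∣ τ ∣) !))))
        extend-by (no v∉τ) = begin
          wℕ (v ∷ l)
            ≡⟨ wℕ-distinct (v ∷ l) (v∉τ , d) ⟩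
          (suc n ℕ.∸ ∣ ⁅ v ⁆ ∪ τ ∣) ! ℕ.* degree X n (⁅ v ⁆ ∪ τ)
            ≡⟨ cong (λ k → (suc n ℕ.∸ k) ! ℕ.* degree X n (⁅ v ⁆ ∪ τ)) (∣⁅v⁆∪τ∣ v∉τ) ⟩
          (n ℕ.∸ ∣ τ ∣) ! ℕ.* degree X n (⁅ v ⁆ ∪ τ)
            ≡⟨ cong ((n ℕ.∸ ∣ τ ∣) ! ℕ.*_) (trans (cong (ℕ._* degree X n (⁅ v ⁆ ∪ τ)) (χ-yes (¬? (v ∈? τ)) v∉τ)) (ℕ.*-identityˡ _)) ⟨
          (n ℕ.∸ ∣ τ ∣) ! ℕ.* (χ (¬? (v ∈? τ)) ℕ.* degree X n (⁅ v ⁆ ∪ τ)) ∎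

  wℕ≢0⇒simplex : ∀ {l} → wℕ l ≢ 0 → Distinct l × Simplex X (support l)
  wℕ≢0⇒simplex {l} ≢0 = distinct , simplex (count-witness (λ σ → facet? σ ×-dec support l ⊆? σ)
      (λ eq → ≢0 (trans (wℕ-distinct l distinct) (trans (cong ((suc n ℕ.∸ ∣ support l ∣) ! ℕ.*_) eq)
        (ℕ.*-zeroʳ ((suc n ℕ.∸ ∣ support l ∣) !))))))
    where
    from-dec : Dec (Distinct l) → Distinct l
    from-dec (yes d) = d
    from-dec (no ¬d) = ⊥-elim (≢0 (wℕ-repeated l ¬d))
    distinct : Distinct l
    distinct = from-dec (distinct? l)
    simplex : (∃[ σ ] (X ⟨ suc n ⟩) σ × support l ⊆ σ) → Simplex X (support l)
    simplex (σ , (σ∈X , _) , τ⊆σ) = closed X τ⊆σ σ∈X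

  -- Purity supplies the facet that makes the degree positive. Together with `wℕ≢0⇒simplex`,
  -- non-vanishing weight characterises ordered simplices, so the vertices and edges of links can be
  -- read off from weights.
  simplex⇒wℕ≢0 : Pure X n → ∀ {l} → Distinct l → Simplex X (support l) → wℕ l ≢ 0
  simplex⇒wℕ≢0 pure {l} d τ∈X eq = from-pure (pure (support l) τ∈X)
    where
    from-pure : (∃[ σ ] (X ⟨ suc n ⟩) σ × support l ⊆ σ) → ⊥
    from-pure (σ , facet , τ⊆σ) = ℕ.≢-nonZero⁻¹ (weight X n (support l))
      {{ℕ.m*n≢0 ((suc n ℕ.∸ ∣ support l ∣) !) (degree X n (support l))
        {{(suc n ℕ.∸ ∣ support l ∣) ℕ.!≢0}}
        {{ℕ.≢-nonZero (count≢0 (λ σ → facet? σ ×-dec support l ⊆? σ) σ (facet , τ⊆σ))}}}}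
      (trans (sym (wℕ-distinct l d)) eq)

-- Spectral gap and mixing in weighted graphs

-- Recursion on both indices instead of a test for equality lets `dot-diagonal` go by the same
-- induction as the sum.
diagonal : ∀ {n} → (Fin n → ℚ) → Fin n → Fin n → ℚ
diagonal d zero    zero    = d zero
diagonal d zero    (suc j) = 0ℚ
diagonal d (suc i) zero    = 0ℚ
diagonal d (suc i) (suc j) = diagonal (d ∘ suc) i j

diagonal-sym : ∀ {n} (d : Fin n → ℚ) i j → diagonal d i j ≡ diagonal d j i
diagonal-sym d zero    zero    = refl
diagonal-sym d zero    (suc j) = refl
diagonal-sym d (suc i) zero    = refl
diagonal-sym d (suc i) (suc j) = diagonal-sym (d ∘ suc) i j

module HarmonicFunctions (R : OrderedRing) where
  open OrderedRingProperties R
  open QuadraticForms R using (Vector; Matrix; Symmetric; dot; dot-cong; dot-linear; dot-comm; dot-zeroˡ; dot-scaleʳ)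
  open Solver using (solve; _:+_; _:*_; _:-_; :-_; _:=_; con)
  open _-Raw-AlmostCommutative⟶_ scalar using (0-homo)
  open import Relation.Binary.Reasoning.Setoid setoid

  dot-diagonal : ∀ {n} (d : Fin n → ℚ) (x : Vector n) i → dot (λ j → ⌊ diagonal d i j ⌋) x ≈ ⌊ d i ⌋ * x i
  dot-diagonal d x zero = ≈-trans
    (+-congˡ (dot-zeroˡ {f = λ _ → ⌊ 0ℚ ⌋} (λ _ → 0-homo) (λ j → x (suc j)))) (+-identityʳ _)
  dot-diagonal d x (suc i) = ≈-trans
    (+-cong (≈-trans (*-congʳ 0-homo) (zeroˡ (x zero))) (dot-diagonal (d ∘ suc) (λ j → x (suc j)) i)) (+-identityˡ _)

  sum-neg : ∀ {n} (f : Vector n) → sum (λ i → - f i) ≈ - sum f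
  sum-neg {zero}  f = ≈-sym -0#≈0#
  sum-neg {suc n} f = ≈-trans (+-congˡ (sum-neg (λ i → f (suc i))))
    (solve 2 (λ a b → :- a :+ :- b := :- (a :+ b)) ≈-refl (f zero) _)

  sum-minus : ∀ {n} (f g : Vector n) → sum (λ i → f i - g i) ≈ sum f - sum g
  sum-minus f g = ≈-trans (∑-distrib-+ f (λ i → - g i)) (+-congˡ (sum-neg g))

  sum-squares : ∀ {n} c (w φ : Vector n) →
    sum (λ j → w j * ((c - φ j) * (c - φ j)))
      ≈ c * c * sum w + dot w (λ j → φ j * φ j) - (c * dot w φ + c * dot w φ)
  sum-squares {zero}  c w φ = ≈-sym (≈-trans
    (solve 2 (λ c z → c :* c :* z :+ z :- (c :* z :+ c :* z) := (c :* c :+ con 1ℚ :- c :- c) :* z) ≈-refl c 0#)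
    (zeroʳ _))
  sum-squares {suc n} c w φ = ≈-trans
    (+-congˡ (sum-squares c (λ j → w (suc j)) (λ j → φ (suc j))))
    (solve 6 (λ c w f W D E → w :* ((c :- f) :* (c :- f)) :+ (c :* c :* W :+ D :- (c :* E :+ c :* E))
       := c :* c :* (w :+ W) :+ (w :* (f :* f) :+ D) :- (c :* (w :* f :+ E) :+ c :* (w :* f :+ E)))
      ≈-refl c (w zero) (φ zero) _ _ _)

  module _ {n} (w : Matrix n) (a : Vector n) (w-sym : Symmetric w) (marginal : ∀ i → sum (w i) ≈ a i) where

    -- The weights a are stationary for the walk: by symmetry the column sums of w are again a.
    total-walk : ∀ φ → sum (λ i → dot (w i) φ) ≈ dot a φ
    total-walk φ = ≈-trans (∑-comm (λ i j → w i j * φ j)) (sum-cong-≋ λ j → begin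
      sum (λ i → w i j * φ j)  ≈⟨ *-distribʳ-sum (φ j) (λ i → w i j) ⟨
      sum (λ i → w i j) * φ j  ≈⟨ *-congʳ (≈-trans (sum-cong-≋ (λ i → w-sym i j)) (marginal j)) ⟩
      a j * φ j                ∎)

    -- The Dirichlet energy of a harmonic function vanishes.
    harmonic⇒flat : (∀ i j → NonNeg (w i j)) → ∀ φ → (∀ i → dot (w i) φ ≈ a i * φ i) →
      ∀ i j → w i j * ((φ i - φ j) * (φ i - φ j)) ≈0
    harmonic⇒flat w-nn φ harmonic i = nn-sum-≈0 (nn i) (nn-sum-≈0 (λ i → nn-sum (nn i)) energy≈0 i)
      where
      nn : ∀ i j → NonNeg (w i j * ((φ i - φ j) * (φ i - φ j)))
      nn i j = nn-* (w-nn i j) (nn-sq (φ i - φ j))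
      φ² : Vector n
      φ² i = φ i * φ i
      local : ∀ i → sum (λ j → w i j * ((φ i - φ j) * (φ i - φ j))) ≈ dot (w i) φ² - a i * φ² i
      local i = begin
        sum (λ j → w i j * ((φ i - φ j) * (φ i - φ j)))
          ≈⟨ sum-squares (φ i) (w i) φ ⟩
        φ i * φ i * sum (w i) + dot (w i) φ² - (φ i * dot (w i) φ + φ i * dot (w i) φ)
          ≈⟨ +-cong (+-congʳ (*-congˡ (marginal i))) (-‿cong (+-cong (*-congˡ (harmonic i)) (*-congˡ (harmonic i)))) ⟩
        φ i * φ i * a i + dot (w i) φ² - (φ i * (a i * φ i) + φ i * (a i * φ i))
          ≈⟨ solve 3 (λ f a d → f :* f :* a :+ d :- (f :* (a :* f) :+ f :* (a :* f)) := d :- a :* (f :* f))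
               ≈-refl (φ i) (a i) (dot (w i) φ²) ⟩
        dot (w i) φ² - a i * φ² i ∎
      energy≈0 : sum (λ i → sum (λ j → w i j * ((φ i - φ j) * (φ i - φ j)))) ≈0
      energy≈0 = begin
        sum (λ i → sum (λ j → w i j * ((φ i - φ j) * (φ i - φ j)))) ≈⟨ sum-cong-≋ local ⟩
        sum (λ i → dot (w i) φ² - a i * φ² i)                       ≈⟨ sum-minus (λ i → dot (w i) φ²) (λ i → a i * φ² i) ⟩
        sum (λ i → dot (w i) φ²) - dot a φ²                         ≈⟨ +-congʳ (total-walk φ²) ⟩
        dot a φ² - dot a φ²                                         ≈⟨ -‿inverseʳ _ ⟩
        0#                                                          ∎

    constant⇒zero : ∀ {M} → Pos M → M ≈ sum a → ∀ φ → dot a φ ≈0 → ∀ c →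
      (∀ i → a i ≈0 ⊎ φ i ≈ c) → c ≈0
    constant⇒zero {M} pM M≈ φ ⊥1 c const = *-cancel-≈0 pM (begin
      M * c                ≈⟨ *-congʳ M≈ ⟩
      sum a * c            ≈⟨ *-distribʳ-sum c a ⟩
      sum (λ i → a i * c)  ≈⟨ sum-cong-≋ (λ i → replace i (const i)) ⟩
      dot a φ              ≈⟨ ⊥1 ⟩
      0#                   ∎)
      where
      replace : ∀ i → a i ≈0 ⊎ φ i ≈ c → a i * c ≈ a i * φ i
      replace i (inj₁ a≈0) = ≈-trans (≈-trans (*-congʳ a≈0) (zeroˡ c)) (≈-sym (≈-trans (*-congʳ a≈0) (zeroˡ (φ i))))
      replace i (inj₂ φ≈c) = *-congˡ (≈-sym φ≈c)

    -- δ is a with its zero entries replaced by positive numbers.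
    module Eigenfunction (δ : Fin n → ℚ) (M iM s μ : Carrier) (M≈ : M ≈ sum a) (M*iM : iM * M ≈ 1#) (s² : s * s ≈ 1#) (pμ : Pos μ)
      (δ-spec : ∀ i → ⌊ δ i ⌋ ≈ a i ⊎ a i ≈0 × (∀ j → w i j ≈0) × Pos ⌊ δ i ⌋)
      (φ : Vector n)
      (eigen : ∀ i → dot (λ j → μ * ⌊ diagonal δ i j ⌋ - s * (w i j - a i * iM * a j)) φ ≈0)
      where

      A : Carrier
      A = dot a φ

      eigen′ : ∀ i → μ * (⌊ δ i ⌋ * φ i) ≈ s * (dot (w i) φ - a i * iM * A)
      eigen′ i = begin
        μ * (⌊ δ i ⌋ * φ i)
          ≈⟨ solve 2 (λ x y → x := (x :- y) :+ y) ≈-refl _ (s * (dot (w i) φ - a i * iM * A)) ⟩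
        μ * (⌊ δ i ⌋ * φ i) - s * (dot (w i) φ - a i * iM * A) + s * (dot (w i) φ - a i * iM * A)
          ≈⟨ +-congʳ (begin
            μ * (⌊ δ i ⌋ * φ i) - s * (dot (w i) φ - a i * iM * A)
              ≈⟨ +-cong (*-congˡ (≈-sym (dot-diagonal δ φ i))) (-‿cong (*-congˡ (begin
                   dot (w i) φ - a i * iM * A        ≈⟨ +-congʳ (*-identityˡ _) ⟨
                   1# * dot (w i) φ - a i * iM * A   ≈⟨ dot-linear 1# (a i * iM) (w i) a φ ⟨
                   dot (λ j → 1# * w i j - a i * iM * a j) φ
                     ≈⟨ sum-cong-≋ (λ j → *-congʳ (+-congʳ (*-identityˡ (w i j)))) ⟩
                   dot (λ j → w i j - a i * iM * a j) φ ∎))) ⟩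
            μ * dot (λ j → ⌊ diagonal δ i j ⌋) φ - s * dot (λ j → w i j - a i * iM * a j) φ
              ≈⟨ dot-linear μ s (λ j → ⌊ diagonal δ i j ⌋) (λ j → w i j - a i * iM * a j) φ ⟨
            dot (λ j → μ * ⌊ diagonal δ i j ⌋ - s * (w i j - a i * iM * a j)) φ
              ≈⟨ eigen i ⟩
            0# ∎) ⟩
        0# + s * (dot (w i) φ - a i * iM * A)
          ≈⟨ +-identityˡ _ ⟩
        s * (dot (w i) φ - a i * iM * A) ∎

      -- At such a vertex the covariance row is zero, so the kernel equation reduces to μ·δᵢ·φᵢ = 0
      -- with both factors positive. Hence the artificial weights create no spurious eigenfunctions.
      isolated⇒zero : ∀ i → a i ≈0 → (∀ j → w i j ≈0) → Pos ⌊ δ i ⌋ → φ i ≈0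
      isolated⇒zero i a≈0 w≈0 pδ = *-cancel-≈0 pδ (*-cancel-≈0 pμ (begin
        μ * (⌊ δ i ⌋ * φ i)
          ≈⟨ eigen′ i ⟩
        s * (dot (w i) φ - a i * iM * A)
          ≈⟨ *-congˡ (+-cong (dot-zeroˡ w≈0 φ) (-‿cong (≈-trans (*-congʳ (≈-trans (*-congʳ a≈0) (zeroˡ iM))) (zeroˡ A)))) ⟩
        s * (0# - 0#)
          ≈⟨ ≈-trans (*-congˡ (-‿inverseʳ 0#)) (zeroʳ s) ⟩
        0# ∎))

      δφ≈aφ : ∀ i → ⌊ δ i ⌋ * φ i ≈ a i * φ i
      δφ≈aφ i = by-cases (δ-spec i)
        where
        by-cases : ⌊ δ i ⌋ ≈ a i ⊎ a i ≈0 × (∀ j → w i j ≈0) × Pos ⌊ δ i ⌋ → ⌊ δ i ⌋ * φ i ≈ a i * φ i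
        by-cases (inj₁ δ≈a)              = *-congʳ δ≈a
        by-cases (inj₂ (a≈0 , w≈0 , pδ)) = ≈-trans (≈-trans (*-congˡ φ≈0) (zeroʳ _)) (≈-sym (≈-trans (*-congˡ φ≈0) (zeroʳ _)))
          where φ≈0 = isolated⇒zero i a≈0 w≈0 pδ

      -- The constants lie in the kernel of the covariance form. Summing the kernel equation over
      -- all vertices therefore leaves μA = s(A - A) = 0.
      orthogonal : A ≈0
      orthogonal = *-cancel-≈0 pμ (begin
        μ * dot a φ
          ≈⟨ *-distribˡ-sum μ (λ i → a i * φ i) ⟩
        sum (λ i → μ * (a i * φ i))
          ≈⟨ sum-cong-≋ (λ i → ≈-trans (*-congˡ (≈-sym (δφ≈aφ i))) (eigen′ i)) ⟩
        sum (λ i → s * (dot (w i) φ - a i * iM * A))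
          ≈⟨ *-distribˡ-sum s (λ i → dot (w i) φ - a i * iM * A) ⟨
        s * sum (λ i → dot (w i) φ - a i * iM * A)
          ≈⟨ *-congˡ (begin
            sum (λ i → dot (w i) φ - a i * iM * A)
              ≈⟨ sum-minus (λ i → dot (w i) φ) (λ i → a i * iM * A) ⟩
            sum (λ i → dot (w i) φ) - sum (λ i → a i * iM * A)
              ≈⟨ +-cong (total-walk φ) (-‿cong (begin
                sum (λ i → a i * iM * A)    ≈⟨ *-distribʳ-sum A (λ i → a i * iM) ⟨
                sum (λ i → a i * iM) * A    ≈⟨ *-congʳ (*-distribʳ-sum iM a) ⟨
                sum a * iM * A              ≈⟨ *-congʳ (≈-trans (*-congʳ (≈-sym M≈)) (≈-trans (*-comm M iM) M*iM)) ⟩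
                1# * A                      ≈⟨ *-identityˡ A ⟩
                A                           ∎)) ⟩
            A - A
              ≈⟨ -‿inverseʳ A ⟩
            0# ∎) ⟩
        s * 0#
          ≈⟨ zeroʳ s ⟩
        0# ∎)

      eigenvalue : ∀ i → dot (w i) φ ≈ (s * μ) * (a i * φ i)
      eigenvalue i = begin
        dot (w i) φ
          ≈⟨ ≈-trans (*-congʳ s²) (*-identityˡ _) ⟨
        s * s * dot (w i) φ
          ≈⟨ solve 2 (λ s d → s :* s :* d := s :* (s :* d)) ≈-refl s (dot (w i) φ) ⟩
        s * (s * dot (w i) φ)
          ≈⟨ *-congˡ (begin
            s * dot (w i) φ                    ≈⟨ *-congˡ (≈-trans (+-congˡ (≈-trans (-‿cong (≈-trans (*-congˡ orthogonal) (zeroʳ _))) -0#≈0#)) (+-identityʳ _)) ⟨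
            s * (dot (w i) φ - a i * iM * A)   ≈⟨ eigen′ i ⟨
            μ * (⌊ δ i ⌋ * φ i)                ≈⟨ *-congˡ (δφ≈aφ i) ⟩
            μ * (a i * φ i)                    ∎) ⟩
        s * (μ * (a i * φ i))
          ≈⟨ *-assoc s μ _ ⟨
        s * μ * (a i * φ i) ∎

ι-sum : ∀ {n} (f : Fin n → ℕ) → ι (sumℕ f) ≡ ℚ-ring.sum (ι ∘ f)
ι-sum {zero}  f = refl
ι-sum {suc n} f = trans (ι-+ (f zero) (sumℕ (λ i → f (suc i)))) (cong (ι (f zero) ℚ.+_) (ι-sum (λ i → f (suc i))))

sum-mono : ∀ {n} {f g : Fin n → ℚ} → (∀ i → f i ℚ.≤ g i) → ℚ-ring.sum f ℚ.≤ ℚ-ring.sum g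
sum-mono {zero}  f≤g = ℚ.≤-refl
sum-mono {suc n} f≤g = ℚ.+-mono-≤ (f≤g zero) (sum-mono (λ i → f≤g (suc i)))

ι-pos : ∀ {k} → k ≢ 0 → 0ℚ ℚ.< ι k
ι-pos {zero}  k≢0 = ⊥-elim (k≢0 refl)
ι-pos {suc k} _   = subst (0ℚ ℚ.<_) (sym (ι≡mkℚ (suc k))) (ℚ.positive⁻¹ (mkℚ (+ suc k) 0 _))

sumℕ-zero⁻ : ∀ {n} (f : Fin n → ℕ) → sumℕ f ≡ 0 → ∀ i → f i ≡ 0
sumℕ-zero⁻ f eq zero    = ℕ.m+n≡0⇒m≡0 (f zero) eq
sumℕ-zero⁻ f eq (suc i) = sumℕ-zero⁻ (λ j → f (suc j)) (ℕ.m+n≡0⇒n≡0 (f zero) eq) i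

-- 1/0 = 0
inv : ℕ → ℚ
inv k = 1 ÷ k

inv-* : ∀ {k} → k ≢ 0 → inv k ℚ.* ι k ≡ 1ℚ
inv-* {zero}  k≢0 = ⊥-elim (k≢0 refl)
inv-* {suc k} _   = trans
  (cong₂ ℚ._*_ (ℚ.↥p/↧p≡p (mkℚ (+ 1) k (Coprime.1-coprimeTo (suc k)))) (ι≡mkℚ (suc k)))
  (ℚ.*-inverseˡ (mkℚ (+ suc k) 0 (Coprime.sym (Coprime.1-coprimeTo (suc k)))))

inv-nonneg : ∀ k → 0ℚ ℚ.≤ inv k
inv-nonneg zero    = ℚ.≤-refl
inv-nonneg (suc k) = subst (0ℚ ℚ.≤_) (sym (ℚ.↥p/↧p≡p (mkℚ (+ 1) k (Coprime.1-coprimeTo (suc k))))) (ℚ.nonNegative⁻¹ (mkℚ (+ 1) k (Coprime.1-coprimeTo (suc k))))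

between-positive : ∀ {t} x → 0ℝ <ℝ x → x <ℝ fromℚ t → 0ℚ ℚ.< t
between-positive {t} x (δ , δ>0 , L , l) (e , e>0 , K , h) = ℚ.<-≤-trans
  (ℚ.+-mono-<-≤ e>0 (ℚ.≤-trans (ℚ.<⇒≤ δ>0)
    (ℚ.≤-trans (ℚ.≤-reflexive (sym (ℚ.+-identityˡ δ))) (l (K ℕ.⊔ L) (ℕ.m≤n⊔m K L)))))
  (ℚ.≤-trans (ℚ.≤-reflexive (ℚ.+-comm e (seq x (K ℕ.⊔ L)))) (h (K ℕ.⊔ L) (ℕ.m≤m⊔n K L)))

module ℚ-harmonic = HarmonicFunctions ℚ-ordered
module ℝ-harmonic = HarmonicFunctions ℝ-ordered

-- Isolated vertices get weight 1, so that the form with these weights is definite.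
δ⁺ : ℕ → ℕ
δ⁺ zero    = 1
δ⁺ (suc k) = suc k

cut : ℕ → ℚ → ℚ
cut zero    x = 0ℚ
cut (suc _) x = x

module WeightedGraph {N} (W : Fin N → Fin N → ℕ) (m : Fin N → ℕ) (M : ℕ)
  (W-sym : ∀ u v → W u v ≡ W v u) (W-marginal : ∀ v → m v ≡ sumℕ (W v)) (M≡ : M ≡ sumℕ m) (M≢0 : M ≢ 0)
  where

  open ℚ-forms using (Vector; Matrix; dot; quad; PSD; Negative)
  open ℚSolver.+-*-Solver

  w : Matrix N
  w u v = ι (W u v)

  a : Vector N
  a v = ι (m v)

  iM : ℚ
  iM = inv M

  δ : Vector N
  δ v = ι (δ⁺ (m v))

  Δ : Matrix N
  Δ = diagonal δ

  -- The sign s = ±1 selects the upper or the lower bound for the covariance. Subtracting a·aᵀ/M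
  -- moves the eigenvalue 1 that the walk has on constants to 0.
  S : ℚ → Matrix N
  S s i j = s ℚ.* (w i j ℚ.- a i ℚ.* iM ℚ.* a j)

  W-isolated : ∀ {v} → m v ≡ 0 → ∀ u → W v u ≡ 0
  W-isolated {v} m≡0 = sumℕ-zero⁻ (W v) (trans (sym (W-marginal v)) m≡0)

  quad-Δ : ∀ x → quad Δ x ≡ dot δ (λ v → x v ℚ.* x v)
  quad-Δ x = ℚ-ring.sum-cong-≋ λ v → trans (cong (x v ℚ.*_) (ℚ-harmonic.dot-diagonal δ x v))
    (solve 2 (λ x d → x :* (d :* x) := d :* (x :* x)) refl (x v) (δ v))

  1≤δ⁺ : ∀ k → 1ℚ ℚ.≤ ι (δ⁺ k)
  1≤δ⁺ zero    = ℚ.≤-refl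
  1≤δ⁺ (suc k) = ι-mono {1} {suc k} (ℕ.s≤s ℕ.z≤n)

  Δ-large : ∀ x → dot x x ℚ.≤ quad Δ x
  Δ-large x = ℚ.≤-trans
    (sum-mono {f = λ v → x v ℚ.* x v} {g = λ v → δ v ℚ.* (x v ℚ.* x v)} λ v → ≤-by (≤⇒0≤ (1≤δ⁺ (m v)) ⊗ 0≤sq (x v))
      (solve 2 (λ d y → d :* y :- y := (d :- con 1ℚ) :* y) refl (δ v) (x v ℚ.* x v)))
    (ℚ.≤-reflexive (sym (quad-Δ x)))

  S-sym : ∀ s → ℚ-forms.Symmetric (S s)
  S-sym s u v = cong₂ (λ p q → s ℚ.* (p ℚ.- q)) (cong ι (W-sym u v))
    (solve 3 (λ a i b → a :* i :* b := b :* i :* a) refl (a u) iM (a v))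

  module P s = Pencil Δ (S s) (diagonal-sym δ) (S-sym s) Δ-large

  bil : Vector N → Vector N → ℚ
  bil φ ψ = dot φ (λ v → dot (w v) ψ)

  cov : Vector N → Vector N → ℚ
  cov φ ψ = bil φ ψ ℚ.- iM ℚ.* (dot a φ ℚ.* dot a ψ)

  quad-S : ∀ s x → quad (S s) x ≡ s ℚ.* cov x x
  quad-S s x = begin
    dot x (λ v → dot (S s v) x)
      ≡⟨ ℚ-ring.sum-cong-≋ (λ v → cong (x v ℚ.*_) (row-S v)) ⟩
    dot x (λ v → s ℚ.* (1ℚ ℚ.* dot (w v) x ℚ.- iM ℚ.* dot a x ℚ.* a v))
      ≡⟨ ℚ-forms.dot-scaleʳ s x (λ v → 1ℚ ℚ.* dot (w v) x ℚ.- iM ℚ.* dot a x ℚ.* a v) ⟩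
    s ℚ.* dot x (λ v → 1ℚ ℚ.* dot (w v) x ℚ.- iM ℚ.* dot a x ℚ.* a v)
      ≡⟨ cong (s ℚ.*_) (trans (ℚ-forms.dot-comm x (λ v → 1ℚ ℚ.* dot (w v) x ℚ.- iM ℚ.* dot a x ℚ.* a v))
           (ℚ-forms.dot-linear 1ℚ (iM ℚ.* dot a x) (λ v → dot (w v) x) a x)) ⟩
    s ℚ.* (1ℚ ℚ.* dot (λ v → dot (w v) x) x ℚ.- iM ℚ.* dot a x ℚ.* dot a x)
      ≡⟨ cong (s ℚ.*_) (cong₂ ℚ._-_ (trans (ℚ.*-identityˡ _) (ℚ-forms.dot-comm (λ v → dot (w v) x) x)) (ℚ.*-assoc iM (dot a x) (dot a x))) ⟩
    s ℚ.* cov x x ∎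
    where
    open ≡-Reasoning
    row-S : ∀ v → dot (S s v) x ≡ s ℚ.* (1ℚ ℚ.* dot (w v) x ℚ.- iM ℚ.* dot a x ℚ.* a v)
    row-S v = begin
      dot (S s v) x
        ≡⟨ ℚ-ring.sum-cong-≋ (λ u → cong (ℚ._* x u) (solve 5 (λ s w a i b → s :* (w :- a :* i :* b) := s :* w :- (s :* a :* i) :* b)
             refl s (w v u) (a v) iM (a u))) ⟩
      dot (λ u → s ℚ.* w v u ℚ.- (s ℚ.* a v ℚ.* iM) ℚ.* a u) x
        ≡⟨ ℚ-forms.dot-linear s (s ℚ.* a v ℚ.* iM) (w v) a x ⟩
      s ℚ.* dot (w v) x ℚ.- s ℚ.* a v ℚ.* iM ℚ.* dot a x
        ≡⟨ solve 5 (λ s w a i b → s :* w :- s :* a :* i :* b := s :* (con 1ℚ :* w :- i :* b :* a)) refl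
             s (dot (w v) x) (a v) iM (dot a x) ⟩
      s ℚ.* (1ℚ ℚ.* dot (w v) x ℚ.- iM ℚ.* dot a x ℚ.* a v) ∎

  module Spectral (lam : ℝ) (0<lam : 0ℝ <ℝ lam)
    (connected : ∀ u v → m u ≢ 0 → m v ≢ 0 → Star (λ u v → W u v ≢ 0) u v)
    (spectrum : ∀ μ φ → ¬ (∀ v → m v ≢ 0 → φ v ≈ℝ 0ℝ) →
      (∀ v → m v ≢ 0 → ℝ-forms.dot (λ u → fromℚ (w v u)) φ ≈ℝ μ ⊠ (fromℚ (a v) ⊠ φ v)) →
      ((-ℝ lam) ≤ℝ μ × μ ≤ℝ lam) ⊎ μ ≃ 1ℝ)
    where

    open ℝ-ring using (≈-refl; ≈-sym; ≈-trans)

    wℝ : ℝ-forms.Matrix N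
    wℝ u v = fromℚ (w u v)

    aℝ : ℝ-forms.Vector N
    aℝ v = fromℚ (a v)

    wℝ-sym : ℝ-forms.Symmetric wℝ
    wℝ-sym u v = pointwise λ _ → cong ι (W-sym u v)

    wℝ-marginal : ∀ v → ℝ-ring.sum (wℝ v) ≈ℝ aℝ v
    wℝ-marginal v = pointwise λ k → trans (seq-sum (wℝ v) k) (trans (sym (ι-sum (W v))) (cong ι (sym (W-marginal v))))

    M≈ : fromℚ (ι M) ≈ℝ ℝ-ring.sum aℝ
    M≈ = pointwise λ k → trans (cong ι M≡) (trans (ι-sum m) (sym (seq-sum aℝ k)))

    fromℚ-pos : ∀ {p} → 0ℚ ℚ.< p → Posℝ (fromℚ p)
    fromℚ-pos {p} p>0 = p , p>0 , 0 , λ _ _ → ℚ.≤-refl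

    δ-spec : ∀ v → fromℚ (δ v) ≈ℝ aℝ v ⊎ aℝ v ≈ℝ 0ℝ × (∀ u → wℝ v u ≈ℝ 0ℝ) × Posℝ (fromℚ (δ v))
    δ-spec v = by-cases (m v) refl
      where
      by-cases : ∀ k → m v ≡ k → fromℚ (δ v) ≈ℝ aℝ v ⊎ aℝ v ≈ℝ 0ℝ × (∀ u → wℝ v u ≈ℝ 0ℝ) × Posℝ (fromℚ (δ v))
      by-cases zero eq = inj₂ ( (pointwise λ _ → cong ι eq)
                              , (λ u → pointwise λ _ → cong ι (W-isolated eq u))
                              , fromℚ-pos (subst (λ k → 0ℚ ℚ.< ι (δ⁺ k)) (sym eq) (ι-pos {1} (λ ()))))
      by-cases (suc k) eq = inj₁ (pointwise λ _ → trans (cong (ι ∘ δ⁺) eq) (cong ι (sym eq)))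

    module _ (s : ℚ) (s² : s ℚ.* s ≡ 1ℚ) (μ : ℝ) (pμ : Posℝ μ) (ker : ℝ-forms.Kernel (P.pencilℝ s μ)) where

      private
        entry : ∀ v u → μ ⊠ fromℚ (Δ v u) ⊞ ⊟ (fromℚ s ⊠ (wℝ v u ⊞ ⊟ (aℝ v ⊠ fromℚ iM ⊠ aℝ u))) ≈ℝ P.pencilℝ s μ v u
        entry v u = ℝ-ring.+-congˡ {μ ⊠ fromℚ (Δ v u)} (ℝ-ring.-‿cong (≈-sym (≈-trans (fromℚ-* s _)
          (ℝ-ring.*-congˡ {fromℚ s} (≈-trans (fromℚ-+ (w v u) _) (ℝ-ring.+-congˡ {wℝ v u} (≈-trans (fromℚ-neg _)
            (ℝ-ring.-‿cong (≈-trans (fromℚ-* _ _) (ℝ-ring.*-congʳ {aℝ u} (fromℚ-* _ _)))))))))))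
        φ : ℝ-forms.Vector N
        φ = proj₁ ker
        module E = ℝ-harmonic.Eigenfunction wℝ aℝ wℝ-sym wℝ-marginal δ (fromℚ (ι M)) (fromℚ iM) (fromℚ s) μ
          M≈ (≈-trans (≈-sym (fromℚ-* iM (ι M))) (pointwise λ _ → inv-* M≢0)) (≈-trans (≈-sym (fromℚ-* s s)) (pointwise λ _ → s²)) pμ δ-spec φ
          (λ v → ≈-trans
            (ℝ-ring.sum-cong-≋ (λ u → ℝ-ring.*-congʳ {φ u} (entry v u)))
            (proj₂ (proj₂ ker) v))

      nonzero : ¬ (∀ v → m v ≢ 0 → φ v ≈ℝ 0ℝ)
      nonzero zero-on-support = proj₁ (proj₂ ker) λ v → by-cases v (m v ℕ.≟ 0)
        where
        by-cases : ∀ v → Dec (m v ≡ 0) → φ v ≈ℝ 0ℝ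
        by-cases v (no  m≢0) = zero-on-support v m≢0
        by-cases v (yes m≡0) = E.isolated⇒zero v (pointwise λ _ → cong ι m≡0)
          (λ u → pointwise λ _ → cong ι (W-isolated m≡0 u))
          (fromℚ-pos (subst (λ k → 0ℚ ℚ.< ι (δ⁺ k)) (sym m≡0) (ι-pos {1} (λ ()))))

      in-spectrum : ((-ℝ lam) ≤ℝ fromℚ s ⊠ μ × fromℚ s ⊠ μ ≤ℝ lam) ⊎ fromℚ s ⊠ μ ≃ 1ℝ
      in-spectrum = spectrum (fromℚ s ⊠ μ) φ nonzero λ v _ → E.eigenvalue v

      -- For eigenvalue 1 the function is harmonic, so its Dirichlet energy vanishes and it agrees
      -- along edges, hence along paths in the support. A constant orthogonal to the constants is
      -- zero, against `nonzero`.
      ¬eigenvalue-1 : ¬ (fromℚ s ⊠ μ ≃ 1ℝ)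
      ¬eigenvalue-1 sμ≃1 = nonzero zero-at
        where
        harmonic : ∀ v → ℝ-forms.dot (wℝ v) φ ≈ℝ aℝ v ⊠ φ v
        harmonic v = ≈-trans (E.eigenvalue v) (≈-trans (ℝ-ring.*-congʳ {aℝ v ⊠ φ v} (≃⇒≈ℝ sμ≃1)) (ℝ-ring.*-identityˡ (aℝ v ⊠ φ v)))
        flat : ∀ u v → wℝ u v ⊠ ((φ u ⊞ ⊟ φ v) ⊠ (φ u ⊞ ⊟ φ v)) ≈ℝ 0ℝ
        flat = ℝ-harmonic.harmonic⇒flat wℝ aℝ wℝ-sym wℝ-marginal
          (λ u v → λ (e , e>0 , K , h) → ℚ.<-irrefl refl (ℚ.<-≤-trans e>0 (ℚ.≤-trans (ℚ.≤-trans (h K ℕ.≤-refl) (ℚ.≤-reflexive (seq-⊟ (wℝ u v) K))) (ℚ.neg-antimono-≤ (ι-nonneg (W u v))))))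
          φ harmonic
        edge : ∀ {u v} → W u v ≢ 0 → φ u ≈ℝ φ v
        edge {u} {v} W≢0 = ≈-trans
          (≈-trans (≈-sym (ℝ-ring.+-identityʳ (φ u))) (≈-trans
            (ℝ-ring.+-congˡ (≈-sym (ℝ-ring.-‿inverseˡ (φ v)))) (≈-sym (ℝ-ring.+-assoc (φ u) (⊟ φ v) (φ v)))))
          (≈-trans (ℝ-ring.+-congʳ (ℝ-ring.sq-≈0 {φ u ⊞ ⊟ φ v} (ℝ-ring.*-cancel-≈0 {wℝ u v} (fromℚ-pos (ι-pos W≢0)) (flat u v))))
            (ℝ-ring.+-identityˡ (φ v)))
        path : ∀ {u v} → Star (λ u v → W u v ≢ 0) u v → φ u ≈ℝ φ v
        path ε⋆       = ≈-refl
        path (e ◅ es) = ≈-trans (edge e) (path es)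
        zero-at : ∀ v → m v ≢ 0 → φ v ≈ℝ 0ℝ
        zero-at v m≢0 = ℝ-harmonic.constant⇒zero wℝ aℝ wℝ-sym wℝ-marginal (fromℚ-pos (ι-pos M≢0)) M≈ φ E.orthogonal (φ v)
          λ u → by-cases u (m u ℕ.≟ 0)
          where
          by-cases : ∀ u → Dec (m u ≡ 0) → aℝ u ≈ℝ 0ℝ ⊎ φ u ≈ℝ φ v
          by-cases u (yes m≡0)  = inj₁ (pointwise λ _ → cong ι m≡0)
          by-cases u (no  m≢0′) = inj₂ (path (connected u v m≢0′ m≢0))

    0<t : ∀ {t} → lam <ℝ fromℚ t → 0ℚ ℚ.< t
    0<t = between-positive lam 0<lam

    Above : ℚ → ℝ → Set
    Above t μ = ∀ k → t ℚ.≤ seq μ k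

    ¬≤lam : ∀ {t} → lam <ℝ fromℚ t → ∀ {μ ν} → Above t μ → (∀ k → seq ν k ≡ seq μ k) → ¬ (ν ≤ℝ lam)
    ¬≤lam {t} (e , e>0 , lam+e≤t) {μ} t≤μ eq ν≤lam = contradiction (eventually-witness (eventually-map₂ (λ _ → _,_) lam+e≤t (ν≤lam (½ ℚ.* e) (halve e>0))))
      where
      contradiction : ∃[ k ] seq lam k ℚ.+ e ℚ.≤ t × _ → ⊥
      contradiction (k , h₁ , h₂) = ℚ.<-irrefl refl (ℚ.<-≤-trans (halve e>0) (≤-by
        (≤⇒0≤ h₁ ⊕ ≤⇒0≤ (t≤μ k) ⊕ ≤⇒0≤ (subst (ℚ._≤ _) (eq k) h₂))
        (solve 4 (λ e l t m → con 0ℚ :- con ½ :* e := (t :- (l :+ e)) :+ (m :- t) :+ (l :+ con ½ :* e :- m)) refl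
          e (seq lam k) t (seq μ k))))

    psd-one : ∀ {t} → lam <ℝ fromℚ t → PSD (P.pencil 1ℚ t)
    psd-one {t} lam<t = from-dec (P.psd? 1ℚ t)
      where
      refute : ¬ (∃[ μ ] Above t μ × ℝ-forms.Kernel (P.pencilℝ 1ℚ μ))
      refute (μ , t≤μ , ker) = by-cases (in-spectrum 1ℚ refl μ pμ ker)
        where
        pμ : Posℝ μ
        pμ = t , 0<t lam<t , 0 , λ k _ → t≤μ k
        by-cases : ((-ℝ lam) ≤ℝ fromℚ 1ℚ ⊠ μ × fromℚ 1ℚ ⊠ μ ≤ℝ lam) ⊎ fromℚ 1ℚ ⊠ μ ≃ 1ℝ → ⊥
        by-cases (inj₁ (_ , ≤lam)) = ¬≤lam lam<t {μ} {fromℚ 1ℚ ⊠ μ} t≤μ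
          (λ k → trans (seq-⊠ (fromℚ 1ℚ) μ k) (ℚ.*-identityˡ (seq μ k))) ≤lam
        by-cases (inj₂ ≃1) = ¬eigenvalue-1 1ℚ refl μ pμ ker ≃1
      from-dec : Negative (P.pencil 1ℚ t) ⊎ PSD (P.pencil 1ℚ t) → PSD (P.pencil 1ℚ t)
      from-dec (inj₁ neg) = ⊥-elim (P.top-eigenvalue 1ℚ neg refute)
      from-dec (inj₂ psd) = psd

    -1ℚ : ℚ
    -1ℚ = ℚ.- 1ℚ

    psd-minus-one : ∀ {t} → lam <ℝ fromℚ t → PSD (P.pencil -1ℚ t)
    psd-minus-one {t} lam<t = from-dec (P.psd? -1ℚ t)
      where
      refute : ¬ (∃[ μ ] Above t μ × ℝ-forms.Kernel (P.pencilℝ -1ℚ μ))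
      refute (μ , t≤μ , ker) = by-cases (in-spectrum -1ℚ refl μ (t , 0<t lam<t , 0 , λ k _ → t≤μ k) ker)
        where
        seq-neg : ∀ k → seq (fromℚ -1ℚ ⊠ μ) k ≡ ℚ.- seq μ k
        seq-neg k = trans (seq-⊠ (fromℚ -1ℚ) μ k) (solve 1 (λ m → con -1ℚ :* m := :- m) refl (seq μ k))
        by-cases : ((-ℝ lam) ≤ℝ fromℚ -1ℚ ⊠ μ × fromℚ -1ℚ ⊠ μ ≤ℝ lam) ⊎ fromℚ -1ℚ ⊠ μ ≃ 1ℝ → ⊥
        by-cases (inj₁ (-lam≤ , _)) = ¬≤lam lam<t {μ} {ν = -ℝ (fromℚ -1ℚ ⊠ μ)} t≤μ
          (λ k → trans (cong ℚ.-_ (seq-neg k)) (solve 1 (λ m → :- :- m := m) refl (seq μ k)))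
          (λ e e>0 → eventually-map (λ k h → ≤-by (≤⇒0≤ h)
            (solve 3 (λ l e m → l :+ e :- :- m := m :+ e :- :- l) refl (seq lam k) e (seq (fromℚ -1ℚ ⊠ μ) k))) (-lam≤ e e>0))
        -- For s = -1 the exceptional eigenvalue is excluded by its sign, without connectedness: sμ
        -- = -μ is negative because μ ≥ t > 0.
        by-cases (inj₂ (_ , 1≤)) = contradiction (eventually-witness (1≤ ½ (ℚ.positive⁻¹ ½)))
          where
          contradiction : ∃[ k ] 1ℚ ℚ.≤ seq (fromℚ -1ℚ ⊠ μ) k ℚ.+ ½ → ⊥
          contradiction (k , h) = ℚ.<-irrefl refl (ℚ.<-≤-trans (0<t lam<t) (ℚ.≤-trans (t≤μ k) (≤-by
            (≤⇒0≤ (subst (λ z → 1ℚ ℚ.≤ z ℚ.+ ½) (seq-neg k) h) ⊕ ℚ.nonNegative⁻¹ ½)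
            (solve 1 (λ m → con 0ℚ :- m := (:- m :+ con ½ :- con 1ℚ) :+ con ½) refl (seq μ k)))))
      from-dec : Negative (P.pencil -1ℚ t) ⊎ PSD (P.pencil -1ℚ t) → PSD (P.pencil -1ℚ t)
      from-dec (inj₁ neg) = ⊥-elim (P.top-eigenvalue -1ℚ neg refute)
      from-dec (inj₂ psd) = psd

    module _ (t : ℚ) (lam<t : lam <ℝ fromℚ t) where

      norm² : Vector N → ℚ
      norm² x = dot a (λ v → x v ℚ.* x v)

      private
        -- Semidefiniteness is known for the form with the artificial weights δ. Setting x to zero
        -- at isolated vertices removes their contribution from the norm and leaves the covariance
        -- unchanged, since w and a vanish there.
        restrict : Vector N → Vector N
        restrict x v = cut (m v) (x v)

        cut-weight : ∀ k x → ι (δ⁺ k) ℚ.* (cut k x ℚ.* cut k x) ≡ ι k ℚ.* (x ℚ.* x)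
        cut-weight zero    x = sym (ℚ.*-zeroˡ (x ℚ.* x))
        cut-weight (suc k) x = refl

        cut-absorb : ∀ k c x → (k ≡ 0 → c ≡ 0ℚ) → c ℚ.* cut k x ≡ c ℚ.* x
        cut-absorb zero    c x c≡0 = trans (ℚ.*-zeroʳ c) (sym (trans (cong (ℚ._* x) (c≡0 refl)) (ℚ.*-zeroˡ x)))
        cut-absorb (suc k) c x _   = refl

        row-restrict : ∀ v x → dot (w v) (restrict x) ≡ dot (w v) x
        row-restrict v x = ℚ-ring.sum-cong-≋ λ u → cut-absorb (m u) (w v u) (x u)
          (λ m≡0 → cong ι (trans (W-sym v u) (W-isolated m≡0 v)))

        cov-restrict : ∀ x → cov (restrict x) (restrict x) ≡ cov x x
        cov-restrict x = cong₂ (λ q b → q ℚ.- iM ℚ.* (b ℚ.* b))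
          (ℚ-ring.sum-cong-≋ λ v → trans (cong (cut (m v) (x v) ℚ.*_) (row-restrict v x))
            (trans (ℚ.*-comm (cut (m v) (x v)) (dot (w v) x))
              (trans (cut-absorb (m v) (dot (w v) x) (x v)
                       (λ m≡0 → ℚ-forms.dot-zeroˡ {f = w v} (λ u → cong ι (W-isolated m≡0 u)) x))
                (ℚ.*-comm (dot (w v) x) (x v)))))
          (ℚ-ring.sum-cong-≋ λ v → cut-absorb (m v) (a v) (x v) (cong ι))

        quad-Δ-restrict : ∀ x → quad Δ (restrict x) ≡ norm² x
        quad-Δ-restrict x = trans (quad-Δ (restrict x)) (ℚ-ring.sum-cong-≋ λ v → cut-weight (m v) (x v))

        form-bound : ∀ s → PSD (P.pencil s t) → ∀ x → s ℚ.* cov x x ℚ.≤ t ℚ.* norm² x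
        form-bound s psd x = 0≤⇒≤ (ℚ.≤-trans (nn⇒0≤ (psd (restrict x))) (ℚ.≤-reflexive (trans
          (P.quad-pencil s t (restrict x))
          (cong₂ (λ n c → t ℚ.* n ℚ.- c) (quad-Δ-restrict x)
            (trans (quad-S s (restrict x)) (cong (s ℚ.*_) (cov-restrict x)))))))

      cov-self-≤ : ∀ x → cov x x ℚ.≤ t ℚ.* norm² x
      cov-self-≤ x = ℚ.≤-trans (ℚ.≤-reflexive (sym (ℚ.*-identityˡ (cov x x)))) (form-bound 1ℚ (psd-one lam<t) x)

      -cov-self-≤ : ∀ x → ℚ.- cov x x ℚ.≤ t ℚ.* norm² x
      -cov-self-≤ x = ℚ.≤-trans
        (ℚ.≤-reflexive (solve 1 (λ c → :- c := con -1ℚ :* c) refl (cov x x)))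
        (form-bound -1ℚ (psd-minus-one lam<t) x)

      dot-combine : ∀ (f φ ψ : Vector N) α β →
        dot f (λ v → α ℚ.* φ v ℚ.+ β ℚ.* ψ v) ≡ α ℚ.* dot f φ ℚ.+ β ℚ.* dot f ψ
      dot-combine f φ ψ α β = trans (ℚ-ring.sum-cong-≋ λ v → ℚ.*-distribˡ-+ (f v) (α ℚ.* φ v) (β ℚ.* ψ v))
        (trans (ℚ-ring.∑-distrib-+ (λ v → f v ℚ.* (α ℚ.* φ v)) (λ v → f v ℚ.* (β ℚ.* ψ v)))
          (cong₂ ℚ._+_ (ℚ-forms.dot-scaleʳ α f φ) (ℚ-forms.dot-scaleʳ β f ψ)))

      bil-sym : ∀ φ ψ → bil φ ψ ≡ bil ψ φ
      bil-sym φ ψ = begin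
        ℚ-ring.sum (λ v → φ v ℚ.* dot (w v) ψ)
          ≡⟨ ℚ-ring.sum-cong-≋ (λ v → ℚ-ring.*-distribˡ-sum (φ v) (λ u → w v u ℚ.* ψ u)) ⟩
        ℚ-ring.sum (λ v → ℚ-ring.sum (λ u → φ v ℚ.* (w v u ℚ.* ψ u)))
          ≡⟨ ℚ-ring.∑-comm (λ v u → φ v ℚ.* (w v u ℚ.* ψ u)) ⟩
        ℚ-ring.sum (λ u → ℚ-ring.sum (λ v → φ v ℚ.* (w v u ℚ.* ψ u)))
          ≡⟨ ℚ-ring.sum-cong-≋ (λ u → trans
               (ℚ-ring.sum-cong-≋ (λ v → trans (solve 3 (λ f w p → f :* (w :* p) := p :* (w :* f)) refl (φ v) (w v u) (ψ u))
                 (cong (λ z → ψ u ℚ.* (z ℚ.* φ v)) (cong ι (W-sym v u)))))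
               (sym (ℚ-ring.*-distribˡ-sum (ψ u) (λ v → w u v ℚ.* φ v)))) ⟩
        ℚ-ring.sum (λ u → ψ u ℚ.* dot (w u) φ) ∎
        where open ≡-Reasoning

      bil-combineˡ : ∀ (φ ψ χ : Vector N) α β →
        bil (λ v → α ℚ.* φ v ℚ.+ β ℚ.* ψ v) χ ≡ α ℚ.* bil φ χ ℚ.+ β ℚ.* bil ψ χ
      bil-combineˡ φ ψ χ α β = trans (ℚ-forms.dot-comm (λ v → α ℚ.* φ v ℚ.+ β ℚ.* ψ v) (λ v → dot (w v) χ))
        (trans (dot-combine (λ v → dot (w v) χ) φ ψ α β)
          (cong₂ (λ p q → α ℚ.* p ℚ.+ β ℚ.* q) (ℚ-forms.dot-comm (λ v → dot (w v) χ) φ) (ℚ-forms.dot-comm (λ v → dot (w v) χ) ψ)))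

      cov-combine : ∀ φ ψ α β → let x = λ v → α ℚ.* φ v ℚ.+ β ℚ.* ψ v in
        cov x x ≡ α ℚ.* α ℚ.* cov φ φ ℚ.+ (α ℚ.* β ℚ.+ α ℚ.* β) ℚ.* cov φ ψ ℚ.+ β ℚ.* β ℚ.* cov ψ ψ
      cov-combine φ ψ α β = trans
        (cong₂ (λ q b → q ℚ.- iM ℚ.* (b ℚ.* b))
          (trans (bil-combineˡ φ ψ x α β) (cong₂ (λ p q → α ℚ.* p ℚ.+ β ℚ.* q) (side φ)
            (trans (side ψ) (cong (λ z → α ℚ.* z ℚ.+ β ℚ.* bil ψ ψ) (bil-sym ψ φ)))))
          (dot-combine a φ ψ α β))
        (solve 8 (λ α β i p q ff fg gg →
            α :* (α :* ff :+ β :* fg) :+ β :* (α :* fg :+ β :* gg) :- i :* ((α :* p :+ β :* q) :* (α :* p :+ β :* q))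
          := α :* α :* (ff :- i :* (p :* p)) :+ (α :* β :+ α :* β) :* (fg :- i :* (p :* q)) :+ β :* β :* (gg :- i :* (q :* q)))
          refl α β iM (dot a φ) (dot a ψ) (bil φ φ) (bil φ ψ) (bil ψ ψ))
        where
        x : Vector N
        x v = α ℚ.* φ v ℚ.+ β ℚ.* ψ v
        side : ∀ χ → bil χ x ≡ α ℚ.* bil χ φ ℚ.+ β ℚ.* bil χ ψ
        side χ = trans (bil-sym χ x) (trans (bil-combineˡ φ ψ χ α β)
          (cong₂ (λ p q → α ℚ.* p ℚ.+ β ℚ.* q) (bil-sym φ χ) (bil-sym ψ χ)))

      norm²-combine : ∀ φ ψ α β → norm² (λ v → α ℚ.* φ v ℚ.+ β ℚ.* ψ v)
        ≡ α ℚ.* α ℚ.* norm² φ ℚ.+ (α ℚ.* β ℚ.+ α ℚ.* β) ℚ.* dot a (λ v → φ v ℚ.* ψ v) ℚ.+ β ℚ.* β ℚ.* norm² ψ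
      norm²-combine φ ψ α β = trans
        (ℚ-ring.sum-cong-≋ λ v → solve 5 (λ a b d f g → d :* ((a :* f :+ b :* g) :* (a :* f :+ b :* g))
           := d :* (con 1ℚ :* (a :* a :* (f :* f) :+ (a :* b :+ a :* b) :* (f :* g)) :+ b :* b :* (g :* g))) refl α β (a v) (φ v) (ψ v))
        (trans (dot-combine a (λ v → α ℚ.* α ℚ.* (φ v ℚ.* φ v) ℚ.+ (α ℚ.* β ℚ.+ α ℚ.* β) ℚ.* (φ v ℚ.* ψ v)) (λ v → ψ v ℚ.* ψ v) 1ℚ (β ℚ.* β))
          (cong (ℚ._+ β ℚ.* β ℚ.* norm² ψ) (trans (ℚ.*-identityˡ _)
            (dot-combine a (λ v → φ v ℚ.* φ v) (λ v → φ v ℚ.* ψ v) (α ℚ.* α) (α ℚ.* β ℚ.+ α ℚ.* β)))))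

      private
        -- 4p·cov φ ψ is the difference of the covariances at pφ + ψ and pφ - ψ, while by the
        -- parallelogram law their norms add up to 2(p²P + Q). Bounding the two terms with opposite
        -- signs gives a bilinear estimate without normalising φ and ψ, which would need square
        -- roots.
        module Polarise (φ ψ : Vector N) (p : ℚ) where

          P Q G : ℚ
          P = norm² φ
          Q = norm² ψ
          G = cov φ ψ

          x : ℚ → Vector N
          x γ v = p ℚ.* φ v ℚ.+ γ ℚ.* ψ v

          upper : 0ℚ ℚ.≤ ½ ℚ.* t ℚ.* (p ℚ.* p ℚ.* P ℚ.+ Q) ℚ.- p ℚ.* G
          upper = subst (0ℚ ℚ.≤_)
            (trans (cong₂ (λ p q → ½ ℚ.* (½ ℚ.* (p ℚ.+ q)))
                (cong₂ (λ n c → t ℚ.* n ℚ.- c) (norm²-combine φ ψ p 1ℚ) (cov-combine φ ψ p 1ℚ))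
                (cong₂ (λ n c → t ℚ.* n ℚ.- ℚ.- c) (norm²-combine φ ψ p -1ℚ) (cov-combine φ ψ p -1ℚ)))
              (solve 8 (λ α t P Q X F G H → let e = con 1ℚ; o = con -1ℚ in
                  con ½ :* (con ½ :* (t :* (α :* α :* P :+ (α :* e :+ α :* e) :* X :+ e :* e :* Q) :- (α :* α :* F :+ (α :* e :+ α :* e) :* G :+ e :* e :* H)
                    :+ (t :* (α :* α :* P :+ (α :* o :+ α :* o) :* X :+ o :* o :* Q) :- :- (α :* α :* F :+ (α :* o :+ α :* o) :* G :+ o :* o :* H))))
                := con ½ :* t :* (α :* α :* P :+ Q) :- α :* G)
                refl p t P Q (dot a (λ v → φ v ℚ.* ψ v)) (cov φ φ) G (cov ψ ψ)))
            (ℚ.nonNegative⁻¹ ½ ⊗ (ℚ.nonNegative⁻¹ ½ ⊗ (≤⇒0≤ (cov-self-≤ (x 1ℚ)) ⊕ ≤⇒0≤ (-cov-self-≤ (x -1ℚ)))))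

          lower : 0ℚ ℚ.≤ ½ ℚ.* t ℚ.* (p ℚ.* p ℚ.* P ℚ.+ Q) ℚ.- p ℚ.* ℚ.- G
          lower = subst (0ℚ ℚ.≤_)
            (trans (cong₂ (λ p q → ½ ℚ.* (½ ℚ.* (p ℚ.+ q)))
                (cong₂ (λ n c → t ℚ.* n ℚ.- ℚ.- c) (norm²-combine φ ψ p 1ℚ) (cov-combine φ ψ p 1ℚ))
                (cong₂ (λ n c → t ℚ.* n ℚ.- c) (norm²-combine φ ψ p -1ℚ) (cov-combine φ ψ p -1ℚ)))
              (solve 8 (λ α t P Q X F G H → let e = con 1ℚ; o = con -1ℚ in
                  con ½ :* (con ½ :* (t :* (α :* α :* P :+ (α :* e :+ α :* e) :* X :+ e :* e :* Q) :- :- (α :* α :* F :+ (α :* e :+ α :* e) :* G :+ e :* e :* H)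
                    :+ (t :* (α :* α :* P :+ (α :* o :+ α :* o) :* X :+ o :* o :* Q) :- (α :* α :* F :+ (α :* o :+ α :* o) :* G :+ o :* o :* H))))
                := con ½ :* t :* (α :* α :* P :+ Q) :- α :* :- G)
                refl p t P Q (dot a (λ v → φ v ℚ.* ψ v)) (cov φ φ) G (cov ψ ψ)))
            (ℚ.nonNegative⁻¹ ½ ⊗ (ℚ.nonNegative⁻¹ ½ ⊗ (≤⇒0≤ (-cov-self-≤ (x 1ℚ)) ⊕ ≤⇒0≤ (cov-self-≤ (x -1ℚ)))))

      -- Polarisation along pφ ± ψ, rescaled by q = 1/p.
      covariance-bound : ∀ {p q} → 0ℚ ℚ.≤ q → q ℚ.* p ≡ 1ℚ → ∀ φ ψ →
        ℚ.∣ cov φ ψ ∣ ℚ.≤ ½ ℚ.* t ℚ.* (p ℚ.* norm² φ ℚ.+ q ℚ.* norm² ψ)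
      covariance-bound {p} {q} 0≤q qp≡1 φ ψ = ∣∣≤ (rescale G upper) (rescale (ℚ.- G) lower)
        where
        open Polarise φ ψ p
        rescale : ∀ g → 0ℚ ℚ.≤ ½ ℚ.* t ℚ.* (p ℚ.* p ℚ.* P ℚ.+ Q) ℚ.- p ℚ.* g →
          g ℚ.≤ ½ ℚ.* t ℚ.* (p ℚ.* P ℚ.+ q ℚ.* Q)
        rescale g h = ≤-by (0≤q ⊗ h) (begin
          ½ ℚ.* t ℚ.* (p ℚ.* P ℚ.+ q ℚ.* Q) ℚ.- g
            ≡⟨ solve 6 (λ t p P q Q g → con ½ :* t :* (p :* P :+ q :* Q) :- g
                 := con ½ :* t :* (con 1ℚ :* (p :* P) :+ q :* Q) :- con 1ℚ :* g) refl t p P q Q g ⟩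
          ½ ℚ.* t ℚ.* (1ℚ ℚ.* (p ℚ.* P) ℚ.+ q ℚ.* Q) ℚ.- 1ℚ ℚ.* g
            ≡⟨ cong (λ e → ½ ℚ.* t ℚ.* (e ℚ.* (p ℚ.* P) ℚ.+ q ℚ.* Q) ℚ.- e ℚ.* g) (sym qp≡1) ⟩
          ½ ℚ.* t ℚ.* (q ℚ.* p ℚ.* (p ℚ.* P) ℚ.+ q ℚ.* Q) ℚ.- q ℚ.* p ℚ.* g
            ≡⟨ solve 6 (λ t p P q Q g → con ½ :* t :* (q :* p :* (p :* P) :+ q :* Q) :- q :* p :* g
                 := q :* (con ½ :* t :* (p :* p :* P :+ Q) :- p :* g)) refl t p P q Q g ⟩
          q ℚ.* (½ ℚ.* t ℚ.* (p ℚ.* p ℚ.* P ℚ.+ Q) ℚ.- p ℚ.* g) ∎)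
          where open ≡-Reasoning

-- Mixing along ordered simplices

∣sum∣≤ : ∀ {n} (f : Fin n → ℚ) → ℚ.∣ ℚ-ring.sum f ∣ ℚ.≤ ℚ-ring.sum (λ i → ℚ.∣ f i ∣)
∣sum∣≤ {zero}  f = ℚ.≤-refl
∣sum∣≤ {suc n} f = ℚ.≤-trans (ℚ.∣p+q∣≤∣p∣+∣q∣ (f zero) _) (ℚ.+-monoʳ-≤ ℚ.∣ f zero ∣ (∣sum∣≤ (λ i → f (suc i))))

sum-nonneg : ∀ {n} {f : Fin n → ℚ} → (∀ i → 0ℚ ℚ.≤ f i) → 0ℚ ℚ.≤ ℚ-ring.sum f
sum-nonneg 0≤f = nn⇒0≤ (ℚ-ring.nn-sum (λ i → 0≤⇒nn (0≤f i)))

∣-∣-chain : ∀ x y z {a b} → ℚ.∣ x ℚ.- y ∣ ℚ.≤ a → ℚ.∣ y ℚ.- z ∣ ℚ.≤ b → ℚ.∣ x ℚ.- z ∣ ℚ.≤ a ℚ.+ b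
∣-∣-chain x y z {a} {b} h₁ h₂ = begin
  ℚ.∣ x ℚ.- z ∣                             ≡⟨ cong ℚ.∣_∣ (solve 3 (λ x y z → x :- z := (x :- y) :+ (y :- z)) refl x y z) ⟩
  ℚ.∣ (x ℚ.- y) ℚ.+ (y ℚ.- z) ∣             ≤⟨ ℚ.∣p+q∣≤∣p∣+∣q∣ (x ℚ.- y) (y ℚ.- z) ⟩
  ℚ.∣ x ℚ.- y ∣ ℚ.+ ℚ.∣ y ℚ.- z ∣           ≤⟨ ℚ.+-mono-≤ h₁ h₂ ⟩
  a ℚ.+ b                                   ∎
  where
  open ℚ.≤-Reasoning
  open ℚSolver.+-*-Solver

inv-≤1 : ∀ k {x} → x ℚ.≤ ι k → inv k ℚ.* x ℚ.≤ 1ℚ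
inv-≤1 k {x} x≤k = by-cases (k ℕ.≟ 0)
  where
  by-cases : Dec (k ≡ 0) → inv k ℚ.* x ℚ.≤ 1ℚ
  by-cases (yes refl) = ℚ.≤-trans (ℚ.≤-reflexive (ℚ.*-zeroˡ x)) (ℚ.nonNegative⁻¹ 1ℚ)
  by-cases (no  k≢0)  = ℚ.≤-trans (ℚ.*-monoˡ-≤-nonNeg (inv k) {{ℚ.nonNegative (inv-nonneg k)}} x≤k) (ℚ.≤-reflexive (inv-* k≢0))

Indicator : ∀ {N} → (Fin N → ℚ) → Set
Indicator f = ∀ v → f v ≡ 0ℚ ⊎ f v ≡ 1ℚ

module _ {N} {f : Fin N → ℚ} (ind : Indicator f) where

  indicator-≥0 : ∀ v → 0ℚ ℚ.≤ f v
  indicator-≥0 v = by-cases (ind v)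
    where
    by-cases : f v ≡ 0ℚ ⊎ f v ≡ 1ℚ → 0ℚ ℚ.≤ f v
    by-cases (inj₁ eq) = ℚ.≤-reflexive (sym eq)
    by-cases (inj₂ eq) = ℚ.≤-trans (ℚ.nonNegative⁻¹ 1ℚ) (ℚ.≤-reflexive (sym eq))

  indicator-≤1 : ∀ v → f v ℚ.≤ 1ℚ
  indicator-≤1 v = by-cases (ind v)
    where
    by-cases : f v ≡ 0ℚ ⊎ f v ≡ 1ℚ → f v ℚ.≤ 1ℚ
    by-cases (inj₁ eq) = ℚ.≤-trans (ℚ.≤-reflexive eq) (ℚ.nonNegative⁻¹ 1ℚ)
    by-cases (inj₂ eq) = ℚ.≤-reflexive eq

  indicator-idem : ∀ v → f v ℚ.* f v ≡ f v
  indicator-idem v = by-cases (ind v)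
    where
    by-cases : f v ≡ 0ℚ ⊎ f v ≡ 1ℚ → f v ℚ.* f v ≡ f v
    by-cases (inj₁ eq) = trans (cong₂ ℚ._*_ eq eq) (sym eq)
    by-cases (inj₂ eq) = trans (cong₂ ℚ._*_ eq eq) (sym eq)

reverse⁺ : ∀ {A : Set} {P : A → Set} {xs} → All P xs → All P (reverse xs)
reverse⁺ []                      = []
reverse⁺ {xs = x ∷ xs} (px ∷ ps) = subst (All _) (sym (List.unfold-reverse x xs)) (All.++⁺ (reverse⁺ ps) (px ∷ []))

triangle : ℕ → ℕ
triangle zero    = 0
triangle (suc k) = suc k ℕ.+ triangle k

-- The expander mixing lemma in every link, with its geometric mean in linear form; τ will be t/2
-- and pq = 1. It is the only spectral input to the combinatorics. The weight p goes with φ, the set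
-- being separated, and q with ψ.
LocalMixing : ∀ {N} → ℕ → (List (Fin N) → ℕ) → (τ p q : ℚ) → Set
LocalMixing {N} n wt τ p q = ∀ l → length l ℕ.< n → wt l ≢ 0 → ∀ φ ψ →
  let a = λ v → ι (wt (v ∷ l)) in
  ℚ.∣ dot ψ (λ v → dot (λ u → ι (wt (u ∷ v ∷ l))) φ) ℚ.- inv (wt l) ℚ.* (dot a ψ ℚ.* dot a φ) ∣
    ℚ.≤ τ ℚ.* (q ℚ.* dot a (λ v → ψ v ℚ.* ψ v) ℚ.+ p ℚ.* dot a (λ v → φ v ℚ.* φ v))
  where open ℚ-forms using (dot)

module Mixing {N} (n : ℕ) (wt : List (Fin N) → ℕ)
  (marginal : ∀ l → length l ℕ.≤ n → wt l ≡ sumℕ (λ v → wt (v ∷ l)))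
  (swap : ∀ u v l → wt (u ∷ v ∷ l) ≡ wt (v ∷ u ∷ l))
  (τ p q : ℚ) (0≤τ : 0ℚ ℚ.≤ τ) (0≤p : 0ℚ ℚ.≤ p) (0≤q : 0ℚ ℚ.≤ q)
  (local : LocalMixing n wt τ p q)
  where

  open ℚ-forms using (Vector; dot)
  open ℚSolver.+-*-Solver

  w : List (Fin N) → ℚ
  w l = ι (wt l)

  w-marginal : ∀ l → length l ℕ.≤ n → w l ≡ ℚ-ring.sum (λ v → w (v ∷ l))
  w-marginal l ∣l∣≤n = trans (cong ι (marginal l ∣l∣≤n)) (ι-sum (λ v → wt (v ∷ l)))

  -- For indicators this is w l times the conditional probability, given the ordered simplex l, that
  -- the next vertices fall into the listed sets in turn. The newest vertex is at the head of l.
  A : List (Fin N) → List (Vector N) → ℚ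
  A l []       = w l
  A l (f ∷ fs) = dot f (λ v → A (v ∷ l) fs)

  m : List (Fin N) → Vector N → ℚ
  m l f = A l (f ∷ [])

  Indicators : List (Vector N) → Set
  Indicators = All Indicator

  A-nonneg : ∀ l {fs} → Indicators fs → 0ℚ ℚ.≤ A l fs
  A-nonneg l []           = ι-nonneg (wt l)
  A-nonneg l (ind ∷ inds) = sum-nonneg (λ v → indicator-≥0 ind v ⊗ A-nonneg (v ∷ l) inds)

  indicator-*-≤ : ∀ {f : Vector N} → Indicator f → ∀ v {x} → 0ℚ ℚ.≤ x → f v ℚ.* x ℚ.≤ x
  indicator-*-≤ {f} ind v {x} 0≤x = ≤-by (≤⇒0≤ (indicator-≤1 ind v) ⊗ 0≤x)
    (solve 2 (λ f x → x :- f :* x := (con 1ℚ :- f) :* x) refl (f v) x)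

  A-≤-w : ∀ l {fs} → Indicators fs → length l ℕ.+ length fs ℕ.≤ suc n → A l fs ℚ.≤ w l
  A-≤-w l []                   _     = ℚ.≤-refl
  A-≤-w l {f ∷ fs} (ind ∷ inds) bound = ℚ.≤-trans
    (sum-mono (λ v → ℚ.≤-trans (indicator-*-≤ ind v (A-nonneg (v ∷ l) inds))
      (A-≤-w (v ∷ l) inds (subst (ℕ._≤ suc n) (ℕ.+-suc (length l) (length fs)) bound))))
    (ℚ.≤-reflexive (sym (w-marginal l (ℕ.≤-trans (ℕ.m≤m+n (length l) (length fs))
      (ℕ.≤-pred (subst (ℕ._≤ suc n) (ℕ.+-suc (length l) (length fs)) bound))))))

  A-≤-head : ∀ l {f fs} → Indicators (f ∷ fs) → length l ℕ.+ suc (length fs) ℕ.≤ suc n → A l (f ∷ fs) ℚ.≤ m l f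
  A-≤-head l {f} {fs} (ind ∷ inds) bound = sum-mono (λ v → ℚ.*-monoˡ-≤-nonNeg (f v) {{ℚ.nonNegative (indicator-≥0 ind v)}}
    (A-≤-w (v ∷ l) inds (subst (ℕ._≤ suc n) (ℕ.+-suc (length l) (length fs)) bound)))

  A-vanishes : ∀ l {fs} → Indicators fs → length l ℕ.+ length fs ℕ.≤ suc n → wt l ≡ 0 → A l fs ≡ 0ℚ
  A-vanishes l inds bound wt≡0 = ℚ.≤-antisym
    (ℚ.≤-trans (A-≤-w l inds bound) (ℚ.≤-reflexive (cong ι wt≡0))) (A-nonneg l inds)

  m-marginal : ∀ l f → suc (length l) ℕ.≤ n → ℚ-ring.sum (λ v → m (v ∷ l) f) ≡ m l f
  m-marginal l f bound = begin
    ℚ-ring.sum (λ v → ℚ-ring.sum (λ u → f u ℚ.* w (u ∷ v ∷ l)))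
      ≡⟨ ℚ-ring.∑-comm (λ v u → f u ℚ.* w (u ∷ v ∷ l)) ⟩
    ℚ-ring.sum (λ u → ℚ-ring.sum (λ v → f u ℚ.* w (u ∷ v ∷ l)))
      ≡⟨ ℚ-ring.sum-cong-≋ (λ u → trans (sym (ℚ-ring.*-distribˡ-sum (f u) (λ v → w (u ∷ v ∷ l))))
           (cong (f u ℚ.*_) (trans (ℚ-ring.sum-cong-≋ (λ v → cong ι (swap u v l))) (sym (w-marginal (u ∷ l) bound))))) ⟩
    m l f ∎
    where open ≡-Reasoning

  deviation : List (Fin N) → List (Vector N) → Vector N → ℚ
  deviation l fs φ = A l (fs List.++ φ ∷ []) ℚ.- inv (wt l) ℚ.* (m l φ ℚ.* A l fs)

  -- Conditioning on the first vertex v reduces to the link of v, up to the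
  -- discrepancy between φ and g(v) = E[f f₁ ⋯ fₖ | v] in the graph on the vertices of l.
  mixing : ∀ l {fs φ} → Indicators fs → Indicator φ → length l ℕ.+ length fs ℕ.≤ n → wt l ≢ 0 →
    ℚ.∣ deviation l fs φ ∣ ℚ.≤ ι (length fs) ℚ.* (τ ℚ.* (p ℚ.* m l φ ℚ.+ q ℚ.* A l fs))
  mixing l {[]} {φ} [] ind-φ _ wt≢0 = ℚ.≤-reflexive (trans
    (cong ℚ.∣_∣ (trans
      (trans (solve 3 (λ m i w → m :- i :* (m :* w) := m :- m :* (i :* w)) refl (m l φ) (inv (wt l)) (w l))
        (trans (cong (λ z → m l φ ℚ.- m l φ ℚ.* z) (inv-* wt≢0)) (cong (λ z → m l φ ℚ.- z) (ℚ.*-identityʳ (m l φ)))))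
      (ℚ.+-inverseʳ (m l φ))))
    (sym (ℚ.*-zeroˡ (τ ℚ.* (p ℚ.* m l φ ℚ.+ q ℚ.* w l)))))
  mixing l {f ∷ fs} {φ} (ind ∷ inds) ind-φ bound wt≢0 = ℚ.≤-trans
    (∣-∣-chain (A l (f ∷ fs List.++ φ ∷ [])) (dot g (λ v → m (v ∷ l) φ)) (inv (wt l) ℚ.* (m l φ ℚ.* A l (f ∷ fs))) first second)
    (ℚ.≤-reflexive (trans (solve 3 (λ k e x → k :* x :+ x := (con 1ℚ :+ k) :* x) refl (ι k) 0ℚ bd)
      (cong (ℚ._* bd) (sym (ι-+ 1 k)))))
    where
    k : ℕ
    k = length fs
    bound′ : suc (length l) ℕ.+ k ℕ.≤ n
    bound′ = subst (ℕ._≤ n) (ℕ.+-suc (length l) k) bound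
    bd : ℚ
    bd = τ ℚ.* (p ℚ.* m l φ ℚ.+ q ℚ.* A l (f ∷ fs))
    -- The conditional probability is a quotient; where its denominator vanishes, the convention 1/0
    -- = 0 is sound because `A-vanishes` makes the numerator zero too, which is what `cancel` uses.
    g : Vector N
    g v = f v ℚ.* (inv (wt (v ∷ l)) ℚ.* A (v ∷ l) fs)
    vanishes : ∀ v → wt (v ∷ l) ≡ 0 → A (v ∷ l) fs ≡ 0ℚ
    vanishes v = A-vanishes (v ∷ l) inds (ℕ.m≤n⇒m≤1+n bound′)
    cancel : ∀ v → w (v ∷ l) ℚ.* (inv (wt (v ∷ l)) ℚ.* A (v ∷ l) fs) ≡ A (v ∷ l) fs
    cancel v = by-cases (wt (v ∷ l) ℕ.≟ 0)
      where
      by-cases : Dec (wt (v ∷ l) ≡ 0) → w (v ∷ l) ℚ.* (inv (wt (v ∷ l)) ℚ.* A (v ∷ l) fs) ≡ A (v ∷ l) fs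
      by-cases (yes eq) = trans (cong (w (v ∷ l) ℚ.*_) (trans (cong (inv (wt (v ∷ l)) ℚ.*_) (vanishes v eq)) (ℚ.*-zeroʳ (inv (wt (v ∷ l))))))
        (trans (ℚ.*-zeroʳ (w (v ∷ l))) (sym (vanishes v eq)))
      by-cases (no wt≢0) = trans (solve 3 (λ w i A → w :* (i :* A) := (i :* w) :* A) refl (w (v ∷ l)) (inv (wt (v ∷ l))) (A (v ∷ l) fs))
        (trans (cong (ℚ._* A (v ∷ l) fs) (inv-* wt≢0)) (ℚ.*-identityˡ _))
    link-mixing : ∀ v → ℚ.∣ deviation (v ∷ l) fs φ ∣ ℚ.≤ ι k ℚ.* (τ ℚ.* (p ℚ.* m (v ∷ l) φ ℚ.+ q ℚ.* A (v ∷ l) fs))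
    link-mixing v = by-cases (wt (v ∷ l) ℕ.≟ 0)
      where
      by-cases : Dec (wt (v ∷ l) ≡ 0) → _
      by-cases (no  wt≢0) = mixing (v ∷ l) inds ind-φ bound′ wt≢0
      by-cases (yes wt≡0) = ℚ.≤-trans
        (ℚ.≤-reflexive (cong ℚ.∣_∣ (trans
          (cong₂ (λ x y → x ℚ.- inv (wt (v ∷ l)) ℚ.* (m (v ∷ l) φ ℚ.* y))
            (A-vanishes (v ∷ l) (All.++⁺ inds (ind-φ ∷ [])) (subst (ℕ._≤ suc n)
              (trans (sym (ℕ.+-suc (suc (length l)) k)) (cong (suc (length l) ℕ.+_) (sym (trans (List.length-++ fs) (ℕ.+-comm k 1)))))
              (ℕ.s≤s bound′)) wt≡0)
            (vanishes v wt≡0))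
          (solve 2 (λ i m → con 0ℚ :- i :* (m :* con 0ℚ) := con 0ℚ) refl (inv (wt (v ∷ l))) (m (v ∷ l) φ)))))
        (ι-nonneg k ⊗ (0≤τ ⊗ (0≤p ⊗ A-nonneg (v ∷ l) (ind-φ ∷ []) ⊕ 0≤q ⊗ A-nonneg (v ∷ l) inds)))
    first : ℚ.∣ A l (f ∷ fs List.++ φ ∷ []) ℚ.- dot g (λ v → m (v ∷ l) φ) ∣ ℚ.≤ ι k ℚ.* bd
    first = begin
      ℚ.∣ A l (f ∷ fs List.++ φ ∷ []) ℚ.- dot g (λ v → m (v ∷ l) φ) ∣
        ≡⟨ cong ℚ.∣_∣ (sym (ℚ-harmonic.sum-minus (λ v → f v ℚ.* A (v ∷ l) (fs List.++ φ ∷ [])) (λ v → g v ℚ.* m (v ∷ l) φ))) ⟩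
      ℚ.∣ ℚ-ring.sum (λ v → f v ℚ.* A (v ∷ l) (fs List.++ φ ∷ []) ℚ.- g v ℚ.* m (v ∷ l) φ) ∣
        ≡⟨ cong ℚ.∣_∣ (ℚ-ring.sum-cong-≋ (λ v → solve 5 (λ f X i a y → f :* X :- f :* (i :* a) :* y := f :* (X :- i :* (y :* a))) refl
             (f v) (A (v ∷ l) (fs List.++ φ ∷ [])) (inv (wt (v ∷ l))) (A (v ∷ l) fs) (m (v ∷ l) φ))) ⟩
      ℚ.∣ ℚ-ring.sum (λ v → f v ℚ.* deviation (v ∷ l) fs φ) ∣
        ≤⟨ ∣sum∣≤ (λ v → f v ℚ.* deviation (v ∷ l) fs φ) ⟩
      ℚ-ring.sum (λ v → ℚ.∣ f v ℚ.* deviation (v ∷ l) fs φ ∣)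
        ≤⟨ sum-mono per-vertex ⟩
      ℚ-ring.sum (λ v → ι k ℚ.* τ ℚ.* (p ℚ.* m (v ∷ l) φ ℚ.+ q ℚ.* (f v ℚ.* A (v ∷ l) fs)))
        ≡⟨ ℚ-ring.*-distribˡ-sum (ι k ℚ.* τ) (λ v → p ℚ.* m (v ∷ l) φ ℚ.+ q ℚ.* (f v ℚ.* A (v ∷ l) fs)) ⟨
      ι k ℚ.* τ ℚ.* ℚ-ring.sum (λ v → p ℚ.* m (v ∷ l) φ ℚ.+ q ℚ.* (f v ℚ.* A (v ∷ l) fs))
        ≡⟨ cong (ι k ℚ.* τ ℚ.*_) (trans (ℚ-ring.∑-distrib-+ (λ v → p ℚ.* m (v ∷ l) φ) (λ v → q ℚ.* (f v ℚ.* A (v ∷ l) fs)))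
             (cong₂ ℚ._+_ (trans (sym (ℚ-ring.*-distribˡ-sum p (λ v → m (v ∷ l) φ)))
                            (cong (p ℚ.*_) (m-marginal l φ (ℕ.≤-trans (ℕ.m≤m+n (suc (length l)) k) bound′))))
                          (sym (ℚ-ring.*-distribˡ-sum q (λ v → f v ℚ.* A (v ∷ l) fs))))) ⟩
      ι k ℚ.* τ ℚ.* (p ℚ.* m l φ ℚ.+ q ℚ.* A l (f ∷ fs))
        ≡⟨ ℚ.*-assoc (ι k) τ _ ⟩
      ι k ℚ.* bd ∎
      where
      open ℚ.≤-Reasoning
      -- The factor f v is dropped from the φ-term by f ≤ 1 and kept in the other. Then the first
      -- terms sum to m l φ by `m-marginal`, and the second ones to A l (f ∷ fs).
      per-vertex : ∀ v → ℚ.∣ f v ℚ.* deviation (v ∷ l) fs φ ∣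
        ℚ.≤ ι k ℚ.* τ ℚ.* (p ℚ.* m (v ∷ l) φ ℚ.+ q ℚ.* (f v ℚ.* A (v ∷ l) fs))
      per-vertex v = ℚ.≤-trans
        (ℚ.≤-reflexive (trans (ℚ.∣p*q∣≡∣p∣*∣q∣ (f v) (deviation (v ∷ l) fs φ))
          (cong (ℚ._* ℚ.∣ deviation (v ∷ l) fs φ ∣) (ℚ.0≤p⇒∣p∣≡p (indicator-≥0 ind v)))))
        (≤-by (indicator-≥0 ind v ⊗ ≤⇒0≤ (link-mixing v)
                ⊕ ι-nonneg k ⊗ 0≤τ ⊗ (0≤p ⊗ ≤⇒0≤ (indicator-*-≤ ind v (A-nonneg (v ∷ l) (ind-φ ∷ [])))))
          (solve 8 (λ k τ p q f M a e → k :* τ :* (p :* M :+ q :* (f :* a)) :- f :* e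
             := f :* (k :* (τ :* (p :* M :+ q :* a)) :- e) :+ k :* τ :* (p :* (M :- f :* M))) refl
            (ι k) τ p q (f v) (m (v ∷ l) φ) (A (v ∷ l) fs) ℚ.∣ deviation (v ∷ l) fs φ ∣))
    a : Vector N
    a v = w (v ∷ l)
    second : ℚ.∣ dot g (λ v → m (v ∷ l) φ) ℚ.- inv (wt l) ℚ.* (m l φ ℚ.* A l (f ∷ fs)) ∣ ℚ.≤ bd
    second = begin
      ℚ.∣ dot g (λ v → m (v ∷ l) φ) ℚ.- inv (wt l) ℚ.* (m l φ ℚ.* A l (f ∷ fs)) ∣
        ≡⟨ cong ℚ.∣_∣ (cong₂ (λ x y → x ℚ.- inv (wt l) ℚ.* y)
             (ℚ-ring.sum-cong-≋ (λ v → cong (g v ℚ.*_) (ℚ-forms.dot-comm φ (λ u → w (u ∷ v ∷ l)))))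
             (trans (ℚ.*-comm (m l φ) (A l (f ∷ fs))) (cong₂ ℚ._*_ (sym a·g) (ℚ-forms.dot-comm φ a)))) ⟩
      ℚ.∣ dot g (λ v → dot (λ u → w (u ∷ v ∷ l)) φ) ℚ.- inv (wt l) ℚ.* (dot a g ℚ.* dot a φ) ∣
        ≤⟨ local l (ℕ.≤-trans (ℕ.m≤m+n (suc (length l)) k) bound′) wt≢0 φ g ⟩
      τ ℚ.* (q ℚ.* dot a (λ v → g v ℚ.* g v) ℚ.+ p ℚ.* dot a (λ v → φ v ℚ.* φ v))
        ≤⟨ ≤-by (0≤τ ⊗ (0≤q ⊗ ≤⇒0≤ g²-≤)) (solve 6 (λ τ p q M G a → τ :* (p :* M :+ q :* a) :- τ :* (q :* G :+ p :* M) := τ :* (q :* (a :- G))) refl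
             τ p q (dot a (λ v → φ v ℚ.* φ v)) (dot a (λ v → g v ℚ.* g v)) (A l (f ∷ fs))) ⟩
      τ ℚ.* (p ℚ.* dot a (λ v → φ v ℚ.* φ v) ℚ.+ q ℚ.* A l (f ∷ fs))
        ≡⟨ cong (λ z → τ ℚ.* (p ℚ.* z ℚ.+ q ℚ.* A l (f ∷ fs)))
             (trans (ℚ-ring.sum-cong-≋ (λ v → cong (a v ℚ.*_) (indicator-idem ind-φ v))) (ℚ-forms.dot-comm a φ)) ⟩
      bd ∎
      where
      open ℚ.≤-Reasoning
      a·g : dot a g ≡ A l (f ∷ fs)
      a·g = ℚ-ring.sum-cong-≋ (λ v → trans
        (solve 4 (λ w f i A → w :* (f :* (i :* A)) := f :* (w :* (i :* A))) refl (a v) (f v) (inv (wt (v ∷ l))) (A (v ∷ l) fs))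
        (cong (f v ℚ.*_) (cancel v)))
      -- As g takes values between 0 and 1, its second moment is at most its mean; so the error
      -- involves the probability of the event and not its square root.
      g²-≤ : dot a (λ v → g v ℚ.* g v) ℚ.≤ A l (f ∷ fs)
      g²-≤ = sum-mono λ v → ℚ.≤-trans
        (ℚ.≤-reflexive (trans
          (solve 4 (λ w f i A → w :* ((f :* (i :* A)) :* (f :* (i :* A))) := (f :* f) :* ((w :* (i :* A)) :* (i :* A))) refl
            (a v) (f v) (inv (wt (v ∷ l))) (A (v ∷ l) fs))
          (cong₂ (λ x y → x ℚ.* (y ℚ.* (inv (wt (v ∷ l)) ℚ.* A (v ∷ l) fs))) (indicator-idem ind v) (cancel v))))
        (≤-by (indicator-≥0 ind v ⊗ (A-nonneg (v ∷ l) inds ⊗ ≤⇒0≤ (inv-≤1 (wt (v ∷ l)) (A-≤-w (v ∷ l) inds (ℕ.m≤n⇒m≤1+n bound′)))))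
          (solve 3 (λ f A y → f :* A :- f :* (A :* y) := f :* (A :* (con 1ℚ :- y))) refl
            (f v) (A (v ∷ l) fs) (inv (wt (v ∷ l)) ℚ.* A (v ∷ l) fs)))

  density : List (Vector N) → ℚ
  density []       = 1ℚ
  density (h ∷ hs) = inv (wt []) ℚ.* m [] h ℚ.* density hs

  -- The empty list is given the total weight: its coefficient in `independence` is `triangle 0`,
  -- and `head-weight-≤` holds for it as for the others.
  head-weight : List (Vector N) → ℚ
  head-weight []      = w []
  head-weight (h ∷ _) = m [] h

  head-weight-≤ : ∀ {hs} → Indicators hs → head-weight hs ℚ.≤ w []
  head-weight-≤ []        = ℚ.≤-refl
  head-weight-≤ (ind ∷ _) = A-≤-w [] (ind ∷ []) (ℕ.s≤s ℕ.z≤n)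

  -- Peeling off h, the last set of the reversed list, costs k + 1 errors, where `A-≤-head` replaces
  -- the remaining event by b alone. The error for the remaining sets is multiplied by P(h); that
  -- factor is at most 1, and it also trades the weight of their head for that of h, since the
  -- latter's companion has probability at most 1. So all errors are measured by the same two sets h
  -- and b, and their numbers add up to a triangular number.
  independence : ∀ {b hs} → Indicator b → Indicators hs → length hs ℕ.≤ n → wt [] ≢ 0 →
    ℚ.∣ A [] (b ∷ reverse hs) ℚ.- m [] b ℚ.* density hs ∣
      ℚ.≤ ι (triangle (length hs)) ℚ.* (τ ℚ.* (p ℚ.* head-weight hs ℚ.+ q ℚ.* m [] b))
  independence {b} {[]} ind-b [] _ wt≢0 = ℚ.≤-reflexive (trans
    (cong ℚ.∣_∣ (trans (cong (λ z → m [] b ℚ.- z) (ℚ.*-identityʳ (m [] b))) (ℚ.+-inverseʳ (m [] b)))) (sym (ℚ.*-zeroˡ (τ ℚ.* (p ℚ.* w [] ℚ.+ q ℚ.* m [] b)))))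
  independence {b} {h ∷ hs} ind-b (ind ∷ inds) bound wt≢0 = ℚ.≤-trans
    (∣-∣-chain (A [] (b ∷ reverse (h ∷ hs))) (inv (wt []) ℚ.* (H ℚ.* A′)) (B ℚ.* density (h ∷ hs)) peel rest)
    (ℚ.≤-reflexive (trans (sym (ℚ.*-distribʳ-+ bd (ι (suc k)) (ι (triangle k)))) (cong (ℚ._* bd) (sym (ι-+ (suc k) (triangle k))))))
    where
    k : ℕ
    k = length hs
    H B A′ bd : ℚ
    H = m [] h
    B = m [] b
    A′ = A [] (b ∷ reverse hs)
    bd = τ ℚ.* (p ℚ.* H ℚ.+ q ℚ.* B)
    inds′ : Indicators (b ∷ reverse hs)
    inds′ = ind-b ∷ reverse⁺ inds
    len : length (b ∷ reverse hs) ≡ suc k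
    len = cong suc (List.length-reverse hs)
    0≤H = A-nonneg [] (ind ∷ [])
    0≤B = A-nonneg [] (ind-b ∷ [])
    peel : ℚ.∣ A [] (b ∷ reverse (h ∷ hs)) ℚ.- inv (wt []) ℚ.* (H ℚ.* A′) ∣ ℚ.≤ ι (suc k) ℚ.* bd
    peel = ℚ.≤-trans
      (ℚ.≤-reflexive (cong (λ fs → ℚ.∣ A [] (b ∷ fs) ℚ.- inv (wt []) ℚ.* (H ℚ.* A′) ∣) (List.unfold-reverse h hs)))
      (ℚ.≤-trans (mixing [] inds′ ind (subst (ℕ._≤ n) (sym len) bound) wt≢0)
        (ℚ.≤-trans (ℚ.≤-reflexive (cong (λ j → ι j ℚ.* (τ ℚ.* (p ℚ.* H ℚ.+ q ℚ.* A′))) len))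
          (≤-by (ι-nonneg (suc k) ⊗ (0≤τ ⊗ (0≤q ⊗ ≤⇒0≤ (A-≤-head [] inds′ (ℕ.m≤n⇒m≤1+n (subst (ℕ._≤ n) (sym len) bound))))))
            (solve 7 (λ k τ p q H B A → k :* (τ :* (p :* H :+ q :* B)) :- k :* (τ :* (p :* H :+ q :* A)) := k :* (τ :* (q :* (B :- A)))) refl
              (ι (suc k)) τ p q H B A′))))
    rest : ℚ.∣ inv (wt []) ℚ.* (H ℚ.* A′) ℚ.- B ℚ.* density (h ∷ hs) ∣ ℚ.≤ ι (triangle k) ℚ.* bd
    rest = ℚ.≤-trans
      (ℚ.≤-reflexive (trans (cong ℚ.∣_∣ (solve 5 (λ i H A B d → i :* (H :* A) :- B :* (i :* H :* d) := (i :* H) :* (A :- B :* d)) refl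
          (inv (wt [])) H A′ B (density hs)))
        (trans (ℚ.∣p*q∣≡∣p∣*∣q∣ (inv (wt []) ℚ.* H) (A′ ℚ.- B ℚ.* density hs))
          (cong (ℚ._* ℚ.∣ A′ ℚ.- B ℚ.* density hs ∣) (ℚ.0≤p⇒∣p∣≡p (inv-nonneg (wt []) ⊗ 0≤H))))))
      (≤-by
        (inv-nonneg (wt []) ⊗ 0≤H ⊗ ≤⇒0≤ (independence ind-b inds (ℕ.≤-trans (ℕ.n≤1+n k) bound) wt≢0)
          ⊕ ι-nonneg (triangle k) ⊗ (0≤τ ⊗ (0≤p ⊗ (0≤H ⊗ ≤⇒0≤ (inv-≤1 (wt []) (head-weight-≤ inds)))
              ⊕ 0≤q ⊗ (0≤B ⊗ ≤⇒0≤ (inv-≤1 (wt []) (head-weight-≤ (ind ∷ inds)))))))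
        (solve 9 (λ i H c τ p q h B e →
            c :* (τ :* (p :* H :+ q :* B)) :- i :* H :* e
          := i :* H :* (c :* (τ :* (p :* h :+ q :* B)) :- e) :+ c :* (τ :* (p :* (H :* (con 1ℚ :- i :* h)) :+ q :* (B :* (con 1ℚ :- i :* H))))) refl
          (inv (wt [])) H (ι (triangle k)) τ p q (head-weight hs) B ℚ.∣ A′ ℚ.- B ℚ.* density hs ∣))

-- Random walks on links

inv≡mkℚ : ∀ b → inv (suc b) ≡ mkℚ (+ 1) b (Coprime.1-coprimeTo (suc b))
inv≡mkℚ b = ℚ.↥p/↧p≡p (mkℚ (+ 1) b (Coprime.1-coprimeTo (suc b)))

mkℚ-*-mkℚ : ∀ a b .(c : Coprime.Coprime a 1) .(d : Coprime.Coprime 1 (suc b)) → mkℚ (+ a) 0 c ℚ.* mkℚ (+ 1) b d ≡ + a ℚ./ suc b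
mkℚ-*-mkℚ a b c d = ℚ./-cong {+ a ℤ.* + 1} {1 ℕ.* suc b} {+ a} {suc b} (ℤ.*-identityʳ (+ a)) (ℕ.*-identityˡ (suc b))

÷≡ : ∀ a b → a ÷ b ≡ ι a ℚ.* inv b
÷≡ a zero    = sym (ℚ.*-zeroʳ (ι a))
÷≡ a (suc b) = sym (trans (cong₂ ℚ._*_ (ι≡mkℚ a) (inv≡mkℚ b))
  (mkℚ-*-mkℚ a b (Coprime.sym (Coprime.1-coprimeTo a)) (Coprime.1-coprimeTo (suc b))))

ι-*-÷ : ∀ a {b} → b ≢ 0 → ι b ℚ.* (a ÷ b) ≡ ι a
ι-*-÷ a {b} b≢0 = trans (cong (ι b ℚ.*_) (÷≡ a b))
  (trans (solve 3 (λ b a i → b :* (a :* i) := a :* (i :* b)) refl (ι b) (ι a) (inv b))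
    (trans (cong (ι a ℚ.*_) (inv-* b≢0)) (ℚ.*-identityʳ (ι a))))
  where open ℚSolver.+-*-Solver

if-yes : ∀ {A B : Set} (d : Dec A) {x y : B} → A → (if does d then x else y) ≡ x
if-yes (yes _) a = refl
if-yes (no ¬a) a = ⊥-elim (¬a a)

if-no : ∀ {A B : Set} (d : Dec A) {x y : B} → ¬ A → (if does d then x else y) ≡ y
if-no (yes a) ¬a = ⊥-elim (¬a a)
if-no (no _)  ¬a = refl

seq-sum-filter : ∀ {A : Set} {P : A → Set} (P? : Decidable P) (F : A → ℝ) {n} (g : Fin n → A) k →
  seq (sumℝ (List.map F (filter P? (List.tabulate g)))) k
    ≡ ℚ-ring.sum (λ i → if does (P? (g i)) then seq (F (g i)) k else 0ℚ)
seq-sum-filter P? F {zero}  g k = refl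
seq-sum-filter {P = P} P? F {suc n} g k = trans (by-cases (P? (g zero)))
  (cong (term zero ℚ.+_) (seq-sum-filter P? F (λ i → g (suc i)) k))
  where
  term : Fin (suc n) → ℚ
  term i = if does (P? (g i)) then seq (F (g i)) k else 0ℚ
  rest : List _
  rest = List.tabulate (λ i → g (suc i))
  total : List _ → ℚ
  total xs = seq (sumℝ (List.map F xs)) k
  by-cases : Dec (P (g zero)) → total (filter P? (g zero ∷ rest)) ≡ term zero ℚ.+ total (filter P? rest)
  by-cases (yes p) = trans (cong total (List.filter-accept P? p))
    (cong (ℚ._+ total (filter P? rest)) (sym (if-yes (P? (g zero)) p)))
  by-cases (no ¬p) = trans (cong total (List.filter-reject P? ¬p))
    (trans (sym (ℚ.+-identityˡ (total (filter P? rest)))) (cong (ℚ._+ total (filter P? rest)) (sym (if-no (P? (g zero)) ¬p))))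

∣⁅v⁆∪τ∣-≤ : ∀ {N} (v : Fin N) (τ : Subset N) → ∣ ⁅ v ⁆ ∪ τ ∣ ℕ.≤ suc ∣ τ ∣
∣⁅v⁆∪τ∣-≤ v τ with v ∈? τ
... | yes v∈τ = ℕ.≤-trans (ℕ.≤-reflexive (∣⁅v⁆∪τ∣-∈ v∈τ)) (ℕ.n≤1+n ∣ τ ∣)
... | no  v∉τ = ℕ.≤-reflexive (∣⁅v⁆∪τ∣ v∉τ)

∣⁅v⁆∪τ∣-∉ : ∀ {N} (v : Fin N) (τ : Subset N) → ∣ ⁅ v ⁆ ∪ τ ∣ ≡ suc ∣ τ ∣ → v ∉ τ
∣⁅v⁆∪τ∣-∉ v τ eq v∈τ = ℕ.1+n≢n (trans (sym eq) (∣⁅v⁆∪τ∣-∈ v∈τ))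

module Links {N} (X : SimplicialComplex N) (n : ℕ) (pure : Pure X n) where

  open Weights X n

  module _ {l : List (Fin N)} (d : Distinct l) (τ∈X : Simplex X (support l)) where

    private
      τ : Subset N
      τ = support l

      L : SimplicialComplex N
      L = link X τ∈X

    linkWeight-vertex : ∀ v → weight X n (τ ∪ ⁅ v ⁆) ≡ weight X n (support (v ∷ l))
    linkWeight-vertex v = cong (weight X n) (Subset.∪-comm τ ⁅ v ⁆)

    edge-support : ∀ u v → τ ∪ (⁅ u ⁆ ∪ ⁅ v ⁆) ≡ support (u ∷ v ∷ l)
    edge-support u v = trans (Subset.∪-comm τ (⁅ u ⁆ ∪ ⁅ v ⁆)) (Subset.∪-assoc ⁅ u ⁆ ⁅ v ⁆ τ)

    vertex⇒ : ∀ v → IsVertex L v → wℕ (v ∷ l) ≢ 0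
    vertex⇒ v ((_ , τv∈X , card) , ∣v∣≡1) = simplex⇒wℕ≢0 pure {v ∷ l}
      (∣⁅v⁆∪τ∣-∉ v τ (trans (cong ∣_∣ (Subset.∪-comm ⁅ v ⁆ τ)) (trans card (trans (cong (∣ τ ∣ ℕ.+_) ∣v∣≡1) (ℕ.+-comm ∣ τ ∣ 1)))) , d)
      (subst (Simplex X) (Subset.∪-comm τ ⁅ v ⁆) τv∈X)

    vertex⇐ : ∀ v → wℕ (v ∷ l) ≢ 0 → IsVertex L v
    vertex⇐ v wt≢0 = let ((v∉τ , _) , vτ∈X) = wℕ≢0⇒simplex {v ∷ l} wt≢0 in
        ( closed X (Subset.p⊆p∪q τ) vτ∈X
        , subst (Simplex X) (Subset.∪-comm ⁅ v ⁆ τ) vτ∈X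
        , trans (cong ∣_∣ (Subset.∪-comm τ ⁅ v ⁆)) (trans (∣⁅v⁆∪τ∣ v∉τ) (trans (ℕ.+-comm 1 ∣ τ ∣) (cong (∣ τ ∣ ℕ.+_) (sym (Subset.∣⁅x⁆∣≡1 v))))))
      , Subset.∣⁅x⁆∣≡1 v

    -- The cardinality conditions force |{u, v} ∪ τ| = |τ| + 2, and adjoining a vertex adds at most
    -- one; so both adjunctions must be of new vertices.
    edge⇒distinct : ∀ u v → IsEdge L u v → Distinct (u ∷ v ∷ l)
    edge⇒distinct u v ((_ , _ , card) , ∣uv∣≡2) = u∉ , ∣⁅v⁆∪τ∣-∉ v τ (ℕ.≤-antisym (∣⁅v⁆∪τ∣-≤ v τ) lower) , d
      where
      total : ∣ ⁅ u ⁆ ∪ (⁅ v ⁆ ∪ τ) ∣ ≡ suc (suc ∣ τ ∣)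
      total = trans (cong ∣_∣ (sym (edge-support u v))) (trans card (trans (cong (∣ τ ∣ ℕ.+_) ∣uv∣≡2) (ℕ.+-comm ∣ τ ∣ 2)))
      lower : suc ∣ τ ∣ ℕ.≤ ∣ ⁅ v ⁆ ∪ τ ∣
      lower = ℕ.≤-pred (subst (ℕ._≤ suc ∣ ⁅ v ⁆ ∪ τ ∣) total (∣⁅v⁆∪τ∣-≤ u (⁅ v ⁆ ∪ τ)))
      u∉ : u ∉ ⁅ v ⁆ ∪ τ
      u∉ u∈ = ℕ.1+n≰n (subst (ℕ._≤ suc ∣ τ ∣) (trans (sym (∣⁅v⁆∪τ∣-∈ u∈)) total) (∣⁅v⁆∪τ∣-≤ v τ))

    edge⇒ : ∀ u v → IsEdge L u v → wℕ (u ∷ v ∷ l) ≢ 0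
    edge⇒ u v e@((_ , τuv∈X , _) , _) = simplex⇒wℕ≢0 pure {u ∷ v ∷ l} (edge⇒distinct u v e) (subst (Simplex X) (edge-support u v) τuv∈X)

    edge⇐ : ∀ u v → wℕ (u ∷ v ∷ l) ≢ 0 → IsEdge L u v
    edge⇐ u v wt≢0 = let ((u∉ , v∉τ , _) , uvτ∈X) = wℕ≢0⇒simplex {u ∷ v ∷ l} wt≢0
                         τuv∈X = subst (Simplex X) (sym (edge-support u v)) uvτ∈X
                         ∣uv∣≡2 = trans (∣⁅v⁆∪τ∣ (λ u∈v → u∉ (Subset.p⊆p∪q τ u∈v))) (cong suc (Subset.∣⁅x⁆∣≡1 v)) in
        ( closed X (Subset.q⊆p∪q τ (⁅ u ⁆ ∪ ⁅ v ⁆)) τuv∈X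
        , τuv∈X
        , trans (cong ∣_∣ (edge-support u v)) (trans (∣⁅v⁆∪τ∣ u∉) (trans (cong suc (∣⁅v⁆∪τ∣ v∉τ))
            (trans (ℕ.+-comm 2 ∣ τ ∣) (cong (∣ τ ∣ ℕ.+_) (sym ∣uv∣≡2))))))
      , ∣uv∣≡2

    seq-walk : ∀ φ v k → seq (walk X n τ∈X φ v) k ≡ ℚ-ring.sum (λ u →
      if does ((link X τ∈X ⟨ 2 ⟩?) (⁅ u ⁆ ∪ ⁅ v ⁆))
      then (linkWeight X n τ∈X (⁅ u ⁆ ∪ ⁅ v ⁆) ÷ linkWeight X n τ∈X ⁅ v ⁆) ℚ.* seq (φ u) k else 0ℚ)
    seq-walk φ v k = seq-sum-filter (λ u → (link X τ∈X ⟨ 2 ⟩?) (⁅ u ⁆ ∪ ⁅ v ⁆))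
      (λ u → fromℚ (linkWeight X n τ∈X (⁅ u ⁆ ∪ ⁅ v ⁆) ÷ linkWeight X n τ∈X ⁅ v ⁆) *ℝ φ u) (λ u → u) k

    -- Multiplying by the weight of v clears the denominators. The summands that the walk filters
    -- out do not appear on the right either, because non-edges have weight zero.
    walk-weighted : ∀ φ v → wℕ (v ∷ l) ≢ 0 →
      fromℚ (ι (wℕ (v ∷ l))) ⊠ walk X n τ∈X φ v ≈ℝ ℝ-forms.dot (λ u → fromℚ (ι (wℕ (u ∷ v ∷ l)))) φ
    walk-weighted φ v wt≢0 = pointwise λ k → begin
      seq (fromℚ (ι M) ⊠ walk X n τ∈X φ v) k
        ≡⟨ seq-⊠ (fromℚ (ι M)) (walk X n τ∈X φ v) k ⟩
      ι M ℚ.* seq (walk X n τ∈X φ v) k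
        ≡⟨ cong (ι M ℚ.*_) (seq-walk φ v k) ⟩
      ι M ℚ.* ℚ-ring.sum (λ u → if does (edge? u) then c u ℚ.* seq (φ u) k else 0ℚ)
        ≡⟨ ℚ-ring.*-distribˡ-sum (ι M) (λ u → if does (edge? u) then c u ℚ.* seq (φ u) k else 0ℚ) ⟩
      ℚ-ring.sum (λ u → ι M ℚ.* (if does (edge? u) then c u ℚ.* seq (φ u) k else 0ℚ))
        ≡⟨ ℚ-ring.sum-cong-≋ (λ u → entry u k (edge? u)) ⟩
      ℚ-ring.sum (λ u → ι (wℕ (u ∷ v ∷ l)) ℚ.* seq (φ u) k)
        ≡⟨ seq-dot (λ u → fromℚ (ι (wℕ (u ∷ v ∷ l)))) φ k ⟨
      seq (ℝ-forms.dot (λ u → fromℚ (ι (wℕ (u ∷ v ∷ l)))) φ) k ∎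
      where
      open ≡-Reasoning
      M : ℕ
      M = wℕ (v ∷ l)
      edge? : ∀ u → Dec (IsEdge L u v)
      edge? u = (L ⟨ 2 ⟩?) (⁅ u ⁆ ∪ ⁅ v ⁆)
      c : Fin N → ℚ
      c u = linkWeight X n τ∈X (⁅ u ⁆ ∪ ⁅ v ⁆) ÷ linkWeight X n τ∈X ⁅ v ⁆
      M≡ : M ≡ linkWeight X n τ∈X ⁅ v ⁆
      M≡ = trans (wℕ-distinct (v ∷ l) (proj₁ (wℕ≢0⇒simplex {v ∷ l} wt≢0))) (sym (linkWeight-vertex v))
      entry : ∀ u k (e : Dec (IsEdge L u v)) → ι M ℚ.* (if does e then c u ℚ.* seq (φ u) k else 0ℚ) ≡ ι (wℕ (u ∷ v ∷ l)) ℚ.* seq (φ u) k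
      entry u k e@(yes uv) = begin
        ι M ℚ.* (c u ℚ.* seq (φ u) k)
          ≡⟨ ℚ.*-assoc (ι M) (c u) (seq (φ u) k) ⟨
        ι M ℚ.* c u ℚ.* seq (φ u) k
          ≡⟨ cong (ℚ._* seq (φ u) k) (trans (cong (λ j → ι j ℚ.* c u) M≡)
               (ι-*-÷ (linkWeight X n τ∈X (⁅ u ⁆ ∪ ⁅ v ⁆)) (λ eq → wt≢0 (trans M≡ eq)))) ⟩
        ι (linkWeight X n τ∈X (⁅ u ⁆ ∪ ⁅ v ⁆)) ℚ.* seq (φ u) k
          ≡⟨ cong (λ j → ι j ℚ.* seq (φ u) k) (trans (cong (weight X n) (edge-support u v)) (sym (wℕ-distinct (u ∷ v ∷ l) (edge⇒distinct u v uv)))) ⟩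
        ι (wℕ (u ∷ v ∷ l)) ℚ.* seq (φ u) k ∎
      entry u k (no ¬uv) = trans (ℚ.*-zeroʳ (ι M)) (sym (trans (cong (ℚ._* seq (φ u) k) (cong ι (vanishes (wℕ (u ∷ v ∷ l) ℕ.≟ 0)))) (ℚ.*-zeroˡ (seq (φ u) k))))
        where
        vanishes : Dec (wℕ (u ∷ v ∷ l) ≡ 0) → wℕ (u ∷ v ∷ l) ≡ 0
        vanishes (yes eq)  = eq
        vanishes (no wt≢0) = ⊥-elim (¬uv (edge⇐ u v wt≢0))

    eigenfunction⇒InSpec : ∀ μ φ → ¬ (∀ v → wℕ (v ∷ l) ≢ 0 → φ v ≈ℝ 0ℝ) →
      (∀ v → wℕ (v ∷ l) ≢ 0 →
        ℝ-forms.dot (λ u → fromℚ (ι (wℕ (u ∷ v ∷ l)))) φ ≈ℝ μ ⊠ (fromℚ (ι (wℕ (v ∷ l))) ⊠ φ v)) →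
      InSpec X n τ∈X μ
    eigenfunction⇒InSpec μ φ nonzero eigen = φ
      , (λ zero → nonzero λ v wt≢0 → ≃⇒≈ℝ (zero v (vertex⇐ v wt≢0)))
      , λ v vertex → ≈ℝ⇒≃ (subst (walk X n τ∈X φ v ≈ℝ_) (⊠≡*ℝ μ (φ v)) (at v (vertex⇒ v vertex)))
      where
      open ℝ-ring using (≈-trans; ≈-sym; *-comm; *-assoc; *-congʳ)
      at : ∀ v → wℕ (v ∷ l) ≢ 0 → walk X n τ∈X φ v ≈ℝ μ ⊠ φ v
      at v wt≢0 = ℝ-ring.*-cancelˡ-≈ {fromℚ m} {walk X n τ∈X φ v} {μ ⊠ φ v}
        (m , ι-pos wt≢0 , 0 , λ _ _ → ℚ.≤-refl)
        (≈-trans (walk-weighted φ v wt≢0) (≈-trans (eigen v wt≢0)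
          (≈-trans (≈-sym (*-assoc μ (fromℚ m) (φ v))) (≈-trans (*-congʳ {φ v} (*-comm μ (fromℚ m))) (*-assoc (fromℚ m) μ (φ v))))))
        where
        m : ℚ
        m = ι (wℕ (v ∷ l))

  module Local (connected : ConnectedLinks X n) (lam : ℝ) (0<lam : 0ℝ <ℝ lam)
    (spectrum : ∀ k τ → k ℕ.< n → ((τ∈X , _) : (X ⟨ k ⟩) τ) →
       ∀ μ → InSpec X n τ∈X μ → ((-ℝ lam) ≤ℝ μ × μ ≤ℝ lam) ⊎ (μ ≃ 1ℝ))
    (t : ℚ) (lam<t : lam <ℝ fromℚ t) {p q : ℚ} (0≤p : 0ℚ ℚ.≤ p) (pq≡1 : p ℚ.* q ≡ 1ℚ)
    where

    local : LocalMixing n wℕ (½ ℚ.* t) p q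
    -- `covariance-bound` attaches its first parameter to its first function; here that function is
    -- ψ, so p and q are interchanged.
    local l ∣l∣<n wt≢0 φ ψ = G.Spectral.covariance-bound lam 0<lam path eigen t lam<t {q} {p}
        0≤p pq≡1 ψ φ
      where
      d : Distinct l
      d = proj₁ (wℕ≢0⇒simplex {l} wt≢0)
      τ∈X : Simplex X (support l)
      τ∈X = proj₂ (wℕ≢0⇒simplex {l} wt≢0)
      module G = WeightedGraph (λ v u → wℕ (u ∷ v ∷ l)) (λ v → wℕ (v ∷ l)) (wℕ l)
        (λ u v → wℕ-swap v u l) (λ v → wℕ-marginal (v ∷ l) ∣l∣<n) (wℕ-marginal l (ℕ.<⇒≤ ∣l∣<n)) wt≢0
      path : ∀ u v → wℕ (u ∷ l) ≢ 0 → wℕ (v ∷ l) ≢ 0 → Star (λ u v → wℕ (v ∷ u ∷ l) ≢ 0) u v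
      path u v u≢0 v≢0 = Star-map (λ {x} {y} e eq → edge⇒ d τ∈X x y e (trans (wℕ-swap x y l) eq))
        (connected (length l) ∣l∣<n (τ∈X , ∣support∣ d) u v (vertex⇐ d τ∈X u u≢0) (vertex⇐ d τ∈X v v≢0))
      eigen : ∀ μ φ → ¬ (∀ v → wℕ (v ∷ l) ≢ 0 → φ v ≈ℝ 0ℝ) →
        (∀ v → wℕ (v ∷ l) ≢ 0 →
          ℝ-forms.dot (λ u → fromℚ (ι (wℕ (u ∷ v ∷ l)))) φ ≈ℝ μ ⊠ (fromℚ (ι (wℕ (v ∷ l))) ⊠ φ v)) →
        ((-ℝ lam) ≤ℝ μ × μ ≤ℝ lam) ⊎ μ ≃ 1ℝ
      eigen μ φ nonzero eq = spectrum (length l) (support l) ∣l∣<n (τ∈X , ∣support∣ d) μ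
        (eigenfunction⇒InSpec d τ∈X μ φ nonzero eq)

-- Counting transversal simplices

unique-resp-↭ : ∀ {A : Set} {xs ys : List A} → xs ↭ ys → Unique xs → Unique ys
unique-resp-↭ xs↭ys = PermSetoid.Unique-resp-↭ (≡.setoid _) (↭⇒↭ₛ xs↭ys)

sum<length⇒product≡0 : ∀ xs → listSum xs ℕ.< length xs → listProduct xs ≡ 0
sum<length⇒product≡0 (zero  ∷ xs) _          = refl
sum<length⇒product≡0 (suc x ∷ xs) (ℕ.s≤s h) = trans
  (cong (suc x ℕ.*_) (sum<length⇒product≡0 xs (ℕ.≤-<-trans (ℕ.m≤n+m (listSum xs) x) h))) (ℕ.*-zeroʳ (suc x))

-- A pigeonhole argument: an entry above 1 forces a zero elsewhere. For the sizes |σ ∩ Uᵢ| of a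
-- facet it makes the product of the sizes the indicator of being transversal.
sum≤length⇒product : ∀ xs → listSum xs ℕ.≤ length xs → listProduct xs ≡ 0 ⊎ All (_≡ 1) xs
sum≤length⇒product []                  _         = inj₂ []
sum≤length⇒product (zero        ∷ xs)  _         = inj₁ refl
sum≤length⇒product (suc zero    ∷ xs) (ℕ.s≤s h) = by-cases (sum≤length⇒product xs h)
  where
  by-cases : listProduct xs ≡ 0 ⊎ All (_≡ 1) xs → 1 ℕ.* listProduct xs ≡ 0 ⊎ All (_≡ 1) (1 ∷ xs)
  by-cases (inj₁ eq)  = inj₁ (trans (ℕ.*-identityˡ (listProduct xs)) eq)
  by-cases (inj₂ all) = inj₂ (refl ∷ all)
sum≤length⇒product (suc (suc x) ∷ xs) (ℕ.s≤s h) = inj₁ (trans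
  (cong (suc (suc x) ℕ.*_) (sum<length⇒product≡0 xs (ℕ.≤-trans (ℕ.s≤s (ℕ.m≤n+m (listSum xs) x)) h))) (ℕ.*-zeroʳ (suc (suc x))))

product-ones : ∀ {xs} → All (_≡ 1) xs → listProduct xs ≡ 1
product-ones []           = refl
product-ones (refl ∷ all) = trans (ℕ.*-identityˡ _) (product-ones all)

χ-∩ : ∀ {N} (σ V : Subset N) v → χ (v ∈? (σ ∩ V)) ≡ χ (v ∈? V) ℕ.* χ (v ∈? σ)
χ-∩ σ V v = by-cases (v ∈? V)
  where
  by-cases : (d : Dec (v ∈ V)) → χ (v ∈? (σ ∩ V)) ≡ χ d ℕ.* χ (v ∈? σ)
  by-cases (yes v∈V) = trans (χ-cong (v ∈? (σ ∩ V)) (v ∈? σ) (λ h → proj₁ (Subset.x∈p∩q⁻ σ V h)) (λ h → Subset.x∈p∩q⁺ (h , v∈V)))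
    (sym (ℕ.*-identityˡ _))
  by-cases (no  v∉V) = χ-no (v ∈? (σ ∩ V)) (λ h → v∉V (proj₂ (Subset.x∈p∩q⁻ σ V h)))

∣∩∣-sum : ∀ {N} (σ V : Subset N) → ∣ σ ∩ V ∣ ≡ sumℕ (λ v → χ (v ∈? V) ℕ.* χ (v ∈? σ))
∣∩∣-sum σ V = trans (∣∣-sum (σ ∩ V)) (ℕ-sum.sum-cong-≋ (χ-∩ σ V))

sumℕ-mono : ∀ {n} {f g : Fin n → ℕ} → (∀ i → f i ℕ.≤ g i) → sumℕ f ℕ.≤ sumℕ g
sumℕ-mono {zero}  f≤g = ℕ.z≤n
sumℕ-mono {suc n} f≤g = ℕ.+-mono-≤ (f≤g zero) (sumℕ-mono (λ i → f≤g (suc i)))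

module Transversals {N n} (X : SimplicialComplex N) (U : Fin (suc n) → Subset N)
  (disjoint : ∀ {i j} → i ≢ j → ∀ {v} → v ∈ U i → v ∉ U j)
  where

  open Weights X n

  sizes : Subset N → List (Fin (suc n)) → List ℕ
  sizes σ = List.map (λ i → ∣ σ ∩ U i ∣)

  -- The number of ordered facets extending l by one vertex from each Uᵢ, i ∈ I.
  Aℕ : List (Fin N) → List (Fin (suc n)) → ℕ
  Aℕ l []      = wℕ l
  Aℕ l (i ∷ I) = sumℕ (λ v → χ (v ∈? U i) ℕ.* Aℕ (v ∷ l) I)

  over : List (Fin N) → Subset N → ℕ
  over l σ = χ (facet? σ ×-dec support l ⊆? σ)

  over-∷ : ∀ v l σ → over (v ∷ l) σ ≡ χ (v ∈? σ) ℕ.* over l σ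
  over-∷ v l σ = by-cases (v ∈? σ)
    where
    by-cases : (d : Dec (v ∈ σ)) → over (v ∷ l) σ ≡ χ d ℕ.* over l σ
    by-cases (yes v∈σ) = trans (χ-cong (facet? σ ×-dec support (v ∷ l) ⊆? σ) (facet? σ ×-dec support l ⊆? σ)
        (λ (f , h) → f , λ u∈ → h (Subset.q⊆p∪q ⁅ v ⁆ (support l) u∈)) (λ (f , h) → f , ∪-⊆ (⁅⁆-⊆ v∈σ) h))
      (sym (ℕ.*-identityˡ (over l σ)))
    by-cases (no v∉σ) = χ-no (facet? σ ×-dec support (v ∷ l) ⊆? σ)
      (λ (_ , h) → v∉σ (h (Subset.p⊆p∪q (support l) (Subset.x∈⁅x⁆ v))))

  -- Double counting: a facet σ over l is reached by choosing one vertex in each σ ∩ Uᵢ.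
  -- Disjointness keeps the chosen vertices distinct, and for complete lists the factorial in the
  -- weight is 0! = 1, so facets are counted with multiplicity one.
  Aℕ-facets : ∀ l I → Unique I → Distinct l → length l ℕ.+ length I ≡ suc n →
    (∀ {i v} → i List.∈ I → v ∈ U i → v ∉ support l) →
    Aℕ l I ≡ sumL (λ σ → over l σ ℕ.* listProduct (sizes σ I)) (subsets N)
  Aℕ-facets l [] _ d len _ = begin
    wℕ l
      ≡⟨ wℕ-distinct l d ⟩
    (suc n ℕ.∸ ∣ support l ∣) ! ℕ.* degree X n (support l)
      ≡⟨ cong (λ k → (suc n ℕ.∸ k) ! ℕ.* degree X n (support l)) (trans (∣support∣ d) (trans (sym (ℕ.+-identityʳ (length l))) len)) ⟩
    (n ℕ.∸ n) ! ℕ.* degree X n (support l)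
      ≡⟨ cong (λ k → k ! ℕ.* degree X n (support l)) (ℕ.n∸n≡0 n) ⟩
    1 ℕ.* degree X n (support l)
      ≡⟨ trans (ℕ.*-identityˡ _) (degree-sum (support l)) ⟩
    sumL (over l) (subsets N)
      ≡⟨ sumL-cong (λ σ → sym (ℕ.*-identityʳ (over l σ))) (subsets N) ⟩
    sumL (λ σ → over l σ ℕ.* 1) (subsets N) ∎
    where open ≡-Reasoning
  Aℕ-facets l (i ∷ I) (i∉I ∷ unique) d len apart = begin
    sumℕ (λ v → χ (v ∈? U i) ℕ.* Aℕ (v ∷ l) I)
      ≡⟨ ℕ-sum.sum-cong-≋ (λ v → trans (extend v (v ∈? U i)) (sym (sumL-*ˡ (χ (v ∈? U i)) _ (subsets N)))) ⟩
    sumℕ (λ v → sumL (λ σ → χ (v ∈? U i) ℕ.* (over (v ∷ l) σ ℕ.* P σ)) (subsets N))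
      ≡⟨ sumL-sumℕ (λ v σ → χ (v ∈? U i) ℕ.* (over (v ∷ l) σ ℕ.* P σ)) (subsets N) ⟨
    sumL (λ σ → sumℕ (λ v → χ (v ∈? U i) ℕ.* (over (v ∷ l) σ ℕ.* P σ))) (subsets N)
      ≡⟨ sumL-cong collect (subsets N) ⟩
    sumL (λ σ → over l σ ℕ.* (∣ σ ∩ U i ∣ ℕ.* P σ)) (subsets N) ∎
    where
    open ≡-Reasoning
    open ℕSolver.+-*-Solver
    P : Subset N → ℕ
    P σ = listProduct (sizes σ I)
    extend : ∀ v (e : Dec (v ∈ U i)) → χ e ℕ.* Aℕ (v ∷ l) I ≡ χ e ℕ.* sumL (λ σ → over (v ∷ l) σ ℕ.* P σ) (subsets N)
    extend v (no _)    = refl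
    extend v (yes v∈U) = cong (1 ℕ.*_) (Aℕ-facets (v ∷ l) I unique (apart (here refl) v∈U , d)
      (trans (sym (ℕ.+-suc (length l) (length I))) len)
      (λ {j} j∈I u∈U → ∪-∉ (λ u∈v → disjoint (All.lookup i∉I j∈I) v∈U (subst (_∈ U j) (Subset.x∈⁅y⁆⇒x≡y v u∈v) u∈U)) (apart (there j∈I) u∈U)))
    collect : ∀ σ → sumℕ (λ v → χ (v ∈? U i) ℕ.* (over (v ∷ l) σ ℕ.* P σ)) ≡ over l σ ℕ.* (∣ σ ∩ U i ∣ ℕ.* P σ)
    collect σ = begin
      sumℕ (λ v → χ (v ∈? U i) ℕ.* (over (v ∷ l) σ ℕ.* P σ))
        ≡⟨ ℕ-sum.sum-cong-≋ (λ v → trans (cong (λ k → χ (v ∈? U i) ℕ.* (k ℕ.* P σ)) (over-∷ v l σ))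
             (solve 4 (λ a b c d → a :* ((b :* c) :* d) := (a :* b) :* (c :* d)) refl (χ (v ∈? U i)) (χ (v ∈? σ)) (over l σ) (P σ))) ⟩
      sumℕ (λ v → χ (v ∈? U i) ℕ.* χ (v ∈? σ) ℕ.* (over l σ ℕ.* P σ))
        ≡⟨ ℕ-sum.*-distribʳ-sum (over l σ ℕ.* P σ) (λ v → χ (v ∈? U i) ℕ.* χ (v ∈? σ)) ⟨
      sumℕ (λ v → χ (v ∈? U i) ℕ.* χ (v ∈? σ)) ℕ.* (over l σ ℕ.* P σ)
        ≡⟨ cong (ℕ._* (over l σ ℕ.* P σ)) (∣∩∣-sum σ (U i)) ⟨
      ∣ σ ∩ U i ∣ ℕ.* (over l σ ℕ.* P σ)
        ≡⟨ solve 3 (λ a b c → a :* (b :* c) := b :* (a :* c)) refl (∣ σ ∩ U i ∣) (over l σ) (P σ) ⟩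
      over l σ ℕ.* (∣ σ ∩ U i ∣ ℕ.* P σ) ∎

  memberships-≤1 : ∀ v {I} → Unique I → sumL (λ i → χ (v ∈? U i)) I ℕ.≤ 1
  memberships-≤1 v []                              = ℕ.z≤n
  memberships-≤1 v {i ∷ I} (i∉I ∷ unique) = by-cases (v ∈? U i)
    where
    none : ∀ J → v ∈ U i → All (i ≢_) J → sumL (λ j → χ (v ∈? U j)) J ≡ 0
    none []      v∈U []         = refl
    none (j ∷ J) v∈U (i≢j ∷ i≢) = cong₂ ℕ._+_ (χ-no (v ∈? U j) (disjoint i≢j v∈U)) (none J v∈U i≢)
    by-cases : (e : Dec (v ∈ U i)) → χ e ℕ.+ sumL (λ i → χ (v ∈? U i)) I ℕ.≤ 1
    by-cases (no  _)   = memberships-≤1 v unique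
    by-cases (yes v∈U) = ℕ.≤-reflexive (cong suc (none I v∈U i∉I))

  sum-sizes-≤ : ∀ σ {I} → Unique I → listSum (sizes σ I) ℕ.≤ ∣ σ ∣
  sum-sizes-≤ σ {I} unique = begin
    sumL (λ i → ∣ σ ∩ U i ∣) I
      ≡⟨ sumL-cong (λ i → trans (∣∩∣-sum σ (U i)) (ℕ-sum.sum-cong-≋ (λ v → ℕ.*-comm (χ (v ∈? U i)) (χ (v ∈? σ))))) I ⟩
    sumL (λ i → sumℕ (λ v → χ (v ∈? σ) ℕ.* χ (v ∈? U i))) I
      ≡⟨ sumL-sumℕ (λ v i → χ (v ∈? σ) ℕ.* χ (v ∈? U i)) I ⟩
    sumℕ (λ v → sumL (λ i → χ (v ∈? σ) ℕ.* χ (v ∈? U i)) I)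
      ≤⟨ sumℕ-mono (λ v → ℕ.≤-trans (ℕ.≤-reflexive (sumL-*ˡ (χ (v ∈? σ)) (λ i → χ (v ∈? U i)) I))
           (ℕ.≤-trans (ℕ.*-monoʳ-≤ (χ (v ∈? σ)) (memberships-≤1 v unique)) (ℕ.≤-reflexive (ℕ.*-identityʳ _)))) ⟩
    sumℕ (λ v → χ (v ∈? σ))
      ≡⟨ ∣∣-sum σ ⟨
    ∣ σ ∣ ∎
    where open ℕ.≤-Reasoning

  -- The freedom to order the indices lets the error be measured by any chosen pair Uᵢ, Uⱼ.
  #Transversal≡Aℕ : ∀ {I} → I ↭ allFin (suc n) → #Transversal X U ≡ Aℕ [] I
  #Transversal≡Aℕ {I} I↭ = begin
    #Transversal X U
      ≡⟨ length-filter (λ σ → facet? σ ×-dec Fin.all? (λ i → ∣ σ ∩ U i ∣ ℕ.≟ 1)) (subsets N) ⟩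
    sumL (λ σ → χ (facet? σ ×-dec Fin.all? (λ i → ∣ σ ∩ U i ∣ ℕ.≟ 1))) (subsets N)
      ≡⟨ sumL-cong per-facet (subsets N) ⟩
    sumL (λ σ → over [] σ ℕ.* listProduct (sizes σ I)) (subsets N)
      ≡⟨ Aℕ-facets [] I unique tt length-I (λ _ _ → Subset.∉⊥) ⟨
    Aℕ [] I ∎
    where
    open ≡-Reasoning
    unique : Unique I
    unique = unique-resp-↭ (↭-sym I↭) (Unique.allFin⁺ (suc n))
    length-I : length I ≡ suc n
    length-I = trans (Perm.↭-length I↭) (List.length-tabulate {n = suc n} (λ i → i))
    per-facet : ∀ σ → χ (facet? σ ×-dec Fin.all? (λ i → ∣ σ ∩ U i ∣ ℕ.≟ 1)) ≡ over [] σ ℕ.* listProduct (sizes σ I)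
    per-facet σ = by-cases (facet? σ)
      where
      transversal? : Dec ((X ⟨ suc n ⟩) σ × ∀ i → ∣ σ ∩ U i ∣ ≡ 1)
      transversal? = facet? σ ×-dec Fin.all? (λ i → ∣ σ ∩ U i ∣ ℕ.≟ 1)
      by-cases : Dec ((X ⟨ suc n ⟩) σ) → χ transversal? ≡ over [] σ ℕ.* listProduct (sizes σ I)
      by-cases (no ¬facet) = trans (χ-no transversal? (λ (f , _) → ¬facet f))
        (sym (cong (ℕ._* listProduct (sizes σ I)) (χ-no (facet? σ ×-dec support [] ⊆? σ) (λ (f , _) → ¬facet f))))
      by-cases (yes facet) = trans (product-case (sum≤length⇒product (sizes σ I) tight))
        (sym (trans (cong (ℕ._* listProduct (sizes σ I))
          (χ-yes (facet? σ ×-dec support [] ⊆? σ) (facet , λ u∈ → ⊥-elim (Subset.∉⊥ u∈)))) (ℕ.*-identityˡ _)))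
        where
        tight : listSum (sizes σ I) ℕ.≤ length (sizes σ I)
        tight = ℕ.≤-trans (sum-sizes-≤ σ unique) (ℕ.≤-reflexive (trans (proj₂ facet)
          (sym (trans (List.length-map (λ i → ∣ σ ∩ U i ∣) I) length-I))))
        all-ones : (∀ i → ∣ σ ∩ U i ∣ ≡ 1) → All (_≡ 1) (sizes σ I)
        all-ones h = All.map⁺ (All.tabulate (λ {i} _ → h i))
        product-case : listProduct (sizes σ I) ≡ 0 ⊎ All (_≡ 1) (sizes σ I) → χ transversal? ≡ listProduct (sizes σ I)
        product-case (inj₁ ≡0) = trans (χ-no transversal? (λ (_ , h) → ℕ.1+n≢0 (trans (sym (product-ones (all-ones h))) ≡0))) (sym ≡0)
        product-case (inj₂ ones) = trans
          (χ-yes transversal? (facet , λ i → All.lookup (All.map⁻ ones) (Perm.∈-resp-↭ (↭-sym I↭) (List.∈-allFin i))))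
          (sym (product-ones ones))

-- The total weight, counted by vertices and by facets

_≟ˢ_ : ∀ {N} (σ τ : Subset N) → Dec (σ ≡ τ)
_≟ˢ_ = Vec.≡-dec Bool._≟_

sumL-++ : ∀ {A : Set} (f : A → ℕ) xs ys → sumL f (xs List.++ ys) ≡ sumL f xs ℕ.+ sumL f ys
sumL-++ f xs ys = trans (cong listSum (List.map-++ f xs ys)) (ListAction.sum-++ (List.map f xs) (List.map f ys))

sumL-map : ∀ {A B : Set} (f : B → ℕ) (g : A → B) xs → sumL f (List.map g xs) ≡ sumL (f ∘ g) xs
sumL-map f g xs = cong listSum (sym (List.map-∘ xs))

sumL-zero : ∀ {A : Set} {f : A → ℕ} → (∀ x → f x ≡ 0) → ∀ xs → sumL f xs ≡ 0
sumL-zero eq []       = refl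
sumL-zero eq (x ∷ xs) = cong₂ ℕ._+_ (eq x) (sumL-zero eq xs)

subsets-once : ∀ {N} (τ : Subset N) → sumL (λ σ → χ (σ ≟ˢ τ)) (subsets N) ≡ 1
subsets-once []      = refl
subsets-once {suc N} (s ∷ τ) = trans (sumL-++ _ (List.map (outside ∷_) (subsets N)) (List.map (inside ∷_) (subsets N)))
  (trans (cong₂ ℕ._+_ (sumL-map _ (outside ∷_) (subsets N)) (sumL-map _ (inside ∷_) (subsets N))) (split s))
  where
  same : ∀ s → sumL (λ σ → χ ((s ∷ σ) ≟ˢ (s ∷ τ))) (subsets N) ≡ 1
  same s = trans (sumL-cong (λ σ → χ-cong ((s ∷ σ) ≟ˢ (s ∷ τ)) (σ ≟ˢ τ) Vec.∷-injectiveʳ (cong (s ∷_))) (subsets N)) (subsets-once τ)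
  other : ∀ s s′ → s ≢ s′ → sumL (λ σ → χ ((s ∷ σ) ≟ˢ (s′ ∷ τ))) (subsets N) ≡ 0
  other s s′ s≢s′ = sumL-zero (λ σ → χ-no ((s ∷ σ) ≟ˢ (s′ ∷ τ)) (λ eq → s≢s′ (Vec.∷-injectiveˡ eq))) (subsets N)
  split : ∀ s → sumL (λ σ → χ ((outside ∷ σ) ≟ˢ (s ∷ τ))) (subsets N) ℕ.+ sumL (λ σ → χ ((inside ∷ σ) ≟ˢ (s ∷ τ))) (subsets N) ≡ 1
  split outside = cong₂ ℕ._+_ (same outside) (other inside outside (λ ()))
  split inside  = cong₂ ℕ._+_ (other outside inside (λ ())) (same inside)

singleton : ∀ {N} {σ : Subset N} {v} → ∣ σ ∣ ≡ 1 → v ∈ σ → σ ≡ ⁅ v ⁆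
singleton {σ = σ} {v} ∣σ∣≡1 v∈σ = Subset.⊆-antisym (λ {u} u∈σ → at u u∈σ (u ∈? ⁅ v ⁆)) (⁅⁆-⊆ v∈σ)
  where
  at : ∀ u → u ∈ σ → Dec (u ∈ ⁅ v ⁆) → u ∈ ⁅ v ⁆
  at u u∈σ (yes u∈v) = u∈v
  at u u∈σ (no  u∉v) = ⊥-elim (ℕ.1+n≰n (ℕ.≤-trans
    (ℕ.≤-reflexive (sym (trans (∣⁅v⁆∪τ∣ u∉v) (cong suc (Subset.∣⁅x⁆∣≡1 v)))))
    (ℕ.≤-trans (Subset.p⊆q⇒∣p∣≤∣q∣ (∪-⊆ (⁅⁆-⊆ u∈σ) (⁅⁆-⊆ v∈σ))) (ℕ.≤-reflexive ∣σ∣≡1))))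

module Counts {N} (X : SimplicialComplex N) (n K : ℕ) (regular : Regular X n K) where

  open Weights X n

  vertex? : ∀ v → Dec (IsVertex X v)
  vertex? v = (X ⟨ 1 ⟩?) ⁅ v ⁆

  ⁅v⁆∪∅ : ∀ (v : Fin N) → support (v ∷ []) ≡ ⁅ v ⁆
  ⁅v⁆∪∅ v = Subset.∪-identityʳ ⁅ v ⁆

  w-vertex : ∀ v → IsVertex X v → wℕ (v ∷ []) ≡ n ! ℕ.* K
  w-vertex v vertex = trans (wℕ-distinct (v ∷ []) (Subset.∉⊥ , tt)) (trans (cong (weight X n) (⁅v⁆∪∅ v))
    (cong₂ (λ k d → (suc n ℕ.∸ k) ! ℕ.* d) (Subset.∣⁅x⁆∣≡1 v) (regular v vertex)))

  w-nonvertex : ∀ v → ¬ IsVertex X v → wℕ (v ∷ []) ≡ 0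
  w-nonvertex v ¬vertex = from-dec (wℕ (v ∷ []) ℕ.≟ 0)
    where
    from-dec : Dec (wℕ (v ∷ []) ≡ 0) → wℕ (v ∷ []) ≡ 0
    from-dec (yes eq) = eq
    from-dec (no ≢0)  = ⊥-elim (¬vertex
      (subst (Simplex X) (⁅v⁆∪∅ v) (proj₂ (wℕ≢0⇒simplex {v ∷ []} ≢0)) , Subset.∣⁅x⁆∣≡1 v))

  w[]-facets : wℕ [] ≡ suc n ! ℕ.* count (X ⟨ suc n ⟩?)
  w[]-facets = trans (wℕ-distinct [] tt) (cong₂ (λ k d → (suc n ℕ.∸ k) ! ℕ.* d) (Subset.∣⊥∣≡0 N)
    (trans (degree-sum ∅) (sym (trans (length-filter facet? (subsets N)) (sumL-cong
      (λ σ → χ-cong (facet? σ) (facet? σ ×-dec ∅ ⊆? σ) (λ f → f , λ u∈ → ⊥-elim (Subset.∉⊥ u∈)) proj₁) (subsets N))))))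

  #X₀-sum : count (X ⟨ 1 ⟩?) ≡ sumℕ (λ v → χ (vertex? v))
  #X₀-sum = begin
    count (X ⟨ 1 ⟩?)
      ≡⟨ length-filter (X ⟨ 1 ⟩?) (subsets N) ⟩
    sumL (λ σ → χ ((X ⟨ 1 ⟩?) σ)) (subsets N)
      ≡⟨ sumL-cong (λ σ → by-size σ ((X ⟨ 1 ⟩?) σ)) (subsets N) ⟩
    sumL (λ σ → sumℕ (λ v → χ ((X ⟨ 1 ⟩?) σ) ℕ.* χ (v ∈? σ))) (subsets N)
      ≡⟨ sumL-sumℕ (λ v σ → χ ((X ⟨ 1 ⟩?) σ) ℕ.* χ (v ∈? σ)) (subsets N) ⟩
    sumℕ (λ v → sumL (λ σ → χ ((X ⟨ 1 ⟩?) σ) ℕ.* χ (v ∈? σ)) (subsets N))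
      ≡⟨ ℕ-sum.sum-cong-≋ (λ v → trans (sumL-cong (λ σ → is-singleton v σ (σ ≟ˢ ⁅ v ⁆)) (subsets N))
           (trans (sumL-*ˡ (χ (vertex? v)) (λ σ → χ (σ ≟ˢ ⁅ v ⁆)) (subsets N))
             (trans (cong (χ (vertex? v) ℕ.*_) (subsets-once ⁅ v ⁆)) (ℕ.*-identityʳ _)))) ⟩
    sumℕ (λ v → χ (vertex? v)) ∎
    where
    open ≡-Reasoning
    by-size : ∀ σ (d : Dec ((X ⟨ 1 ⟩) σ)) → χ d ≡ sumℕ (λ v → χ d ℕ.* χ (v ∈? σ))
    by-size σ (no _)              = sym (sumℕ-zero {f = λ v → 0 ℕ.* χ (v ∈? σ)} (λ _ → refl))
    by-size σ (yes (_ , ∣σ∣≡1)) = sym (trans (sym (ℕ-sum.*-distribˡ-sum 1 (λ v → χ (v ∈? σ))))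
      (trans (ℕ.*-identityˡ _) (trans (sym (∣∣-sum σ)) ∣σ∣≡1)))
    is-singleton : ∀ v σ (e : Dec (σ ≡ ⁅ v ⁆)) → χ ((X ⟨ 1 ⟩?) σ) ℕ.* χ (v ∈? σ) ≡ χ (vertex? v) ℕ.* χ e
    is-singleton v σ (yes refl) = cong (χ (vertex? v) ℕ.*_) (χ-yes (v ∈? ⁅ v ⁆) (Subset.x∈⁅x⁆ v))
    is-singleton v σ (no σ≢v)   = trans (by-cases ((X ⟨ 1 ⟩?) σ) (v ∈? σ)) (sym (ℕ.*-zeroʳ (χ (vertex? v))))
      where
      by-cases : (d : Dec ((X ⟨ 1 ⟩) σ)) (e : Dec (v ∈ σ)) → χ d ℕ.* χ e ≡ 0
      by-cases (no _)              _         = refl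
      by-cases (yes _)             (no _)    = refl
      by-cases (yes (_ , ∣σ∣≡1)) (yes v∈σ) = ⊥-elim (σ≢v (singleton ∣σ∣≡1 v∈σ))

  -- By regularity every vertex has weight n!·K. Compared with `w[]-facets` this gives |X(0)|·n!·K =
  -- (n+1)!·|X(n)|, the relation between the two normalisations in the theorem.
  w[]-vertices : wℕ [] ≡ count (X ⟨ 1 ⟩?) ℕ.* (n ! ℕ.* K)
  w[]-vertices = trans (wℕ-marginal [] ℕ.z≤n) (trans
    (ℕ-sum.sum-cong-≋ (λ v → by-cases v (vertex? v)))
    (trans (sym (ℕ-sum.*-distribʳ-sum (n ! ℕ.* K) (λ v → χ (vertex? v)))) (cong (ℕ._* (n ! ℕ.* K)) (sym #X₀-sum))))
    where
    by-cases : ∀ v (d : Dec (IsVertex X v)) → wℕ (v ∷ []) ≡ χ d ℕ.* (n ! ℕ.* K)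
    by-cases v (yes vertex) = trans (w-vertex v vertex) (sym (ℕ.*-identityˡ _))
    by-cases v (no ¬vertex) = w-nonvertex v ¬vertex

-- The two inequalities over the rationals

inv-homo : ∀ a b → inv (a ℕ.* b) ≡ inv a ℚ.* inv b
inv-homo zero    b       = sym (ℚ.*-zeroˡ (inv b))
inv-homo (suc a) zero    = trans (cong inv (ℕ.*-zeroʳ (suc a))) (sym (ℚ.*-zeroʳ (inv (suc a))))
inv-homo (suc a) (suc b) = begin
  inv ab
    ≡⟨ trans (cong₂ (λ x y → inv ab ℚ.* (x ℚ.* y)) (inv-* {suc a} (λ ())) (inv-* {suc b} (λ ()))) (ℚ.*-identityʳ (inv ab)) ⟨
  inv ab ℚ.* (inv (suc a) ℚ.* ι (suc a) ℚ.* (inv (suc b) ℚ.* ι (suc b)))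
    ≡⟨ solve 5 (λ i x y z w → i :* (x :* y :* (z :* w)) := i :* (y :* w) :* (x :* z)) refl
         (inv ab) (inv (suc a)) (ι (suc a)) (inv (suc b)) (ι (suc b)) ⟩
  inv ab ℚ.* (ι (suc a) ℚ.* ι (suc b)) ℚ.* (inv (suc a) ℚ.* inv (suc b))
    ≡⟨ cong (λ z → inv ab ℚ.* z ℚ.* (inv (suc a) ℚ.* inv (suc b))) (sym (ι-* (suc a) (suc b))) ⟩
  inv ab ℚ.* ι ab ℚ.* (inv (suc a) ℚ.* inv (suc b))
    ≡⟨ trans (cong (ℚ._* (inv (suc a) ℚ.* inv (suc b))) (inv-* {ab} (λ ()))) (ℚ.*-identityˡ _) ⟩
  inv (suc a) ℚ.* inv (suc b) ∎
  where
  open ≡-Reasoning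
  open ℚSolver.+-*-Solver
  ab : ℕ
  ab = suc a ℕ.* suc b

-- The order has the shape required by `independence`: y stands in front and is never peeled off, x
-- comes last and is peeled off first.
two-first : ∀ {A : Set} {xs : List A} {x y : A} → x ≢ y → x List.∈ xs → y List.∈ xs →
  ∃[ zs ] (y ∷ reverse (x ∷ zs)) ↭ xs
two-first {xs = xs} {x} {y} x≢y x∈ y∈ = from-split (List.∈-∃++ y∈)
  where
  from-split : (∃[ us ] ∃[ vs ] xs ≡ us List.++ y ∷ vs) → ∃[ zs ] (y ∷ reverse (x ∷ zs)) ↭ xs
  from-split (us , vs , refl) = from-split′ (List.∈-∃++ (x∈rest (Perm.∈-resp-↭ (Perm.shift y us vs) x∈)))
    where
    x∈rest : x List.∈ (y ∷ us List.++ vs) → x List.∈ (us List.++ vs)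
    x∈rest (here x≡y) = ⊥-elim (x≢y x≡y)
    x∈rest (there p)  = p
    from-split′ : (∃[ us′ ] ∃[ vs′ ] us List.++ vs ≡ us′ List.++ x ∷ vs′) → _
    from-split′ (us′ , vs′ , eq) = us′ List.++ vs′ , ↭-trans
      (prep y (↭-trans (Perm.↭-reverse (x ∷ us′ List.++ vs′))
        (↭-trans (↭-sym (Perm.shift x us′ vs′)) (↭-reflexive (sym eq)))))
      (↭-sym (Perm.shift y us vs))

-- `c` stands for n!·K and `f` for (n+1)!; these numbers and the two counts enter only through the
-- last three equations.
module RationalBound {N n : ℕ} (X : SimplicialComplex N) (pure : Pure X n) (connected : ConnectedLinks X n) (lam : ℝ) (0<lam : 0ℝ <ℝ lam)
  (spectrum : ∀ k τ → k ℕ.< n → ((τ∈X , _) : (X ⟨ k ⟩) τ) →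
     ∀ μ → InSpec X n τ∈X μ → ((-ℝ lam) ≤ℝ μ × μ ≤ℝ lam) ⊎ (μ ≃ 1ℝ))
  (U : Fin (suc n) → Subset N) (vertices : ∀ i v → v ∈ U i → IsVertex X v)
  (disjoint : ∀ i j → i ≢ j → Empty (U i ∩ U j))
  (#X₀ #Xₙ c f : ℕ) (w-vertex : ∀ v → IsVertex X v → Weights.wℕ X n (v ∷ []) ≡ c)
  (w[]-vertices : Weights.wℕ X n [] ≡ #X₀ ℕ.* c) (w[]-facets : Weights.wℕ X n [] ≡ f ℕ.* #Xₙ)
  where

  open Weights X n
  open Transversals X U (λ {i} {j} i≢j v∈i v∈j → disjoint i j i≢j (_ , Subset.x∈p∩q⁺ (v∈i , v∈j)))
  open ℚSolver.+-*-Solver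

  w[]≢0 : wℕ [] ≢ 0
  w[]≢0 = simplex⇒wℕ≢0 pure {[]} tt (∅-simp X)

  c≢0 : c ≢ 0
  c≢0 c≡0 = w[]≢0 (trans w[]-vertices (trans (cong (#X₀ ℕ.*_) c≡0) (ℕ.*-zeroʳ #X₀)))

  #X₀≢0 : #X₀ ≢ 0
  #X₀≢0 #X₀≡0 = w[]≢0 (trans w[]-vertices (cong (ℕ._* c) #X₀≡0))

  #Xₙ≢0 : #Xₙ ≢ 0
  #Xₙ≢0 #Xₙ≡0 = w[]≢0 (trans w[]-facets (trans (cong (f ℕ.*_) #Xₙ≡0) (ℕ.*-zeroʳ (f))))

  𝟙 : Fin (suc n) → Fin N → ℚ
  𝟙 i v = ι (χ (v ∈? U i))

  𝟙-indicator : ∀ i → Indicator (𝟙 i)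
  𝟙-indicator i v = by-cases (v ∈? U i)
    where
    by-cases : (d : Dec (v ∈ U i)) → ι (χ d) ≡ 0ℚ ⊎ ι (χ d) ≡ 1ℚ
    by-cases (yes _) = inj₂ refl
    by-cases (no _)  = inj₁ refl

  error : ℚ
  error = ι (#Transversal X U) ℚ.- ι c ℚ.* inv (#X₀ ℕ.^ n) ℚ.* ι ∏∣ U ∣

  module _ {t : ℚ} (lam<t : lam <ℝ fromℚ t) {p q : ℚ} (0≤p : 0ℚ ℚ.≤ p) (0≤q : 0ℚ ℚ.≤ q) (pq≡1 : p ℚ.* q ≡ 1ℚ) where

    private
      module M = Mixing n wℕ wℕ-marginal wℕ-swap (½ ℚ.* t) p q
        (ℚ.<⇒≤ (halve (between-positive lam 0<lam lam<t))) 0≤p 0≤q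
        (Links.Local.local X n pure connected lam 0<lam spectrum t lam<t 0≤p pq≡1)

    A≡ιAℕ : ∀ l I → M.A l (List.map 𝟙 I) ≡ ι (Aℕ l I)
    A≡ιAℕ l []      = refl
    A≡ιAℕ l (i ∷ I) = trans
      (ℚ-ring.sum-cong-≋ (λ v → trans (cong (𝟙 i v ℚ.*_) (A≡ιAℕ (v ∷ l) I)) (sym (ι-* (χ (v ∈? U i)) (Aℕ (v ∷ l) I)))))
      (sym (ι-sum (λ v → χ (v ∈? U i) ℕ.* Aℕ (v ∷ l) I)))

    m-𝟙 : ∀ i → M.m [] (𝟙 i) ≡ ι ∣ U i ∣ ℚ.* ι c
    m-𝟙 i = trans (A≡ιAℕ [] (i ∷ [])) (trans (cong ι (begin
      sumℕ (λ v → χ (v ∈? U i) ℕ.* wℕ (v ∷ []))  ≡⟨ ℕ-sum.sum-cong-≋ (λ v → by-cases v (v ∈? U i)) ⟩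
      sumℕ (λ v → χ (v ∈? U i) ℕ.* c)             ≡⟨ ℕ-sum.*-distribʳ-sum c (λ v → χ (v ∈? U i)) ⟨
      sumℕ (λ v → χ (v ∈? U i)) ℕ.* c             ≡⟨ cong (ℕ._* c) (∣∣-sum (U i)) ⟨
      ∣ U i ∣ ℕ.* c                                 ∎)) (ι-* ∣ U i ∣ c))
      where
      open ≡-Reasoning
      by-cases : ∀ v (d : Dec (v ∈ U i)) → χ d ℕ.* wℕ (v ∷ []) ≡ χ d ℕ.* c
      by-cases v (no _)    = refl
      by-cases v (yes v∈U) = cong (1 ℕ.*_) (w-vertex v (vertices i v v∈U))

    density : ∀ J → M.density (List.map 𝟙 J) ≡ inv (#X₀ ℕ.^ length J) ℚ.* ι (listProduct (List.map (λ i → ∣ U i ∣) J))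
    density []      = refl
    density (j ∷ J) = begin
      inv (wℕ []) ℚ.* M.m [] (𝟙 j) ℚ.* M.density (List.map 𝟙 J)
        ≡⟨ cong₂ (λ i d → i ℚ.* M.m [] (𝟙 j) ℚ.* d) (trans (cong inv w[]-vertices) (inv-homo #X₀ c)) (density J) ⟩
      inv #X₀ ℚ.* inv c ℚ.* M.m [] (𝟙 j) ℚ.* (inv (#X₀ ℕ.^ length J) ℚ.* P)
        ≡⟨ cong (λ m → inv #X₀ ℚ.* inv c ℚ.* m ℚ.* (inv (#X₀ ℕ.^ length J) ℚ.* P)) (m-𝟙 j) ⟩
      inv #X₀ ℚ.* inv c ℚ.* (ι ∣ U j ∣ ℚ.* ι c) ℚ.* (inv (#X₀ ℕ.^ length J) ℚ.* P)
        ≡⟨ solve 6 (λ x i s c y P → x :* i :* (s :* c) :* (y :* P) := (i :* c) :* ((x :* y) :* (s :* P))) refl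
             (inv #X₀) (inv c) (ι ∣ U j ∣) (ι c) (inv (#X₀ ℕ.^ length J)) P ⟩
      inv c ℚ.* ι c ℚ.* (inv #X₀ ℚ.* inv (#X₀ ℕ.^ length J) ℚ.* (ι ∣ U j ∣ ℚ.* P))
        ≡⟨ trans (cong (ℚ._* (inv #X₀ ℚ.* inv (#X₀ ℕ.^ length J) ℚ.* (ι ∣ U j ∣ ℚ.* P))) (inv-* c≢0)) (ℚ.*-identityˡ _) ⟩
      inv #X₀ ℚ.* inv (#X₀ ℕ.^ length J) ℚ.* (ι ∣ U j ∣ ℚ.* P)
        ≡⟨ cong₂ ℚ._*_ (sym (inv-homo #X₀ (#X₀ ℕ.^ length J))) (sym (ι-* ∣ U j ∣ (listProduct (List.map (λ i → ∣ U i ∣) J)))) ⟩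
      inv (#X₀ ℕ.^ suc (length J)) ℚ.* ι (∣ U j ∣ ℕ.* listProduct (List.map (λ i → ∣ U i ∣) J)) ∎
      where
      open ≡-Reasoning
      P : ℚ
      P = ι (listProduct (List.map (λ i → ∣ U i ∣) J))

    error-bound : ∀ {i j} → i ≢ j →
      ℚ.∣ error ∣ ℚ.≤ ι (triangle n) ℚ.* ι c ℚ.* (½ ℚ.* t ℚ.* (p ℚ.* ι ∣ U i ∣ ℚ.+ q ℚ.* ι ∣ U j ∣))
    error-bound {i} {j} i≢j = from-order (two-first i≢j (List.∈-allFin i) (List.∈-allFin j))
      where
      from-order : (∃[ zs ] (j ∷ reverse (i ∷ zs)) ↭ allFin (suc n)) →
        ℚ.∣ error ∣ ℚ.≤ ι (triangle n) ℚ.* ι c ℚ.* (½ ℚ.* t ℚ.* (p ℚ.* ι ∣ U i ∣ ℚ.+ q ℚ.* ι ∣ U j ∣))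
      from-order (zs , order) = begin
        ℚ.∣ error ∣
          ≡⟨ cong ℚ.∣_∣ (cong₂ ℚ._-_ (sym main) (sym expected)) ⟩
        ℚ.∣ M.A [] (𝟙 j ∷ reverse hs) ℚ.- M.m [] (𝟙 j) ℚ.* M.density hs ∣
          ≤⟨ M.independence (𝟙-indicator j) (All.map⁺ (All.tabulate {xs = i ∷ zs} (λ {k} _ → 𝟙-indicator k)))
               (ℕ.≤-reflexive len-hs) w[]≢0 ⟩
        ι (triangle (length hs)) ℚ.* (½ ℚ.* t ℚ.* (p ℚ.* M.m [] (𝟙 i) ℚ.+ q ℚ.* M.m [] (𝟙 j)))
          ≡⟨ cong₂ (λ k z → ι (triangle k) ℚ.* (½ ℚ.* t ℚ.* z)) len-hs
               (cong₂ (λ x y → p ℚ.* x ℚ.+ q ℚ.* y) (m-𝟙 i) (m-𝟙 j)) ⟩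
        ι (triangle n) ℚ.* (½ ℚ.* t ℚ.* (p ℚ.* (ι ∣ U i ∣ ℚ.* ι c) ℚ.+ q ℚ.* (ι ∣ U j ∣ ℚ.* ι c)))
          ≡⟨ solve 7 (λ T h p x q y c → T :* (h :* (p :* (x :* c) :+ q :* (y :* c))) := T :* c :* (h :* (p :* x :+ q :* y))) refl
               (ι (triangle n)) (½ ℚ.* t) p (ι ∣ U i ∣) q (ι ∣ U j ∣) (ι c) ⟩
        ι (triangle n) ℚ.* ι c ℚ.* (½ ℚ.* t ℚ.* (p ℚ.* ι ∣ U i ∣ ℚ.+ q ℚ.* ι ∣ U j ∣)) ∎
        where
        open ℚ.≤-Reasoning
        hs : List (Fin N → ℚ)
        hs = List.map 𝟙 (i ∷ zs)
        len-zs : length (i ∷ zs) ≡ n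
        len-zs = ℕ.suc-injective (trans (cong suc (sym (List.length-reverse (i ∷ zs))))
          (trans (Perm.↭-length order) (List.length-tabulate {n = suc n} (λ i → i))))
        len-hs : length hs ≡ n
        len-hs = trans (List.length-map 𝟙 (i ∷ zs)) len-zs
        main : M.A [] (𝟙 j ∷ reverse hs) ≡ ι (#Transversal X U)
        main = trans (cong (λ fs → M.A [] (𝟙 j ∷ fs)) (sym (List.reverse-map 𝟙 (i ∷ zs))))
          (trans (A≡ιAℕ [] (j ∷ reverse (i ∷ zs))) (cong ι (sym (#Transversal≡Aℕ order))))
        product≡ : ∣ U j ∣ ℕ.* listProduct (List.map (λ i → ∣ U i ∣) (i ∷ zs)) ≡ ∏∣ U ∣
        product≡ = trans (cong (∣ U j ∣ ℕ.*_) (ListAction.product-↭ (Perm.map⁺ (λ i → ∣ U i ∣) (↭-sym (Perm.↭-reverse (i ∷ zs))))))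
          (ListAction.product-↭ (Perm.map⁺ (λ i → ∣ U i ∣) order))
        expected : M.m [] (𝟙 j) ℚ.* M.density hs ≡ ι c ℚ.* inv (#X₀ ℕ.^ n) ℚ.* ι ∏∣ U ∣
        expected = trans (cong₂ ℚ._*_ (m-𝟙 j) (density (i ∷ zs))) (trans
          (solve 4 (λ s c x P → s :* c :* (x :* P) := c :* x :* (s :* P)) refl
            (ι ∣ U j ∣) (ι c) (inv (#X₀ ℕ.^ length (i ∷ zs))) (ι (listProduct (List.map (λ i → ∣ U i ∣) (i ∷ zs)))))
          (cong₂ (λ k z → ι c ℚ.* inv (#X₀ ℕ.^ k) ℚ.* z) len-zs
            (trans (sym (ι-* ∣ U j ∣ (listProduct (List.map (λ i → ∣ U i ∣) (i ∷ zs))))) (cong ι product≡))))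

  deviation₁≡ : #Transversal X U ÷ 1 ℚ.- (c ÷ (#X₀ ℕ.^ n)) ℚ.* (∏∣ U ∣ ÷ 1) ≡ error
  deviation₁≡ = cong (λ z → ι (#Transversal X U) ℚ.- z ℚ.* ι ∏∣ U ∣) (÷≡ c (#X₀ ℕ.^ n))

  -- The two values of the total weight, divided by both counts. It turns the first deviation,
  -- divided by |X(n)|, into the second one.
  rescale : ι (f) ℚ.* inv #X₀ ≡ inv #Xₙ ℚ.* ι c
  rescale = begin
    ι (f) ℚ.* inv #X₀
      ≡⟨ trans (cong (ι (f) ℚ.* inv #X₀ ℚ.*_) (inv-* #Xₙ≢0)) (ℚ.*-identityʳ _) ⟨
    ι (f) ℚ.* inv #X₀ ℚ.* (inv #Xₙ ℚ.* ι #Xₙ)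
      ≡⟨ solve 4 (λ f x i y → f :* x :* (i :* y) := x :* i :* (f :* y)) refl (ι (f)) (inv #X₀) (inv #Xₙ) (ι #Xₙ) ⟩
    inv #X₀ ℚ.* inv #Xₙ ℚ.* (ι (f) ℚ.* ι #Xₙ)
      ≡⟨ cong (inv #X₀ ℚ.* inv #Xₙ ℚ.*_) (trans (sym (ι-* (f) #Xₙ))
           (trans (cong ι (trans (sym w[]-facets) w[]-vertices)) (ι-* #X₀ c))) ⟩
    inv #X₀ ℚ.* inv #Xₙ ℚ.* (ι #X₀ ℚ.* ι c)
      ≡⟨ solve 4 (λ i j x c → i :* j :* (x :* c) := (i :* x) :* (j :* c)) refl (inv #X₀) (inv #Xₙ) (ι #X₀) (ι c) ⟩
    inv #X₀ ℚ.* ι #X₀ ℚ.* (inv #Xₙ ℚ.* ι c)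
      ≡⟨ trans (cong (ℚ._* (inv #Xₙ ℚ.* ι c)) (inv-* #X₀≢0)) (ℚ.*-identityˡ _) ⟩
    inv #Xₙ ℚ.* ι c ∎
    where open ≡-Reasoning

  deviation₂≡ : #Transversal X U ÷ #Xₙ ℚ.- (f ÷ 1) ℚ.* (∏∣ U ∣ ÷ (#X₀ ℕ.^ suc n)) ≡ inv #Xₙ ℚ.* error
  deviation₂≡ = begin
    #Transversal X U ÷ #Xₙ ℚ.- ι (f) ℚ.* (∏∣ U ∣ ÷ (#X₀ ℕ.^ suc n))
      ≡⟨ cong₂ (λ x y → x ℚ.- ι (f) ℚ.* y) (÷≡ (#Transversal X U) #Xₙ)
           (trans (÷≡ ∏∣ U ∣ (#X₀ ℕ.^ suc n)) (cong (ι ∏∣ U ∣ ℚ.*_) (inv-homo #X₀ (#X₀ ℕ.^ n)))) ⟩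
    T ℚ.* inv #Xₙ ℚ.- ι (f) ℚ.* (P ℚ.* (inv #X₀ ℚ.* inv (#X₀ ℕ.^ n)))
      ≡⟨ solve 6 (λ T i f P x y → T :* i :- f :* (P :* (x :* y)) := T :* i :- (f :* x) :* (P :* y)) refl
           T (inv #Xₙ) (ι (f)) P (inv #X₀) (inv (#X₀ ℕ.^ n)) ⟩
    T ℚ.* inv #Xₙ ℚ.- (ι (f) ℚ.* inv #X₀) ℚ.* (P ℚ.* inv (#X₀ ℕ.^ n))
      ≡⟨ cong (λ z → T ℚ.* inv #Xₙ ℚ.- z ℚ.* (P ℚ.* inv (#X₀ ℕ.^ n))) rescale ⟩
    T ℚ.* inv #Xₙ ℚ.- (inv #Xₙ ℚ.* ι c) ℚ.* (P ℚ.* inv (#X₀ ℕ.^ n))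
      ≡⟨ solve 5 (λ T i c P y → T :* i :- (i :* c) :* (P :* y) := i :* (T :- c :* y :* P)) refl
           T (inv #Xₙ) (ι c) P (inv (#X₀ ℕ.^ n)) ⟩
    inv #Xₙ ℚ.* error ∎
    where
    open ≡-Reasoning
    T P : ℚ
    T = ι (#Transversal X U)
    P = ι ∏∣ U ∣

  error₂-bound : ∀ {t} → lam <ℝ fromℚ t → ∀ {p q} → 0ℚ ℚ.≤ p → 0ℚ ℚ.≤ q → p ℚ.* q ≡ 1ℚ → ∀ {i j} → i ≢ j →
    ℚ.∣ inv #Xₙ ℚ.* error ∣ ℚ.≤ ι (triangle n) ℚ.* ι (f) ℚ.*
      (½ ℚ.* t ℚ.* (p ℚ.* (inv #X₀ ℚ.* ι ∣ U i ∣) ℚ.+ q ℚ.* (inv #X₀ ℚ.* ι ∣ U j ∣)))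
  error₂-bound {t} lam<t {p} {q} 0≤p 0≤q pq≡1 {i} {j} i≢j = begin
    ℚ.∣ inv #Xₙ ℚ.* error ∣
      ≡⟨ trans (ℚ.∣p*q∣≡∣p∣*∣q∣ (inv #Xₙ) error) (cong (ℚ._* ℚ.∣ error ∣) (ℚ.0≤p⇒∣p∣≡p (inv-nonneg #Xₙ))) ⟩
    inv #Xₙ ℚ.* ℚ.∣ error ∣
      ≤⟨ ℚ.*-monoˡ-≤-nonNeg (inv #Xₙ) {{ℚ.nonNegative (inv-nonneg #Xₙ)}} (error-bound lam<t 0≤p 0≤q pq≡1 i≢j) ⟩
    inv #Xₙ ℚ.* (ι (triangle n) ℚ.* ι c ℚ.* Y)
      ≡⟨ solve 4 (λ i T c Y → i :* (T :* c :* Y) := T :* (i :* c) :* Y) refl (inv #Xₙ) (ι (triangle n)) (ι c) Y ⟩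
    ι (triangle n) ℚ.* (inv #Xₙ ℚ.* ι c) ℚ.* Y
      ≡⟨ cong (λ z → ι (triangle n) ℚ.* z ℚ.* Y) (sym rescale) ⟩
    ι (triangle n) ℚ.* (ι (f) ℚ.* inv #X₀) ℚ.* Y
      ≡⟨ solve 8 (λ T f x h p a q b → T :* (f :* x) :* (h :* (p :* a :+ q :* b)) := T :* f :* (h :* (p :* (x :* a) :+ q :* (x :* b)))) refl
           (ι (triangle n)) (ι (f)) (inv #X₀) (½ ℚ.* t) p (ι ∣ U i ∣) q (ι ∣ U j ∣) ⟩
    ι (triangle n) ℚ.* ι (f) ℚ.* (½ ℚ.* t ℚ.* (p ℚ.* (inv #X₀ ℚ.* ι ∣ U i ∣) ℚ.+ q ℚ.* (inv #X₀ ℚ.* ι ∣ U j ∣))) ∎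
    where
    open ℚ.≤-Reasoning
    Y : ℚ
    Y = ½ ℚ.* t ℚ.* (p ℚ.* ι ∣ U i ∣ ℚ.+ q ℚ.* ι ∣ U j ∣)

  deviation₁-bound : ∀ {t} → lam <ℝ fromℚ t → ∀ {p q} → 0ℚ ℚ.≤ p → 0ℚ ℚ.≤ q → p ℚ.* q ≡ 1ℚ → ∀ {i j} → i ≢ j →
    ℚ.∣ #Transversal X U ÷ 1 ℚ.- (c ÷ (#X₀ ℕ.^ n)) ℚ.* (∏∣ U ∣ ÷ 1) ∣
      ℚ.≤ ι (triangle n) ℚ.* ι c ℚ.* (½ ℚ.* t ℚ.* (p ℚ.* ι ∣ U i ∣ ℚ.+ q ℚ.* ι ∣ U j ∣))
  deviation₁-bound lam<t 0≤p 0≤q pq≡1 i≢j =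
    ℚ.≤-trans (ℚ.≤-reflexive (cong ℚ.∣_∣ deviation₁≡)) (error-bound lam<t 0≤p 0≤q pq≡1 i≢j)

  deviation₂-bound : ∀ {t} → lam <ℝ fromℚ t → ∀ {p q} → 0ℚ ℚ.≤ p → 0ℚ ℚ.≤ q → p ℚ.* q ≡ 1ℚ → ∀ {i j} → i ≢ j →
    ℚ.∣ #Transversal X U ÷ #Xₙ ℚ.- (f ÷ 1) ℚ.* (∏∣ U ∣ ÷ (#X₀ ℕ.^ suc n)) ∣
      ℚ.≤ ι (triangle n) ℚ.* ι f ℚ.* (½ ℚ.* t ℚ.* (p ℚ.* (inv #X₀ ℚ.* ι ∣ U i ∣) ℚ.+ q ℚ.* (inv #X₀ ℚ.* ι ∣ U j ∣)))
  deviation₂-bound lam<t 0≤p 0≤q pq≡1 i≢j =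
    ℚ.≤-trans (ℚ.≤-reflexive (cong ℚ.∣_∣ deviation₂≡)) (error₂-bound lam<t 0≤p 0≤q pq≡1 i≢j)

-- Square roots and passage to the limit

reciprocal : ∀ {y} → 0ℚ ℚ.< y → ∃[ i ] 0ℚ ℚ.≤ i × y ℚ.* i ≡ 1ℚ
reciprocal {y} y>0 = ℚ.1/ y , ℚ.<⇒≤ (ℚ.positive⁻¹ (ℚ.1/ y) {{ℚ.1/pos⇒pos y}}) , ℚ.*-inverseʳ y
  where
  instance
    y-pos : ℚ.Positive y
    y-pos = ℚ.positive y>0
    y≢0 : ℚ.NonZero y
    y≢0 = ℚ.pos⇒nonZero y

-- p = y/F balances pF and G/p; for F = 0 any large p will do.
optimise : ∀ {D E F G t y} → 0ℚ ℚ.≤ E → 0ℚ ℚ.≤ F → 0ℚ ℚ.≤ G → 0ℚ ℚ.≤ t → 0ℚ ℚ.< y → F ℚ.* G ℚ.≤ y ℚ.* y →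
  (∀ {p q} → 0ℚ ℚ.≤ p → 0ℚ ℚ.≤ q → p ℚ.* q ≡ 1ℚ → D ℚ.≤ E ℚ.* (½ ℚ.* t ℚ.* (p ℚ.* F ℚ.+ q ℚ.* G))) →
  D ℚ.≤ E ℚ.* (t ℚ.* y)
optimise {D} {E} {F} {G} {t} {y} 0≤E 0≤F 0≤G 0≤t y>0 FG≤y² bound = with-inverse (reciprocal y>0)
  where
  open ℚSolver.+-*-Solver
  0≤y : 0ℚ ℚ.≤ y
  0≤y = ℚ.<⇒≤ y>0
  finish : ∀ {p q} → 0ℚ ℚ.≤ p → 0ℚ ℚ.≤ q → p ℚ.* q ≡ 1ℚ → p ℚ.* F ℚ.≤ y → q ℚ.* G ℚ.≤ y → D ℚ.≤ E ℚ.* (t ℚ.* y)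
  finish {p} {q} 0≤p 0≤q pq≡1 pF≤y qG≤y = ℚ.≤-trans (bound 0≤p 0≤q pq≡1)
    (≤-by (0≤E ⊗ (ℚ.nonNegative⁻¹ ½ ⊗ 0≤t ⊗ (≤⇒0≤ pF≤y ⊕ ≤⇒0≤ qG≤y)))
      (solve 5 (λ E t y a b → E :* (t :* y) :- E :* (con ½ :* t :* (a :+ b)) := E :* (con ½ :* t :* ((y :- a) :+ (y :- b)))) refl
        E t y (p ℚ.* F) (q ℚ.* G)))
  with-inverse : ∃[ i ] 0ℚ ℚ.≤ i × y ℚ.* i ≡ 1ℚ → D ℚ.≤ E ℚ.* (t ℚ.* y)
  with-inverse (i , 0≤i , yi≡1) = by-cases (F ℚ.≟ 0ℚ)
    where
    by-cases : Dec (F ≡ 0ℚ) → D ℚ.≤ E ℚ.* (t ℚ.* y)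
    by-cases (no F≢0) = balance (reciprocal (0≤∧≢0⇒0< 0≤F F≢0))
      where
      balance : ∃[ j ] 0ℚ ℚ.≤ j × F ℚ.* j ≡ 1ℚ → D ℚ.≤ E ℚ.* (t ℚ.* y)
      balance (j , 0≤j , Fj≡1) = finish {y ℚ.* j} {F ℚ.* i} (0≤y ⊗ 0≤j) (0≤F ⊗ 0≤i)
        (trans (solve 4 (λ y j F i → y :* j :* (F :* i) := (y :* i) :* (F :* j)) refl y j F i) (cong₂ ℚ._*_ yi≡1 Fj≡1))
        (ℚ.≤-reflexive (trans (solve 3 (λ y j F → y :* j :* F := y :* (F :* j)) refl y j F)
          (trans (cong (y ℚ.*_) Fj≡1) (ℚ.*-identityʳ y))))
        (ℚ.≤-trans (≤-by (0≤i ⊗ ≤⇒0≤ FG≤y²)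
            (solve 4 (λ y i F G → y :* (y :* i) :- F :* i :* G := i :* (y :* y :- F :* G)) refl y i F G))
          (ℚ.≤-reflexive (trans (cong (y ℚ.*_) yi≡1) (ℚ.*-identityʳ y))))
    by-cases (yes F≡0) = spread (reciprocal (ℚ.+-mono-≤-< 0≤G (ℚ.positive⁻¹ 1ℚ)))
      where
      spread : ∃[ j ] 0ℚ ℚ.≤ j × (G ℚ.+ 1ℚ) ℚ.* j ≡ 1ℚ → D ℚ.≤ E ℚ.* (t ℚ.* y)
      -- Here p = (G + 1)/y and q = y/(G + 1), so that qG ≤ y also when G = 0.
      spread (j , 0≤j , Gj≡1) = finish {(G ℚ.+ 1ℚ) ℚ.* i} {y ℚ.* j} ((0≤G ⊕ ℚ.nonNegative⁻¹ 1ℚ) ⊗ 0≤i) (0≤y ⊗ 0≤j)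
        (trans (solve 4 (λ y j F i → F :* i :* (y :* j) := (y :* i) :* (F :* j)) refl y j (G ℚ.+ 1ℚ) i) (cong₂ ℚ._*_ yi≡1 Gj≡1))
        (ℚ.≤-trans (ℚ.≤-reflexive (trans (cong ((G ℚ.+ 1ℚ) ℚ.* i ℚ.*_) F≡0) (ℚ.*-zeroʳ ((G ℚ.+ 1ℚ) ℚ.* i)))) 0≤y)
        (ℚ.≤-trans (≤-by (0≤y ⊗ 0≤j)
            (solve 3 (λ y j G → y :* ((G :+ con 1ℚ) :* j) :- y :* j :* G := y :* j) refl y j G))
          (ℚ.≤-reflexive (trans (cong (y ℚ.*_) Gj≡1) (ℚ.*-identityʳ y))))

η : ℕ → ℚ
η k = inv (suc k)

η-pos : ∀ k → 0ℚ ℚ.< η k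
η-pos k = 0≤∧≢0⇒0< (inv-nonneg (suc k)) λ eq → ℚ.<⇒≢ (ℚ.positive⁻¹ 1ℚ)
  (trans (sym (ℚ.*-zeroˡ (ι (suc k)))) (trans (cong (ℚ._* ι (suc k)) (sym eq)) (inv-* {suc k} (λ ()))))

η-≤1 : ∀ k → η k ℚ.≤ 1ℚ
η-≤1 k = ℚ.≤-trans (ℚ.≤-reflexive (sym (ℚ.*-identityʳ (η k)))) (inv-≤1 (suc k) {1ℚ} (ι-mono {1} {suc k} (ℕ.s≤s ℕ.z≤n)))

η-small : ∀ {δ} → 0ℚ ℚ.< δ → Eventually (λ k → η k ℚ.≤ δ)
η-small {δ} δ>0 = from-inverse (reciprocal δ>0)
  where
  open ℚ.≤-Reasoning
  open ℚSolver.+-*-Solver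
  from-inverse : ∃[ i ] 0ℚ ℚ.≤ i × δ ℚ.* i ≡ 1ℚ → Eventually (λ k → η k ℚ.≤ δ)
  from-inverse (i , 0≤i , δi≡1) = ℤ.∣ ℚ.↥ i ∣ , λ k K≤k → begin
    η k                             ≡⟨ trans (cong (η k ℚ.*_) δi≡1) (ℚ.*-identityʳ (η k)) ⟨
    η k ℚ.* (δ ℚ.* i)               ≡⟨ solve 3 (λ h d i → h :* (d :* i) := h :* d :* i) refl (η k) δ i ⟩
    η k ℚ.* δ ℚ.* i                 ≤⟨ ℚ.*-monoˡ-≤-nonNeg (η k ℚ.* δ) {{ℚ.nonNegative (ℚ.<⇒≤ (η-pos k) ⊗ ℚ.<⇒≤ δ>0)}}
                                         (ℚ.≤-trans (≤ι∣↥∣ i) (ι-mono (ℕ.≤-trans K≤k (ℕ.n≤1+n k)))) ⟩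
    η k ℚ.* δ ℚ.* ι (suc k)         ≡⟨ solve 3 (λ h d s → h :* d :* s := (h :* s) :* d) refl (η k) δ (ι (suc k)) ⟩
    η k ℚ.* ι (suc k) ℚ.* δ         ≡⟨ trans (cong (ℚ._* δ) (inv-* {suc k} (λ ()))) (ℚ.*-identityˡ δ) ⟩
    δ                               ∎

-- Just what an upper estimate needs: x_k + 1/(k+1) is a positive rational at or above √r, hence an
-- admissible y in `optimise`.
record IsSquareRoot (x : ℝ) (r : ℚ) : Set where
  field
    nonneg : ∀ k → 0ℚ ℚ.≤ seq x k
    upper  : ∀ k → r ℚ.≤ (seq x k ℚ.+ η k) ℚ.* (seq x k ℚ.+ η k)

open IsSquareRoot

nonneg-÷ : ∀ {r} → 0ℚ ℚ.≤ r → r ≡ ℤ.∣ ℚ.↥ r ∣ ÷ ℚ.↧ₙ r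
nonneg-÷ {r@(mkℚ (+ a) d _)}    _   = sym (ℚ.↥p/↧p≡p r)
nonneg-÷ {r@(mkℚ -[1+ a ] d _)} 0≤r = ⊥-elim (ℚ.<-irrefl refl (ℚ.≤-<-trans 0≤r (ℚ.negative⁻¹ r)))

-- Writing r = a/d, the integer root R satisfies (R + 1)² > ad(k+1)². Division by d(k+1) turns R + 1
-- into x_k + 1/(d(k+1)), which is at most x_k + 1/(k+1).
√-isSquareRoot : ∀ {r} → 0ℚ ℚ.≤ r → IsSquareRoot (√ r) r
√-isSquareRoot {r} 0≤r = record
  { nonneg = λ k → subst (0ℚ ℚ.≤_) (sym (seq≡ k)) (inv-nonneg d ⊗ (ι-nonneg (root k) ⊗ inv-nonneg (suc k)))
  ; upper  = λ k → begin
      r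
        ≡⟨ trans (nonneg-÷ 0≤r) (÷≡ a d) ⟩
      ι a ℚ.* inv d
        ≡⟨ solve 2 (λ a i → a :* i := i :* a :* con 1ℚ :* (con 1ℚ :* con 1ℚ)) refl (ι a) (inv d) ⟩
      inv d ℚ.* ι a ℚ.* 1ℚ ℚ.* (1ℚ ℚ.* 1ℚ)
        ≡⟨ cong₂ (λ e h → inv d ℚ.* ι a ℚ.* e ℚ.* (h ℚ.* h)) (sym (inv-* d≢0)) (sym (inv-* {suc k} (λ ()))) ⟩
      inv d ℚ.* ι a ℚ.* (inv d ℚ.* ι d) ℚ.* (η k ℚ.* ι (suc k) ℚ.* (η k ℚ.* ι (suc k)))
        ≡⟨ solve 5 (λ i a d h s → i :* a :* (i :* d) :* (h :* s :* (h :* s)) := (i :* h) :* (i :* h) :* ((a :* d) :* (s :* s))) refl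
             (inv d) (ι a) (ι d) (η k) (ι (suc k)) ⟩
      (inv d ℚ.* η k) ℚ.* (inv d ℚ.* η k) ℚ.* ((ι a ℚ.* ι d) ℚ.* (ι (suc k) ℚ.* ι (suc k)))
        ≤⟨ ℚ.*-monoˡ-≤-nonNeg ((inv d ℚ.* η k) ℚ.* (inv d ℚ.* η k))
             {{ℚ.nonNegative (0≤sq (inv d ℚ.* η k))}} (ι-upper k) ⟩
      (inv d ℚ.* η k) ℚ.* (inv d ℚ.* η k) ℚ.* ((1ℚ ℚ.+ ι (root k)) ℚ.* (1ℚ ℚ.+ ι (root k)))
        ≤⟨ ≤-by (≤⇒0≤ (inv-d-≤1) ⊗ ℚ.<⇒≤ (η-pos k) ⊗ (0≤x k ⊕ ℚ.<⇒≤ (η-pos k) ⊕ (0≤x k ⊕ inv-nonneg d ⊗ ℚ.<⇒≤ (η-pos k))))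
             (solve 3 (λ i h R → (i :* (R :* h) :+ h) :* (i :* (R :* h) :+ h) :- (i :* h) :* (i :* h) :* ((con 1ℚ :+ R) :* (con 1ℚ :+ R))
                := (con 1ℚ :- i) :* h :* (i :* (R :* h) :+ h :+ (i :* (R :* h) :+ i :* h))) refl (inv d) (η k) (ι (root k))) ⟩
      (inv d ℚ.* (ι (root k) ℚ.* η k) ℚ.+ η k) ℚ.* (inv d ℚ.* (ι (root k) ℚ.* η k) ℚ.+ η k)
        ≡⟨ cong (λ x → (x ℚ.+ η k) ℚ.* (x ℚ.+ η k)) (sym (seq≡ k)) ⟩
      (seq (√ r) k ℚ.+ η k) ℚ.* (seq (√ r) k ℚ.+ η k) ∎
  }
  where
  open ℚ.≤-Reasoning
  open ℚSolver.+-*-Solver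
  a d : ℕ
  a = ℤ.∣ ℚ.↥ r ∣
  d = ℚ.↧ₙ r
  root : ℕ → ℕ
  root k = isqrt (a ℕ.* d ℕ.* (suc k ℕ.* suc k))
  d≢0 : d ≢ 0
  d≢0 ()
  seq≡ : ∀ k → seq (√ r) k ≡ inv d ℚ.* (ι (root k) ℚ.* η k)
  seq≡ k = cong (inv d ℚ.*_) (÷≡ (root k) (suc k))
  0≤x : ∀ k → 0ℚ ℚ.≤ inv d ℚ.* (ι (root k) ℚ.* η k)
  0≤x k = inv-nonneg d ⊗ (ι-nonneg (root k) ⊗ inv-nonneg (suc k))
  inv-d-≤1 : inv d ℚ.≤ 1ℚ
  inv-d-≤1 = ℚ.≤-trans (ℚ.≤-reflexive (sym (ℚ.*-identityʳ (inv d)))) (inv-≤1 d {1ℚ} (ι-mono {1} {d} (ℕ.s≤s ℕ.z≤n)))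
  ι-upper : ∀ k → (ι a ℚ.* ι d) ℚ.* (ι (suc k) ℚ.* ι (suc k)) ℚ.≤ (1ℚ ℚ.+ ι (root k)) ℚ.* (1ℚ ℚ.+ ι (root k))
  ι-upper k = begin
    (ι a ℚ.* ι d) ℚ.* (ι (suc k) ℚ.* ι (suc k))
      ≡⟨ cong₂ ℚ._*_ (sym (ι-* a d)) (sym (ι-* (suc k) (suc k))) ⟩
    ι (a ℕ.* d) ℚ.* ι (suc k ℕ.* suc k)
      ≡⟨ ι-* (a ℕ.* d) (suc k ℕ.* suc k) ⟨
    ι (a ℕ.* d ℕ.* (suc k ℕ.* suc k))
      ≤⟨ ι-mono (ℕ.<⇒≤ (isqrt-upper (a ℕ.* d ℕ.* (suc k ℕ.* suc k)))) ⟩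
    ι (suc (root k) ℕ.* suc (root k))
      ≡⟨ trans (ι-* (suc (root k)) (suc (root k))) (cong₂ ℚ._*_ (ι-+ 1 (root k)) (ι-+ 1 (root k))) ⟩
    (1ℚ ℚ.+ ι (root k)) ℚ.* (1ℚ ℚ.+ ι (root k)) ∎

pass-to-limit : ∀ {D E r} lam x → 0ℚ ℚ.≤ E → IsSquareRoot x r →
  (∀ {t} → lam <ℝ fromℚ t → ∀ {y} → 0ℚ ℚ.< y → r ℚ.≤ y ℚ.* y → D ℚ.≤ E ℚ.* (t ℚ.* y)) →
  ∀ ε → 0ℚ ℚ.< ε → Eventually (λ k → D ℚ.≤ E ℚ.* (seq lam k ℚ.* seq x k) ℚ.+ ε)
pass-to-limit {D} {E} {r} lam x 0≤E root bound ε ε>0 = go (bounded lam) (bounded x)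
  where
  open ℚSolver.+-*-Solver
  3ℚ : ℚ
  3ℚ = 1ℚ ℚ.+ 1ℚ ℚ.+ 1ℚ
  go : Bounded (seq lam) → Bounded (seq x) → Eventually (λ k → D ℚ.≤ E ℚ.* (seq lam k ℚ.* seq x k) ℚ.+ ε)
  go (L , L>0 , lam≤L) (B , B>0 , x≤B) = with-δ (split-off 0≤e ε>0)
    where
    e : ℚ
    -- With t ≤ λ_k + 3δ and η_k ≤ δ, the product t(x_k + η_k) exceeds λ_k·x_k by at most 3δB + Lδ +
    -- 3δ.
    e = E ℚ.* (3ℚ ℚ.* B ℚ.+ L ℚ.+ 3ℚ)
    0≤3 : 0ℚ ℚ.≤ 3ℚ
    0≤3 = ℚ.nonNegative⁻¹ 3ℚ
    0≤e : 0ℚ ℚ.≤ e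
    0≤e = 0≤E ⊗ (0≤3 ⊗ ℚ.<⇒≤ B>0 ⊕ ℚ.<⇒≤ L>0 ⊕ 0≤3)
    with-δ : ∃[ δ ] 0ℚ ℚ.< δ × e ℚ.* δ ℚ.+ δ ≡ ε → Eventually (λ k → D ℚ.≤ E ℚ.* (seq lam k ℚ.* seq x k) ℚ.+ ε)
    with-δ (δ , δ>0 , eδ+δ≡ε) = with-N (cauchy lam δ δ>0)
      where
      with-N : (∃[ M ] ∀ m n → M ℕ.≤ m → M ℕ.≤ n → ℚ.∣ seq lam m ℚ.- seq lam n ∣ ℚ.≤ δ) → _
      with-N (M , close) = eventually-map₂ estimate
          (M , λ k M≤k → close M k ℕ.≤-refl M≤k)
          (eventually-map₂ (λ _ → _,_) (η-small δ>0) (eventually-map₂ (λ _ → _,_) lam≤L x≤B))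
        where
        t : ℚ
        -- One δ covers the oscillation of the sequence after M, the other makes t strictly larger
        -- than the limit.
        t = seq lam M ℚ.+ δ ℚ.+ δ
        lam<t : lam <ℝ fromℚ t
        lam<t = δ , δ>0 , M , λ k M≤k → ≤-by (≤⇒0≤ (ℚ.≤-trans (≤∣∣ (seq lam k ℚ.- seq lam M)) (close k M M≤k ℕ.≤-refl)))
          (solve 3 (λ a b d → b :+ d :+ d :- (a :+ d) := d :- (a :- b)) refl (seq lam k) (seq lam M) δ)
        estimate : ∀ k → ℚ.∣ seq lam M ℚ.- seq lam k ∣ ℚ.≤ δ →
          η k ℚ.≤ δ × ℚ.∣ seq lam k ∣ ℚ.≤ L × ℚ.∣ seq x k ∣ ℚ.≤ B →
          D ℚ.≤ E ℚ.* (seq lam k ℚ.* seq x k) ℚ.+ ε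
        estimate k near (η≤δ , l≤L , x≤B) = ℚ.≤-trans
          (bound lam<t (ℚ.+-mono-≤-< (nonneg root k) (η-pos k)) (upper root k))
          (≤-by
            (0≤E ⊗ (≤⇒0≤ (ℚ.≤-trans (≤∣∣ (seq lam M ℚ.- seq lam k)) near) ⊗ (nonneg root k ⊕ 0≤η)
               ⊕ 0≤3 ⊗ ℚ.<⇒≤ δ>0 ⊗ ≤⇒0≤ (ℚ.≤-trans (≤∣∣ (seq x k)) x≤B)
               ⊕ (≤⇒0≤ (ℚ.≤-trans (≤∣∣ (seq lam k)) l≤L) ⊗ 0≤η ⊕ ℚ.<⇒≤ L>0 ⊗ ≤⇒0≤ η≤δ)
               ⊕ 0≤3 ⊗ ℚ.<⇒≤ δ>0 ⊗ ≤⇒0≤ (η-≤1 k)) ⊕ ℚ.<⇒≤ δ>0)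
            (trans (cong (λ z → E ℚ.* (seq lam k ℚ.* seq x k) ℚ.+ z ℚ.- E ℚ.* (t ℚ.* (seq x k ℚ.+ η k))) (sym eδ+δ≡ε))
              (solve 8 (λ E l x d m h B L → let three = con 3ℚ in
                  E :* (l :* x) :+ (E :* (three :* B :+ L :+ three) :* d :+ d) :- E :* ((m :+ d :+ d) :* (x :+ h))
                := E :* ((d :- (m :- l)) :* (x :+ h) :+ three :* d :* (B :- x) :+ ((L :- l) :* h :+ L :* (d :- h)) :+ three :* d :* (con 1ℚ :- h)) :+ d)
                refl E (seq lam k) (seq x k) δ (seq lam M) (η k) B L)))
          where
          0≤η : 0ℚ ℚ.≤ η k
          0≤η = ℚ.<⇒≤ (η-pos k)

module _ (P : ℕ → ℚ → Set) where

  EventuallyAt : ℝ → Set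
  EventuallyAt x = Eventually (λ k → P k (seq x k))

  -- Which of two reals attains the minimum cannot be decided, but at each index the rational
  -- minimum is one of its arguments. Hence the estimates are kept in the form of eventual
  -- inequalities between terms.
  ⊓-eventually : ∀ {x y} → EventuallyAt x → EventuallyAt y → EventuallyAt (x ⊓ℝ y)
  ⊓-eventually {x} {y} = eventually-map₂ λ k px py → by-cases k px py (ℚ.⊓-sel (seq x k) (seq y k))
    where
    by-cases : ∀ k → P k (seq x k) → P k (seq y k) →
      seq x k ℚ.⊓ seq y k ≡ seq x k ⊎ seq x k ℚ.⊓ seq y k ≡ seq y k → P k (seq x k ℚ.⊓ seq y k)
    by-cases k px py (inj₁ eq) = subst (P k) (sym eq) px
    by-cases k px py (inj₂ eq) = subst (P k) (sym eq) py

  min-eventually : ∀ {n} → 1 ℕ.≤ n → (f : Fin (suc n) → Fin (suc n) → ℝ) →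
    (∀ i j → i ≢ j → EventuallyAt (f i j)) → EventuallyAt (min⟨i<j⟩ f)
  min-eventually {suc n} _ f all = fold (List.cartesianProduct (allFin _) (allFin _))
    where
    Pairs : List (Fin (suc (suc n)) × Fin (suc (suc n))) → List (Fin (suc (suc n)) × Fin (suc (suc n)))
    Pairs = filter (λ (i , j) → i Fin.<? j)
    total : List (Fin (suc (suc n)) × Fin (suc (suc n))) → ℝ
    total ps = List.foldr _⊓ℝ_ (f zero (suc zero)) (List.map (λ (i , j) → f i j) ps)
    fold : ∀ ps → EventuallyAt (total (Pairs ps))
    -- The seed of the fold belongs to the pair 0 < 1, so it satisfies the same bound as the listed
    -- pairs.
    fold []             = all zero (suc zero) (λ ())
    fold ((i , j) ∷ ps) = by-cases (i Fin.<? j)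
      where
      by-cases : Dec (i Fin.< j) → EventuallyAt (total (Pairs ((i , j) ∷ ps)))
      by-cases (yes i<j) = subst (EventuallyAt ∘ total) (sym (List.filter-accept (λ (i , j) → i Fin.<? j) {xs = ps} i<j))
        (⊓-eventually {f i j} {total (Pairs ps)} (all i j (λ i≡j → Fin.<⇒≢ i<j i≡j)) (fold ps))
      by-cases (no ¬i<j) = subst (EventuallyAt ∘ total) (sym (List.filter-reject (λ (i , j) → i Fin.<? j) {xs = ps} ¬i<j)) (fold ps)

-- Comparison of n(n+1)/2 with Cₙ

triangle-sum : ∀ n → listSum (List.map suc (List.upTo n)) ≡ triangle n
triangle-sum zero    = refl
triangle-sum (suc n) = begin
  listSum (List.map suc (List.upTo (suc n)))
    ≡⟨ cong (listSum ∘ List.map suc) (List.upTo-∷ʳ n) ⟨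
  listSum (List.map suc (List.upTo n List.++ n ∷ []))
    ≡⟨ trans (cong listSum (List.map-++ suc (List.upTo n) (n ∷ []))) (ListAction.sum-++ (List.map suc (List.upTo n)) (suc n ∷ [])) ⟩
  listSum (List.map suc (List.upTo n)) ℕ.+ (suc n ℕ.+ 0)
    ≡⟨ cong₂ ℕ._+_ (triangle-sum n) (ℕ.+-identityʳ (suc n)) ⟩
  triangle n ℕ.+ suc n
    ≡⟨ ℕ.+-comm (triangle n) (suc n) ⟩
  triangle (suc n) ∎
  where open ≡-Reasoning

sum-≤-foldr : ∀ (g : ℕ → ℤ) ks → (∀ {k} → k List.∈ ks → + suc k ℤ.≤ g k) →
  + listSum (List.map suc ks) ℤ.≤ List.foldr ℤ._+_ (+ 0) (List.map g ks)
sum-≤-foldr g []       _ = ℤ.≤-refl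
sum-≤-foldr g (k ∷ ks) h = ℤ.+-mono-≤ (h (here refl)) (sum-≤-foldr g ks (λ k∈ → h (there k∈)))

-- The summand is (k+1)·((k+2)^e - (k+1)^e) with e = n - k, and the bracket is at least 1 because k
-- < n makes e positive.
term-≥ : ∀ {n k} → k ℕ.< n →
  + suc k ℤ.≤ + ((k ℕ.+ 1) ℕ.* (k ℕ.+ 2) ℕ.^ (n ℕ.∸ k)) ℤ.- + ((k ℕ.+ 1) ℕ.^ (n ℕ.∸ k ℕ.+ 1))
term-≥ {n} {k} k<n = subst (ℤ._≤ + a ℤ.- + b) (ℤ-cancel (+ suc k) (+ b))
  (ℤ.+-monoˡ-≤ (ℤ.- + b) (ℤ.+≤+ gap))
  where
  open ℕ.≤-Reasoning
  e a b : ℕ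
  e = n ℕ.∸ k
  a = (k ℕ.+ 1) ℕ.* (k ℕ.+ 2) ℕ.^ e
  b = (k ℕ.+ 1) ℕ.^ (e ℕ.+ 1)
  ℤ-cancel : ∀ i j → i ℤ.+ j ℤ.- j ≡ i
  ℤ-cancel i j = trans (ℤ.+-assoc i j (ℤ.- j)) (trans (cong (λ z → i ℤ.+ z) (ℤ.+-inverseʳ j)) (ℤ.+-identityʳ i))
  gap : suc k ℕ.+ b ℕ.≤ a
  gap = begin
    suc k ℕ.+ (k ℕ.+ 1) ℕ.^ (e ℕ.+ 1)
      ≡⟨ cong₂ ℕ._+_ (ℕ.+-comm 1 k) (cong ((k ℕ.+ 1) ℕ.^_) (ℕ.+-comm e 1)) ⟩
    (k ℕ.+ 1) ℕ.+ (k ℕ.+ 1) ℕ.* (k ℕ.+ 1) ℕ.^ e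
      ≡⟨ ℕ.*-suc (k ℕ.+ 1) ((k ℕ.+ 1) ℕ.^ e) ⟨
    (k ℕ.+ 1) ℕ.* suc ((k ℕ.+ 1) ℕ.^ e)
      ≤⟨ ℕ.*-monoʳ-≤ (k ℕ.+ 1) (ℕ.^-monoˡ-< e {{ℕ.>-nonZero (ℕ.m<n⇒0<n∸m k<n)}} (ℕ.+-monoʳ-< k (ℕ.n<1+n 1))) ⟩
    a ∎

triangle≤C : ∀ n → ι (triangle n) ℚ.≤ C n ℚ./ 1
triangle≤C n = subst₂ ℚ._≤_ (cong (ℚ._/ 1) (cong +_ (triangle-sum n))) refl
  (/1-mono (sum-≤-foldr _ (List.upTo n) (λ {k} k∈ → term-≥ (List.∈-upTo⁻ k∈))))
  where
  /1-mono : ∀ {i j} → i ℤ.≤ j → i ℚ./ 1 ℚ.≤ j ℚ./ 1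
  /1-mono {i} {j} i≤j = ℚ.toℚᵘ-cancel-≤ (ℚᵘ.≤-trans (ℚᵘ.≤-reflexive (ℚ.toℚᵘ-fromℚᵘ (ℚᵘ.mkℚᵘ i 0)))
    (ℚᵘ.≤-trans (ℚᵘ.*≤* (subst₂ ℤ._≤_ (sym (ℤ.*-identityʳ i)) (sym (ℤ.*-identityʳ j)) i≤j))
      (ℚᵘ.≤-reflexive (ℚᵘ.≃-sym (ℚ.toℚᵘ-fromℚᵘ (ℚᵘ.mkℚᵘ j 0))))))

-- From rational bounds to the real inequalities

open import Data.Nat.Base using (_*_; _^_; _≤_; _<_)

-- Common to both inequalities: F is |Uᵢ| with c = n!·K in one, and |Uᵢ|/|X(0)| with c = (n+1)! in
-- the other. The separate r keeps the radicand in the form in which the theorem states it.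
mixing-limit : ∀ {n} lam → 0ℝ <ℝ lam → 1 ℕ.≤ n → ∀ {D c} → 0ℚ ℚ.≤ c →
  (F : Fin (suc n) → ℚ) → (∀ i → 0ℚ ℚ.≤ F i) → (r : Fin (suc n) → Fin (suc n) → ℚ) → (∀ i j → r i j ≡ F i ℚ.* F j) →
  (∀ {t} → lam <ℝ fromℚ t → ∀ {p q} → 0ℚ ℚ.≤ p → 0ℚ ℚ.≤ q → p ℚ.* q ≡ 1ℚ → ∀ {i j} → i ≢ j →
    D ℚ.≤ ι (triangle n) ℚ.* c ℚ.* (½ ℚ.* t ℚ.* (p ℚ.* F i ℚ.+ q ℚ.* F j))) →
  ∀ ε → 0ℚ ℚ.< ε → Eventually (λ k →
    D ℚ.≤ (C n ℚ./ 1) ℚ.* c ℚ.* (seq lam k ℚ.* seq (min⟨i<j⟩ (λ i j → √ (r i j))) k) ℚ.+ ε)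
mixing-limit {n} lam 0<lam 1≤n {D} {c} 0≤c F 0≤F r r≡ bound ε ε>0 =
  min-eventually (λ k z → D ℚ.≤ E ℚ.* (seq lam k ℚ.* z) ℚ.+ ε) 1≤n (λ i j → √ (r i j)) at
  where
  open ℚSolver.+-*-Solver
  E : ℚ
  E = (C n ℚ./ 1) ℚ.* c
  0≤C : 0ℚ ℚ.≤ C n ℚ./ 1
  0≤C = ℚ.≤-trans (ι-nonneg (triangle n)) (triangle≤C n)
  at : ∀ i j → i ≢ j → Eventually (λ k → D ℚ.≤ E ℚ.* (seq lam k ℚ.* seq (√ (r i j)) k) ℚ.+ ε)
  at i j i≢j = pass-to-limit lam (√ (r i j)) (0≤C ⊗ 0≤c)
    (√-isSquareRoot (ℚ.≤-trans (0≤F i ⊗ 0≤F j) (ℚ.≤-reflexive (sym (r≡ i j))))) above ε ε>0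
    where
    above : ∀ {t} → lam <ℝ fromℚ t → ∀ {y} → 0ℚ ℚ.< y → r i j ℚ.≤ y ℚ.* y → D ℚ.≤ E ℚ.* (t ℚ.* y)
    above {t} lam<t {y} y>0 r≤y² = optimise {D} {E} {F i} {F j} {t} {y} (0≤C ⊗ 0≤c) (0≤F i) (0≤F j) 0≤t y>0
      (ℚ.≤-trans (ℚ.≤-reflexive (sym (r≡ i j))) r≤y²)
      λ {p} {q} 0≤p 0≤q pq≡1 → ℚ.≤-trans (bound lam<t 0≤p 0≤q pq≡1 i≢j)
        (≤-by (≤⇒0≤ (triangle≤C n) ⊗ 0≤c ⊗ (ℚ.nonNegative⁻¹ ½ ⊗ 0≤t ⊗ (0≤p ⊗ 0≤F i ⊕ 0≤q ⊗ 0≤F j)))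
          (solve 4 (λ C T c z → C :* c :* z :- T :* c :* z := (C :- T) :* c :* z) refl
            (C n ℚ./ 1) (ι (triangle n)) c (½ ℚ.* t ℚ.* (p ℚ.* F i ℚ.+ q ℚ.* F j))))
      where
      0≤t : 0ℚ ℚ.≤ t
      0≤t = ℚ.<⇒≤ (between-positive lam 0<lam lam<t)

module RealBound {n} (lam : ℝ) (0<lam : 0ℝ <ℝ lam) (1≤n : 1 ℕ.≤ n) (size : Fin (suc n) → ℕ) where

  open ℚSolver.+-*-Solver

  count-bound : ∀ D f K →
    (∀ {t} → lam <ℝ fromℚ t → ∀ {p q} → 0ℚ ℚ.≤ p → 0ℚ ℚ.≤ q → p ℚ.* q ≡ 1ℚ → ∀ {i j} → i ≢ j →
      D ℚ.≤ ι (triangle n) ℚ.* ι (f ℕ.* K) ℚ.* (½ ℚ.* t ℚ.* (p ℚ.* ι (size i) ℚ.+ q ℚ.* ι (size j)))) →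
    fromℚ D ≤ℝ fromℤ (C n) *ℝ fromℕ f *ℝ lam *ℝ fromℕ K *ℝ min⟨i<j⟩ (λ i j → √ ((size i ℕ.* size j) ÷ 1))
  count-bound D f K bound ε ε>0 = eventually-map rearrange
    (mixing-limit lam 0<lam 1≤n (ι-nonneg (f ℕ.* K)) (λ i → ι (size i)) (λ i → ι-nonneg (size i))
      (λ i j → (size i ℕ.* size j) ÷ 1) (λ i j → ι-* (size i) (size j)) bound ε ε>0)
    where
    m : ℕ → ℚ
    m k = seq (min⟨i<j⟩ (λ i j → √ ((size i ℕ.* size j) ÷ 1))) k
    rearrange : ∀ k → D ℚ.≤ (C n ℚ./ 1) ℚ.* ι (f ℕ.* K) ℚ.* (seq lam k ℚ.* m k) ℚ.+ ε →
      D ℚ.≤ (C n ℚ./ 1) ℚ.* ι f ℚ.* seq lam k ℚ.* ι K ℚ.* m k ℚ.+ ε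
    rearrange k h = ℚ.≤-trans h (ℚ.≤-reflexive (trans
      (cong (λ z → (C n ℚ./ 1) ℚ.* z ℚ.* (seq lam k ℚ.* m k) ℚ.+ ε) (ι-* f K))
      (solve 6 (λ C f K l m e → C :* (f :* K) :* (l :* m) :+ e := C :* f :* l :* K :* m :+ e) refl
        (C n ℚ./ 1) (ι f) (ι K) (seq lam k) (m k) ε)))

  density-bound : ∀ D f x →
    (∀ {t} → lam <ℝ fromℚ t → ∀ {p q} → 0ℚ ℚ.≤ p → 0ℚ ℚ.≤ q → p ℚ.* q ≡ 1ℚ → ∀ {i j} → i ≢ j →
      D ℚ.≤ ι (triangle n) ℚ.* ι f ℚ.* (½ ℚ.* t ℚ.* (p ℚ.* (inv x ℚ.* ι (size i)) ℚ.+ q ℚ.* (inv x ℚ.* ι (size j))))) →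
    fromℚ D ≤ℝ fromℤ (C n) *ℝ fromℕ f *ℝ lam *ℝ min⟨i<j⟩ (λ i j → √ ((size i ℕ.* size j) ÷ (x ℕ.^ 2)))
  density-bound D f x bound ε ε>0 = eventually-map rearrange
    (mixing-limit lam 0<lam 1≤n (ι-nonneg f) (λ i → inv x ℚ.* ι (size i)) (λ i → inv-nonneg x ⊗ ι-nonneg (size i))
      (λ i j → (size i ℕ.* size j) ÷ (x ℕ.^ 2)) square bound ε ε>0)
    where
    m : ℕ → ℚ
    m k = seq (min⟨i<j⟩ (λ i j → √ ((size i ℕ.* size j) ÷ (x ℕ.^ 2)))) k
    square : ∀ i j → (size i ℕ.* size j) ÷ (x ℕ.^ 2) ≡ inv x ℚ.* ι (size i) ℚ.* (inv x ℚ.* ι (size j))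
    square i j = trans (÷≡ (size i ℕ.* size j) (x ℕ.^ 2)) (trans
      (cong₂ ℚ._*_ (ι-* (size i) (size j)) (trans (cong (λ y → inv (x ℕ.* y)) (ℕ.*-identityʳ x)) (inv-homo x x)))
      (solve 3 (λ a b i → a :* b :* (i :* i) := i :* a :* (i :* b)) refl (ι (size i)) (ι (size j)) (inv x)))
    rearrange : ∀ k → D ℚ.≤ (C n ℚ./ 1) ℚ.* ι f ℚ.* (seq lam k ℚ.* m k) ℚ.+ ε →
      D ℚ.≤ (C n ℚ./ 1) ℚ.* ι f ℚ.* seq lam k ℚ.* m k ℚ.+ ε
    rearrange k h = ℚ.≤-trans h (ℚ.≤-reflexive
      (cong (ℚ._+ ε) (sym (ℚ.*-assoc ((C n ℚ./ 1) ℚ.* ι f) (seq lam k) (m k)))))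

  bounds : ∀ T P x₀ xₙ f₁ f₂ K →
    let D₁ = ℚ.∣ T ÷ 1 ℚ.- ((f₁ * K) ÷ (x₀ ^ n)) ℚ.* (P ÷ 1) ∣
        D₂ = ℚ.∣ T ÷ xₙ ℚ.- (f₂ ÷ 1) ℚ.* (P ÷ (x₀ ^ suc n)) ∣
    in
    (∀ {t} → lam <ℝ fromℚ t → ∀ {p q} → 0ℚ ℚ.≤ p → 0ℚ ℚ.≤ q → p ℚ.* q ≡ 1ℚ → ∀ {i j} → i ≢ j →
      D₁ ℚ.≤ ι (triangle n) ℚ.* ι (f₁ * K) ℚ.* (½ ℚ.* t ℚ.* (p ℚ.* ι (size i) ℚ.+ q ℚ.* ι (size j)))) →
    (∀ {t} → lam <ℝ fromℚ t → ∀ {p q} → 0ℚ ℚ.≤ p → 0ℚ ℚ.≤ q → p ℚ.* q ≡ 1ℚ → ∀ {i j} → i ≢ j →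
      D₂ ℚ.≤ ι (triangle n) ℚ.* ι f₂ ℚ.* (½ ℚ.* t ℚ.* (p ℚ.* (inv x₀ ℚ.* ι (size i)) ℚ.+ q ℚ.* (inv x₀ ℚ.* ι (size j))))) →
    (fromℚ D₁ ≤ℝ fromℤ (C n) *ℝ fromℕ f₁ *ℝ lam *ℝ fromℕ K *ℝ min⟨i<j⟩ (λ i j → √ ((size i * size j) ÷ 1)))
    × (fromℚ D₂ ≤ℝ fromℤ (C n) *ℝ fromℕ f₂ *ℝ lam *ℝ min⟨i<j⟩ (λ i j → √ ((size i * size j) ÷ (x₀ ^ 2))))
  bounds T P x₀ xₙ f₁ f₂ K bound₁ bound₂ =
      count-bound ℚ.∣ T ÷ 1 ℚ.- ((f₁ * K) ÷ (x₀ ^ n)) ℚ.* (P ÷ 1) ∣ f₁ K bound₁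
    , density-bound ℚ.∣ T ÷ xₙ ℚ.- (f₂ ÷ 1) ℚ.* (P ÷ (x₀ ^ suc n)) ∣ f₂ x₀ bound₂

corollary7p2 :
    ∀ {N : ℕ} (n : ℕ) (X : SimplicialComplex N) (K : ℕ) (lam : ℝ) →
    1 ≤ n →
    Pure X n →
    ConnectedLinks X n →
    Regular X n K →
    0ℝ <ℝ lam →
    lam <ℝ 1ℝ →
    (∀ k τ → k < n → ((τ∈X , _) : (X ⟨ k ⟩) τ) →
       ∀ μ → InSpec X n τ∈X μ → ((-ℝ lam) ≤ℝ μ × μ ≤ℝ lam) ⊎ (μ ≃ 1ℝ)) →
    (U : Fin (suc n) → Subset N) →
    (∀ i v → v ∈ U i → IsVertex X v) →
    (∀ i j → i ≢ j → Empty (U i ∩ U j)) →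
    let #X₀ = count (X ⟨ 1 ⟩?)
        #Xₙ = count (X ⟨ suc n ⟩?)
    in
    (fromℚ ℚ.∣ #Transversal X U ÷ 1 ℚ.- ((n ! * K) ÷ (#X₀ ^ n)) ℚ.* (∏∣ U ∣ ÷ 1) ∣
       ≤ℝ fromℤ (C n) *ℝ fromℕ (n !) *ℝ lam *ℝ fromℕ K
            *ℝ min⟨i<j⟩ (λ i j → √ ((∣ U i ∣ * ∣ U j ∣) ÷ 1)))
    ×
    (fromℚ ℚ.∣ #Transversal X U ÷ #Xₙ ℚ.- ((suc n) ! ÷ 1) ℚ.* (∏∣ U ∣ ÷ (#X₀ ^ suc n)) ∣
       ≤ℝ fromℤ (C n) *ℝ fromℕ ((suc n) !) *ℝ lam
            *ℝ min⟨i<j⟩ (λ i j → √ ((∣ U i ∣ * ∣ U j ∣) ÷ (#X₀ ^ 2))))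
corollary7p2 {N} n X K lam 1≤n pure connected regular 0<lam _ spectrum U vertices disjoint =
  bounds (#Transversal X U) ∏∣ U ∣ (count {P = X ⟨ 1 ⟩} (X ⟨ 1 ⟩?)) (count {P = X ⟨ suc n ⟩} (X ⟨ suc n ⟩?)) (n !) (suc n !) K
    Bound.deviation₁-bound Bound.deviation₂-bound
  where
  open RealBound lam 0<lam 1≤n (λ i → ∣ U i ∣)
  module Count = Counts X n K regular
  module Bound = RationalBound X pure connected lam 0<lam spectrum U vertices disjoint
    (count {P = X ⟨ 1 ⟩} (X ⟨ 1 ⟩?)) (count {P = X ⟨ suc n ⟩} (X ⟨ suc n ⟩?)) (n ! * K) (suc n !) Count.w-vertex Count.w[]-vertices Count.w[]-facets
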